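{- There is a polynomial $p$ such that the following holds for all $\epsilon,\delta\in(0,1)$ and all $n$. Let $\mu$ be a known distribution over $[n]$. If $\|\mu-U_n\|_\infty<\frac{\epsilon}{8n}$, where $U_n$ is the uniform distribution over $[n]$, then identity with $\mu$ can be tested by a non-adaptive algorithm using at most $p(\log n,\epsilon^{ -1},\log(\delta^{ -1}))$ conditional samples: given conditional sample access to an unknown distribution $\mu'$ over $[n]$, the algorithm accepts with probability at least $1-\delta$ if $\mu'=\mu$, and rejects with probability at least $1-\delta$ if $d(\mu,\mu')\ge\epsilon$.
   Context: $[n]=\{1,\ldots,n\}$; $U_n(i)=1/n$; $\|\mu-U_n\|_\infty=\max_i|\mu(i)-1/n|$; the variation distance is $d(\mu,\mu')=\frac12\sum_{i=1}^n|\mu(i)-\mu'(i)|$. A conditional sample from $\mu'$ with a nonempty set $A\subseteq[n]$ is an element $j\in A$ drawn with probability $\mu'(j)/\mu'(A)$ if $\mu'(A)>0$, and uniformly from $A$ if $\mu'(A)=0$, independently of all previous samples. A non-adaptive algorithm is a randomized algorithm that generates all of its conditioning sets $A_1,\ldots,A_t$ before receiving any sample, then receives one conditional sample for each $A_i$, and finally accepts or rejects based on the received samples and its internal coin tosses. The algorithm is given $\mu,\epsilon,\delta,n$ explicitly. -}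

module Defs where

open import Algebra.Bundles using (CommutativeRing)
open import Algebra.Solver.Ring.AlmostCommutativeRing using (fromCommutativeRing)
import Algebra.Construct.NaturalChoice.Max as Max
import Algebra.Properties.CommutativeMonoid.Sum as Sum
import Algebra.Properties.Ring as RingProperties
import Algebra.Properties.Semiring.Exp as Exp
import Algebra.Properties.Semiring.Mult as Mult
import Algebra.Solver.Ring.Simple as Solver
open import Data.Bool.Base using (if_then_else_)
open import Data.Fin.Base using (Fin)
open import Data.Fin.Subset using (Subset; Nonempty; ∣_∣)
open import Data.Fin.Subset.Properties using (_∈?_)
open import Data.Nat.Base as ℕ using (ℕ; zero; suc; NonZero)
open import Data.Nat.DivMod using (m≡m%n+[m/n]*n; m%n<n; m/n*n≤m)
import Data.Nat.Properties as ℕ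
open import Data.Product using (∃; Σ; _×_; _,_; proj₁; proj₂)
open import Data.Sum.Base using (inj₁; inj₂)
open import Data.Vec.Base using (Vec; []; _∷_)
import Data.Vec.Functional as Vector
open import Level using (0ℓ) renaming (suc to lsuc)
open import Relation.Binary.Bundles using (StrictTotalOrder; TotalOrder; DecTotalOrder)
open import Relation.Binary.Core using (Rel)
open import Relation.Binary.Definitions using (tri<; tri≈; tri>)
import Relation.Binary.Construct.StrictToNonStrict as StrictToNonStrict
import Relation.Binary.Properties.StrictTotalOrder as StrictTotalOrderProperties
import Relation.Binary.Reasoning.StrictPartialOrder as OrderReasoning
open import Relation.Binary.PropositionalEquality as ≡ using (_≡_)
open import Relation.Binary.Structures using (IsStrictTotalOrder)
open import Relation.Nullary using (¬_; does; yes; no; contradiction)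
open import Relation.Unary using (Pred)

-- The real numbers, characterised (up to unique isomorphism) as a complete
-- ordered field.  The axioms are the classical ones: the order is decidable and
-- every inhabited set that is bounded above has a supremum, in the sense that
-- anything below the supremum is below some element of the set.

record Reals : Set (lsuc 0ℓ) where
  infix 4 _<_
  infix 9 _⁻¹
  field
    commutativeRing : CommutativeRing 0ℓ 0ℓ

  open CommutativeRing commutativeRing public
    renaming (zero to *-zero)

  field
    _<_                : Rel Carrier 0ℓ
    isStrictTotalOrder : IsStrictTotalOrder _≈_ _<_
    0<1                : 0# < 1#
    +-monoˡ-<          : ∀ {x y} z → x < y → x + z < y + z
    *-pos              : ∀ {x y} → 0# < x → 0# < y → 0# < x * y
    -- 0# ⁻¹ is an unspecified value.
    _⁻¹                : Carrier → Carrier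
    *-inverseʳ         : ∀ {x} → ¬ x ≈ 0# → x * x ⁻¹ ≈ 1#

  open StrictToNonStrict _≈_ _<_ public using (_≤_; <⇒≤)

  IsSupremum : Pred Carrier 0ℓ → Carrier → Set
  IsSupremum P s = (∀ x → P x → x ≤ s) × (∀ y → y < s → ∃ λ x → P x × y < x)

  field
    complete : (P : Pred Carrier 0ℓ) → ∃ P →
               (∃ λ b → ∀ x → P x → x ≤ b) → ∃ (IsSupremum P)

  strictTotalOrder : StrictTotalOrder 0ℓ 0ℓ 0ℓ
  strictTotalOrder = record { isStrictTotalOrder = isStrictTotalOrder }

  open StrictTotalOrder strictTotalOrder public
    using (compare; _≟_; _<?_; strictPartialOrder)
    renaming (irrefl to <-irrefl; trans to <-trans; asym to <-asym)

  decTotalOrder : DecTotalOrder 0ℓ 0ℓ 0ℓ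
  decTotalOrder = StrictTotalOrderProperties.decTotalOrder strictTotalOrder

  open DecTotalOrder decTotalOrder public
    using (_≤?_; totalOrder)
    renaming (refl to ≤-refl; reflexive to ≤-reflexive; trans to ≤-trans;
              total to ≤-total; antisym to ≤-antisym)

  open Max totalOrder public using (_⊔_)
  open Exp semiring public using (_^_)
  open Mult semiring public using () renaming (_×_ to _·_)
  open Sum +-commutativeMonoid public using (sum; sum-syntax)

  open Solver (fromCommutativeRing commutativeRing) _≟_ public
    using (Polynomial; ⟦_⟧)

  fromℕ : ℕ → Carrier
  fromℕ n = n · 1#

  ∣_∣ᴿ : Carrier → Carrier
  ∣ x ∣ᴿ = x ⊔ - x

  private
    open module R = OrderReasoning strictPartialOrder

    module M = Mult semiring
    module E = Exp semiring

    +-monoʳ-< : ∀ {x y} z → x < y → z + x < z + y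
    +-monoʳ-< {x} {y} z x<y = begin-strict
      z + x ≈⟨ +-comm z x ⟩
      x + z <⟨ +-monoˡ-< z x<y ⟩
      y + z ≈⟨ +-comm y z ⟩
      z + y ∎

    x<y⇒0<y-x : ∀ {x y} → x < y → 0# < y - x
    x<y⇒0<y-x {x} {y} x<y = begin-strict
      0#    ≈⟨ -‿inverseʳ x ⟨
      x - x <⟨ +-monoˡ-< (- x) x<y ⟩
      y - x ∎

    y-x+x≈y : ∀ x y → (y - x) + x ≈ y
    y-x+x≈y x y = trans (+-assoc y (- x) x)
                 (trans (+-congˡ (-‿inverseˡ x)) (+-identityʳ y))

    *-monoʳ-< : ∀ {x y} z → 0# < z → x < y → x * z < y * z
    *-monoʳ-< {x} {y} z 0<z x<y = begin-strict
      x * z                 ≈⟨ +-identityˡ (x * z) ⟨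
      0# + x * z            <⟨ +-monoˡ-< (x * z) (*-pos (x<y⇒0<y-x x<y) 0<z) ⟩
      (y - x) * z + x * z   ≈⟨ distribʳ z (y - x) x ⟨
      ((y - x) + x) * z     ≈⟨ *-congʳ (y-x+x≈y x y) ⟩
      y * z                 ∎

    *-monoʳ-≤ : ∀ {x y} z → 0# < z → x ≤ y → x * z ≤ y * z
    *-monoʳ-≤ z 0<z (inj₁ x<y) = <⇒≤ (*-monoʳ-< z 0<z x<y)
    *-monoʳ-≤ z 0<z (inj₂ x≈y) = ≤-reflexive (*-congʳ x≈y)

    <⇒≱ : ∀ {x y} → x < y → ¬ y ≤ x
    <⇒≱ x<y (inj₁ y<x) = <-asym x<y y<x
    <⇒≱ x<y (inj₂ y≈x) = <-irrefl (sym y≈x) x<y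

    ≰⇒> : ∀ {x y} → ¬ x ≤ y → y < x
    ≰⇒> {x} {y} x≰y with ≤-total x y
    ... | inj₁ x≤y        = contradiction x≤y x≰y
    ... | inj₂ (inj₁ y<x) = y<x
    ... | inj₂ (inj₂ y≈x) = contradiction (≤-reflexive (sym y≈x)) x≰y

    *-mono-< : ∀ {x y u v} → 0# < y → 0# < u → x < y → u < v → x * u < y * v
    *-mono-< {x} {y} {u} {v} 0<y 0<u x<y u<v = begin-strict
      x * u <⟨ *-monoʳ-< u 0<u x<y ⟩
      y * u ≈⟨ *-comm y u ⟩
      u * y <⟨ *-monoʳ-< y 0<y u<v ⟩
      v * y ≈⟨ *-comm v y ⟩
      y * v ∎

    ^-pos : ∀ {x} k → 0# < x → 0# < x ^ k
    ^-pos zero    0<x = 0<1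
    ^-pos (suc k) 0<x = *-pos 0<x (^-pos k 0<x)

    ^-mono-< : ∀ {x y} k → 0# < x → x < y → x ^ suc k < y ^ suc k
    ^-mono-< {x} {y} zero 0<x x<y = begin-strict
      x * 1# ≈⟨ *-identityʳ x ⟩
      x      <⟨ x<y ⟩
      y      ≈⟨ *-identityʳ y ⟨
      y * 1# ∎
    ^-mono-< (suc k) 0<x x<y =
      *-mono-< (<-trans 0<x x<y) (^-pos (suc k) 0<x) x<y (^-mono-< k 0<x x<y)

    fromℕ-suc : ∀ n → fromℕ n < fromℕ (suc n)
    fromℕ-suc n = begin-strict
      fromℕ n       ≈⟨ +-identityˡ (fromℕ n) ⟨
      0# + fromℕ n  <⟨ +-monoˡ-< (fromℕ n) 0<1 ⟩
      1# + fromℕ n  ∎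

    fromℕ-≤′ : ∀ {m n} → m ℕ.≤′ n → fromℕ m ≤ fromℕ n
    fromℕ-≤′ (ℕ.≤′-reflexive ≡.refl) = ≤-refl
    fromℕ-≤′ (ℕ.≤′-step {n} m≤n) = ≤-trans (fromℕ-≤′ m≤n) (<⇒≤ (fromℕ-suc n))

    fromℕ-^ : ∀ m k → fromℕ (m ℕ.^ k) ≈ fromℕ m ^ k
    fromℕ-^ m zero    = +-identityʳ 1#
    fromℕ-^ m (suc k) = trans (M.×1-homo-* m (m ℕ.^ k)) (*-congˡ (fromℕ-^ m k))

  fromℕ-mono-≤ : ∀ {m n} → m ℕ.≤ n → fromℕ m ≤ fromℕ n
  fromℕ-mono-≤ m≤n = fromℕ-≤′ (ℕ.≤⇒≤′ m≤n)

  1≤fromℕ : ∀ n .{{_ : NonZero n}} → 1# ≤ fromℕ n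
  1≤fromℕ n = begin
    1#       ≈⟨ +-identityʳ 1# ⟨
    fromℕ 1  ≤⟨ fromℕ-mono-≤ (ℕ.>-nonZero⁻¹ n) ⟩
    fromℕ n  ∎

  0<fromℕ : ∀ n .{{_ : NonZero n}} → 0# < fromℕ n
  0<fromℕ n = begin-strict
    0#      <⟨ 0<1 ⟩
    1#      ≤⟨ 1≤fromℕ n ⟩
    fromℕ n ∎

  pos⇒≉0 : ∀ {x} → 0# < x → ¬ x ≈ 0#
  pos⇒≉0 0<x x≈0 = <-irrefl (sym x≈0) 0<x

  1≤⁻¹ : ∀ {x} → 0# < x → x < 1# → 1# ≤ x ⁻¹
  1≤⁻¹ {x} 0<x x<1 with 1# ≤? x ⁻¹
  ... | yes 1≤x⁻¹ = 1≤x⁻¹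
  ... | no  1≰x⁻¹ = contradiction (begin-strict
    1#         ≈⟨ *-inverseʳ (pos⇒≉0 0<x) ⟨
    x * x ⁻¹   ≈⟨ *-comm x (x ⁻¹) ⟩
    x ⁻¹ * x   <⟨ *-monoʳ-< x 0<x (≰⇒> 1≰x⁻¹) ⟩
    1# * x     ≈⟨ *-identityˡ x ⟩
    x          <⟨ x<1 ⟩
    1#         ∎) (<-irrefl refl)

  -- The rationals m / k with 0 ≤ m / k ≤ log₂ x, the latter being equivalent
  -- to 2ᵐ ≤ xᵏ.
  BelowLog₂ : Carrier → Pred Carrier 0ℓ
  BelowLog₂ x y = ∃ λ m → ∃ λ k → NonZero k ×
    y ≈ fromℕ m * fromℕ k ⁻¹ × fromℕ 2 ^ m ≤ x ^ k

  private
    n<2^n : ∀ n → n ℕ.< 2 ℕ.^ n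
    n<2^n zero    = ℕ.s≤s ℕ.z≤n
    n<2^n (suc n) = ℕ.≤-trans
      (ℕ.+-mono-≤ (ℕ.>-nonZero⁻¹ (2 ℕ.^ n) {{ℕ.m^n≢0 2 n}}) (n<2^n n))
      (ℕ.+-monoʳ-≤ (2 ℕ.^ n) (ℕ.m≤m+n (2 ℕ.^ n) 0))

    zero-below : ∀ {x} → 1# ≤ x → BelowLog₂ x 0#
    zero-below {x} 1≤x = 0 , 1 , _ , sym (zeroˡ _) , (begin
      1#     ≤⟨ 1≤x ⟩
      x      ≈⟨ *-identityʳ x ⟨
      x * 1# ∎)

    below-bounded : ∀ {x} → 1# ≤ x → ∀ y → BelowLog₂ x y → y ≤ x
    below-bounded {x} 1≤x y (m , suc k-1 , _ , y≈m/k , 2^m≤x^k) with y ≤? x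
    ... | yes y≤x = y≤x
    ... | no  y≰x = contradiction x^k<2^m (λ lt → <⇒≱ lt 2^m≤x^k)
      where
      k = suc k-1
      q = m ℕ./ k

      0<x : 0# < x
      0<x = begin-strict 0# <⟨ 0<1 ⟩ 1# ≤⟨ 1≤x ⟩ x ∎

      m≤[1+q]k : m ℕ.≤ suc q ℕ.* k
      m≤[1+q]k = ℕ.≤-trans (ℕ.≤-reflexive (m≡m%n+[m/n]*n m k))
        (ℕ.+-monoˡ-≤ (q ℕ.* k) (ℕ.<⇒≤ (m%n<n m k)))

      [1+q]^k≤2^m : suc q ℕ.^ k ℕ.≤ 2 ℕ.^ m
      [1+q]^k≤2^m = ℕ.≤-trans (ℕ.^-monoˡ-≤ k (n<2^n q))
        (ℕ.≤-trans (ℕ.≤-reflexive (ℕ.^-*-assoc 2 q k))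
                   (ℕ.^-monoʳ-≤ 2 (m/n*n≤m m k)))

      yk≈m : y * fromℕ k ≈ fromℕ m
      yk≈m = begin-equality
        y * fromℕ k                      ≈⟨ *-congʳ y≈m/k ⟩
        fromℕ m * fromℕ k ⁻¹ * fromℕ k   ≈⟨ *-assoc _ _ _ ⟩
        fromℕ m * (fromℕ k ⁻¹ * fromℕ k) ≈⟨ *-congˡ (*-comm _ _) ⟩
        fromℕ m * (fromℕ k * fromℕ k ⁻¹) ≈⟨ *-congˡ (*-inverseʳ (pos⇒≉0 (0<fromℕ k))) ⟩
        fromℕ m * 1#                     ≈⟨ *-identityʳ _ ⟩
        fromℕ m                          ∎

      x<1+q : x < fromℕ (suc q)
      x<1+q with fromℕ (suc q) ≤? x
      ... | no  1+q≰x = ≰⇒> 1+q≰x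
      ... | yes 1+q≤x = contradiction (begin-strict
        fromℕ m                   ≤⟨ fromℕ-mono-≤ m≤[1+q]k ⟩
        fromℕ (suc q ℕ.* k)       ≈⟨ M.×1-homo-* (suc q) k ⟩
        fromℕ (suc q) * fromℕ k   ≤⟨ *-monoʳ-≤ _ (0<fromℕ k) 1+q≤x ⟩
        x * fromℕ k               <⟨ *-monoʳ-< _ (0<fromℕ k) (≰⇒> y≰x) ⟩
        y * fromℕ k               ≈⟨ yk≈m ⟩
        fromℕ m                   ∎) (<-irrefl refl)

      x^k<2^m : x ^ k < fromℕ 2 ^ m
      x^k<2^m = begin-strict
        x ^ k                  <⟨ ^-mono-< k-1 0<x x<1+q ⟩
        fromℕ (suc q) ^ k      ≈⟨ fromℕ-^ (suc q) k ⟨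
        fromℕ (suc q ℕ.^ k)    ≤⟨ fromℕ-mono-≤ [1+q]^k≤2^m ⟩
        fromℕ (2 ℕ.^ m)        ≈⟨ fromℕ-^ 2 m ⟩
        fromℕ 2 ^ m            ∎

  log₂-supremum : ∀ x → 1# ≤ x → ∃ (IsSupremum (BelowLog₂ x))
  log₂-supremum x 1≤x =
    complete (BelowLog₂ x) (0# , zero-below 1≤x) (x , below-bounded 1≤x)

  log₂ : ∀ x → 1# ≤ x → Carrier
  log₂ x 1≤x = proj₁ (log₂-supremum x 1≤x)

module Testing (ℝ : Reals) where

  open Reals ℝ public

  -- Fin n plays the role of [n] = {1, …, n}.
  record Distribution (n : ℕ) : Set where
    field
      prob   : Fin n → Carrier
      nonneg : ∀ i → 0# ≤ prob i
      total  : ∑[ i < n ] prob i ≈ 1#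

  open Distribution public

  uniform : ∀ n .{{_ : NonZero n}} → Distribution n
  uniform n = record
    { prob   = λ _ → fromℕ n ⁻¹
    ; nonneg = λ _ → 0≤1/n
    ; total  = trans (sum-replicate n) n·1/n≈1
    }
    where
    open Sum +-commutativeMonoid using (sum-replicate)
    open OrderReasoning strictPartialOrder

    n·1/n≈1 : n · (fromℕ n ⁻¹) ≈ 1#
    n·1/n≈1 = begin-equality
      n · (fromℕ n ⁻¹)        ≈⟨ Mult.×-congʳ semiring n (*-identityˡ _) ⟨
      n · (1# * fromℕ n ⁻¹)   ≈⟨ Mult.×-assoc-* semiring n 1# _ ⟨
      fromℕ n * fromℕ n ⁻¹    ≈⟨ *-inverseʳ (pos⇒≉0 (0<fromℕ n)) ⟩
      1#                      ∎

    neg : ∀ {x} m → x < 0# → m · x ≤ 0#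
    neg zero    x<0 = ≤-refl
    neg {x} (suc m) x<0 = begin
      x + m · x   <⟨ +-monoˡ-< (m · x) x<0 ⟩
      0# + m · x  ≈⟨ +-identityˡ _ ⟩
      m · x       ≤⟨ neg m x<0 ⟩
      0#          ∎

    0≤1/n : 0# ≤ fromℕ n ⁻¹
    0≤1/n with compare 0# (fromℕ n ⁻¹)
    ... | tri< 0<y _ _ = inj₁ 0<y
    ... | tri≈ _ 0≈y _ = inj₂ 0≈y
    ... | tri> _ _ y<0 = contradiction (begin-strict
      0#                <⟨ 0<1 ⟩
      1#                ≈⟨ n·1/n≈1 ⟨
      n · (fromℕ n ⁻¹)  ≤⟨ neg n y<0 ⟩
      0#                ∎) (<-irrefl refl)

  _≈ᵈ_ : ∀ {n} → Distribution n → Distribution n → Set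
  μ ≈ᵈ μ′ = ∀ i → prob μ i ≈ prob μ′ i

  -- Starting the maximum at 0# is harmless: the entries are nonnegative.
  ‖_-_‖∞ : ∀ {n} → Distribution n → Distribution n → Carrier
  ‖ μ - μ′ ‖∞ = Vector.foldr _⊔_ 0# (λ i → ∣ prob μ i - prob μ′ i ∣ᴿ)

  variationDistance : ∀ {n} → Distribution n → Distribution n → Carrier
  variationDistance {n} μ μ′ =
    fromℕ 2 ⁻¹ * (∑[ i < n ] ∣ prob μ i - prob μ′ i ∣ᴿ)

  ConditioningSet : ℕ → Set
  ConditioningSet n = Σ (Subset n) Nonempty

  mass : ∀ {n} → Distribution n → Subset n → Carrier
  mass {n} μ A = ∑[ i < n ] (if does (i ∈? A) then prob μ i else 0#)

  conditional : ∀ {n} → Distribution n → ConditioningSet n → Fin n → Carrier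
  conditional μ (A , _) j =
    if does (j ∈? A)
    then (if does (0# <? mass μ A)
          then prob μ j * mass μ A ⁻¹
          else fromℕ ∣ A ∣ ⁻¹)
    else 0#

  -- The expectation of f (j₁ ∷ … ∷ jₜ ∷ []) for independent conditional
  -- samples jᵢ with sets Aᵢ.
  expectation : ∀ {n t} → Distribution n → Vec (ConditioningSet n) t →
                (Vec (Fin n) t → Carrier) → Carrier
  expectation μ []       f = f []
  expectation {n} μ (A ∷ As) f =
    ∑[ j < n ] (conditional μ A j * expectation μ As (λ js → f (j ∷ js)))

  data Verdict : Set where
    accept reject : Verdict

  -- All internal randomness is a single coin outcome, drawn independently of the
  -- samples; the conditioning sets depend on nothing else.
  record NonAdaptiveAlgorithm (n t : ℕ) : Set where
    field
      coinOutcomes : ℕ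
      coins        : Distribution coinOutcomes
      queries      : Fin coinOutcomes → Vec (ConditioningSet n) t
      decide       : Fin coinOutcomes → Vec (Fin n) t → Verdict

  indicator : Verdict → Verdict → Carrier
  indicator accept accept = 1#
  indicator reject reject = 1#
  indicator _      _      = 0#

  -- Pr[ alg , μ ⇒ v ] is the probability that alg, given conditional sample
  -- access to μ, returns v.
  Pr[_,_⇒_] : ∀ {n t} → NonAdaptiveAlgorithm n t → Distribution n → Verdict → Carrier
  Pr[ alg , μ ⇒ v ] =
    ∑[ ω < coinOutcomes ]
      (prob coins ω * expectation μ (queries ω) (λ js → indicator v (decide ω js)))
    where open NonAdaptiveAlgorithm alg

{-# OPTIONS --safe #-}
module Submission where

-- Let |μ(i) - 1/n| < ε / (8 n) for all i; then all μ(i) agree up to a factor 2.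
-- Write ν for the unknown distribution.
--
-- One run draws a random set A, conditions r times on A, and compares the counts
-- of all elements with their expectations under μ; it rejects if the sum of the
-- squared differences is large.  If ν = μ this sum has mean at most r, so Markov's
-- inequality bounds the chance of rejecting (deviationTest-sound).  If some h in A
-- has ν(h | A) ≥ μ(h | A) + ε/18, Chebyshev's inequality for the count of h shows
-- for large r that the run rejects with probability at least 1/2
-- (deviationTest-complete).
--
-- It remains to find sets A with such an h when ν is ε-far from μ
-- (randomSet-detects).  A is formed by independent draws from μ, and its size is
-- taken from one of about log n dyadic levels at random.  At level 0, A is a pair.
-- With probability at least ε/2 a draw l is light, ν(l) ≤ (1 - ε/2) μ(l), and
-- beside any h with ν(h) ≥ μ(h) this gives h the required excess.  At level k + 1,
-- there are 2ᵏ + 1 draws; an h with ν(h) ≥ 16 · 2ᵏ μ(h) takes most of the ν-mass of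
-- A whenever the ν-mass of its companions is at most twice a natural bound for its
-- mean, as it is with probability at least 1/2.  In both cases at most one position of A can be
-- such a spike, so the probability of a spike is the expected number of spikes,
-- which is a product by independence: at level k + 1 it is at least 2ᵏ/2 times the
-- μ-probability of the heavy elements.  Summed over the levels these numbers
-- dominate, up to a factor of order ε, the layers of ν/μ, hence the sum of the
-- positive part of ν - μ, which is at least ε.  So a run rejects with probability
-- of order ε² / log n.
--
-- To reach the error δ, a block of N runs accepts iff all of them accept, and the
-- verdict is reject iff all of l blocks reject.  With l about log (1/δ), N of order
-- l log n / ε² and r of order N / ε², a block is wrong with probability at most 1/2
-- if ν = μ and at most 4⁻ˡ if ν is far, and both errors of the verdict are at most
-- 2⁻ˡ (amplify-accepts, amplify-rejects).  The number of samples is l N r.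

import Algebra.Construct.NaturalChoice.Max as Max
import Algebra.Properties.CommutativeSemiring.Exp as CExp
import Algebra.Properties.Ring as RingProperties
import Algebra.Properties.Semiring.Exp as Exp
import Algebra.Properties.Semiring.Mult as Mult
import Algebra.Properties.Semiring.Sum as SemiringSum
import Algebra.Solver.Ring as RingSolver
open import Algebra.Solver.Ring.AlmostCommutativeRing
  using (fromCommutativeRing; _-Raw-AlmostCommutative⟶_)
import Algebra.Solver.Ring.Simple as SimpleSolver
open import Data.Bool.Base using (if_then_else_; true; false)
open import Data.Fin.Base using (Fin; zero; suc; toℕ; fromℕ<; punchIn; punchOut)
open import Data.Fin.Patterns using (0F; 1F; 2F)
import Data.Fin.Properties as Fin
open import Data.Fin.Subset using (Subset; Nonempty; inside; outside; ∣_∣; _∈_; _∉_; ⊥; ⁅_⁆; _∪_)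
open import Data.Fin.Subset.Properties
  using (_∈?_; ∉⊥; x∈⁅x⁆; x∈⁅y⁆⇒x≡y; x∈p∪q⁺; x∈p∪q⁻; x∈p⇒∣p-x∣<∣p∣)
open import Data.Integer.Base as ℤ using (ℤ; +_; -[1+_]; _⊖_)
import Data.Integer.Properties as ℤ
open import Data.List.Base as List using (List; []; _∷_)
open import Data.List.Relation.Unary.All as All using (All; []; _∷_)
import Data.List.Relation.Unary.All.Properties as All
open import Data.Maybe.Base using (Maybe; just; nothing)
open import Data.Nat.Base as ℕ using (ℕ; zero; suc; NonZero)
import Data.Nat.Properties as ℕ
open import Data.Product using (∃; Σ; _×_; _,_; proj₁; proj₂; map₁)
import Data.Sign.Base as Sign
open import Data.Sum.Base using (inj₁; inj₂; [_,_]′)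
open import Data.Vec.Base as Vec using (Vec; []; _∷_; _++_; take; drop; replicate; lookup; removeAt)
import Data.Vec.Functional as Vector
open import Data.Vec.Properties using (removeAt-punchOut)
open import Defs
open import Function.Base using (_∘_)
import Relation.Binary.Reasoning.StrictPartialOrder as OrderReasoning
open import Relation.Binary.PropositionalEquality as ≡ using (_≡_; _≢_)
open import Relation.Nullary using (¬_; yes; no; does; contradiction; Dec)
open import Relation.Nullary.Decidable using (dec-true; dec-false; _×-dec_)

-- Ring identities with integer coefficients

module IntegerCoefficients (ℝ : Reals) where

  open Reals ℝ

  module ≤-Reasoning = OrderReasoning strictPartialOrder
  open ≤-Reasoning

  -- Equality of field elements does not compute, so identities are normalised
  -- with integer coefficients, which are then interpreted in the field.
  private
    module M = Mult semiring
    module RP = RingProperties ring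

    -- Agrees with fromℕ, but makes the literals 0 and 1 denote 0# and 1#.
    numeral : ℕ → Carrier
    numeral 0 = 0#
    numeral 1 = 1#
    numeral n = fromℕ n

    numeral≈ : ∀ n → numeral n ≈ fromℕ n
    numeral≈ 0 = refl
    numeral≈ 1 = sym (+-identityʳ 1#)
    numeral≈ (suc (suc n)) = refl

    ⟦_⟧ℤ : ℤ → Carrier
    ⟦ + n ⟧ℤ      = numeral n
    ⟦ -[1+ n ] ⟧ℤ = - numeral (suc n)

    ⟦⊖⟧ : ∀ m n → ⟦ m ⊖ n ⟧ℤ ≈ fromℕ m - fromℕ n
    ⟦⊖⟧ zero    zero    = sym (-‿inverseʳ 0#)
    ⟦⊖⟧ zero    (suc n) = trans (-‿cong (numeral≈ (suc n))) (sym (+-identityˡ _))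
    ⟦⊖⟧ (suc m) zero    = trans (numeral≈ (suc m))
      (sym (trans (+-congˡ RP.-0#≈0#) (+-identityʳ _)))
    ⟦⊖⟧ (suc m) (suc n) = begin-equality
      ⟦ suc m ⊖ suc n ⟧ℤ                ≡⟨ ≡.cong ⟦_⟧ℤ (ℤ.[1+m]⊖[1+n]≡m⊖n m n) ⟩
      ⟦ m ⊖ n ⟧ℤ                        ≈⟨ ⟦⊖⟧ m n ⟩
      fromℕ m - fromℕ n                 ≈⟨ +-congʳ (+-identityˡ _) ⟨
      (0# + fromℕ m) - fromℕ n          ≈⟨ +-congʳ (+-congʳ (-‿inverseʳ 1#)) ⟨
      (1# - 1# + fromℕ m) - fromℕ n     ≈⟨ +-congʳ (+-assoc 1# (- 1#) (fromℕ m)) ⟩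
      (1# + (- 1# + fromℕ m)) - fromℕ n ≈⟨ +-congʳ (+-congˡ (+-comm (- 1#) (fromℕ m))) ⟩
      (1# + (fromℕ m - 1#)) - fromℕ n   ≈⟨ +-congʳ (+-assoc 1# (fromℕ m) (- 1#)) ⟨
      (fromℕ (suc m) - 1#) - fromℕ n    ≈⟨ +-assoc _ _ _ ⟩
      fromℕ (suc m) + (- 1# - fromℕ n)  ≈⟨ +-congˡ (RP.-‿+-comm 1# (fromℕ n)) ⟩
      fromℕ (suc m) - fromℕ (suc n)     ∎

    ⟦⟧ℤ-+ : ∀ i j → ⟦ i ℤ.+ j ⟧ℤ ≈ ⟦ i ⟧ℤ + ⟦ j ⟧ℤ
    ⟦⟧ℤ-+ (+ m) (+ n) = begin-equality
      numeral (m ℕ.+ n)     ≈⟨ numeral≈ (m ℕ.+ n) ⟩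
      fromℕ (m ℕ.+ n)       ≈⟨ M.×-homo-+ 1# m n ⟩
      fromℕ m + fromℕ n     ≈⟨ +-cong (numeral≈ m) (numeral≈ n) ⟨
      numeral m + numeral n ∎
    ⟦⟧ℤ-+ (+ m) -[1+ n ] = begin-equality
      ⟦ m ⊖ suc n ⟧ℤ            ≈⟨ ⟦⊖⟧ m (suc n) ⟩
      fromℕ m - fromℕ (suc n)   ≈⟨ +-cong (numeral≈ m) (-‿cong (numeral≈ (suc n))) ⟨
      numeral m - numeral (suc n) ∎
    ⟦⟧ℤ-+ -[1+ m ] (+ n) = begin-equality
      ⟦ n ⊖ suc m ⟧ℤ            ≈⟨ ⟦⊖⟧ n (suc m) ⟩
      fromℕ n - fromℕ (suc m)   ≈⟨ +-cong (numeral≈ n) (-‿cong (numeral≈ (suc m))) ⟨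
      numeral n - numeral (suc m) ≈⟨ +-comm _ _ ⟩
      - numeral (suc m) + numeral n ∎
    ⟦⟧ℤ-+ -[1+ m ] -[1+ n ] = begin-equality
      - fromℕ (suc (suc (m ℕ.+ n)))       ≡⟨ ≡.cong (λ k → - fromℕ (suc k)) (ℕ.+-suc m n) ⟨
      - fromℕ (suc m ℕ.+ suc n)           ≈⟨ -‿cong (M.×-homo-+ 1# (suc m) (suc n)) ⟩
      - (fromℕ (suc m) + fromℕ (suc n))   ≈⟨ RP.-‿+-comm _ _ ⟨
      - fromℕ (suc m) - fromℕ (suc n)     ≈⟨ +-cong (-‿cong (numeral≈ (suc m))) (-‿cong (numeral≈ (suc n))) ⟨
      - numeral (suc m) - numeral (suc n) ∎

    ⟦-◃⟧ : ∀ n → ⟦ Sign.- ℤ.◃ n ⟧ℤ ≈ - fromℕ n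
    ⟦-◃⟧ zero    = sym RP.-0#≈0#
    ⟦-◃⟧ (suc n) = -‿cong (numeral≈ (suc n))

    fromℕ-* : ∀ m n → fromℕ (m ℕ.* n) ≈ numeral m * numeral n
    fromℕ-* m n = trans (M.×1-homo-* m n) (sym (*-cong (numeral≈ m) (numeral≈ n)))

    ⟦⟧ℤ-* : ∀ i j → ⟦ i ℤ.* j ⟧ℤ ≈ ⟦ i ⟧ℤ * ⟦ j ⟧ℤ
    ⟦⟧ℤ-* (+ m) (+ n) = begin-equality
      ⟦ Sign.+ ℤ.◃ (m ℕ.* n) ⟧ℤ ≡⟨ ≡.cong ⟦_⟧ℤ (ℤ.+◃n≡+n (m ℕ.* n)) ⟩
      numeral (m ℕ.* n)       ≈⟨ numeral≈ (m ℕ.* n) ⟩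
      fromℕ (m ℕ.* n)         ≈⟨ fromℕ-* m n ⟩
      numeral m * numeral n   ∎
    ⟦⟧ℤ-* (+ m) -[1+ n ] = begin-equality
      ⟦ Sign.- ℤ.◃ (m ℕ.* suc n) ⟧ℤ    ≈⟨ ⟦-◃⟧ (m ℕ.* suc n) ⟩
      - fromℕ (m ℕ.* suc n)          ≈⟨ -‿cong (fromℕ-* m (suc n)) ⟩
      - (numeral m * numeral (suc n)) ≈⟨ RP.-‿distribʳ-* _ _ ⟩
      numeral m * - numeral (suc n)  ∎
    ⟦⟧ℤ-* -[1+ m ] (+ n) = begin-equality
      ⟦ Sign.- ℤ.◃ (suc m ℕ.* n) ⟧ℤ    ≈⟨ ⟦-◃⟧ (suc m ℕ.* n) ⟩
      - fromℕ (suc m ℕ.* n)          ≈⟨ -‿cong (fromℕ-* (suc m) n) ⟩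
      - (numeral (suc m) * numeral n) ≈⟨ RP.-‿distribˡ-* _ _ ⟩
      - numeral (suc m) * numeral n  ∎
    ⟦⟧ℤ-* -[1+ m ] -[1+ n ] = begin-equality
      numeral (suc m ℕ.* suc n)            ≈⟨ numeral≈ (suc m ℕ.* suc n) ⟩
      fromℕ (suc m ℕ.* suc n)              ≈⟨ fromℕ-* (suc m) (suc n) ⟩
      numeral (suc m) * numeral (suc n)     ≈⟨ RP.-‿involutive _ ⟨
      - - (numeral (suc m) * numeral (suc n)) ≈⟨ -‿cong (RP.-‿distribʳ-* _ _) ⟩
      - (numeral (suc m) * - numeral (suc n)) ≈⟨ RP.-‿distribˡ-* _ _ ⟩
      - numeral (suc m) * - numeral (suc n) ∎

    ⟦⟧ℤ-neg : ∀ i → ⟦ ℤ.- i ⟧ℤ ≈ - ⟦ i ⟧ℤ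
    ⟦⟧ℤ-neg (+ 0)     = sym RP.-0#≈0#
    ⟦⟧ℤ-neg (+ suc n) = refl
    ⟦⟧ℤ-neg -[1+ n ]  = sym (RP.-‿involutive _)

    interpret : ℤ.+-*-rawRing -Raw-AlmostCommutative⟶ fromCommutativeRing commutativeRing
    interpret = record
      { ⟦_⟧ = ⟦_⟧ℤ ; +-homo = ⟦⟧ℤ-+ ; *-homo = ⟦⟧ℤ-* ; -‿homo = ⟦⟧ℤ-neg
      ; 0-homo = refl ; 1-homo = refl }

    equalNumerals : ∀ i j → Maybe (⟦ i ⟧ℤ ≈ ⟦ j ⟧ℤ)
    equalNumerals i j with i ℤ.≟ j
    ... | yes ≡.refl = just refl
    ... | no  _      = nothing

  open RingSolver ℤ.+-*-rawRing (fromCommutativeRing commutativeRing) interpret equalNumerals public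
    using (solve; con; _:=_; _:+_; _:*_; _:-_; :-_)

-- Ordered fields, logarithms and the Archimedean property

module OrderedField (ℝ : Reals) where

  open Reals ℝ
  open IntegerCoefficients ℝ
  open ≤-Reasoning

  -- The certificate d for x ≤ y turns an inequality into a ring identity.
  ≤-by : ∀ {x y} d → 0# ≤ d → y ≈ x + d → x ≤ y
  ≤-by {x} {y} d (inj₁ 0<d) y≈x+d = begin
    x       ≈⟨ +-identityˡ x ⟨
    0# + x  <⟨ +-monoˡ-< x 0<d ⟩
    d + x   ≈⟨ +-comm d x ⟩
    x + d   ≈⟨ y≈x+d ⟨
    y       ∎
  ≤-by {x} {y} d (inj₂ 0≈d) y≈x+d = begin
    x       ≈⟨ +-identityʳ x ⟨
    x + 0#  ≈⟨ +-congˡ 0≈d ⟩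
    x + d   ≈⟨ y≈x+d ⟨
    y       ∎

  +-monoˡ-≤ : ∀ {x y} z → x ≤ y → x + z ≤ y + z
  +-monoˡ-≤ z (inj₁ x<y) = inj₁ (+-monoˡ-< z x<y)
  +-monoˡ-≤ z (inj₂ x≈y) = inj₂ (+-congʳ x≈y)

  +-monoʳ-≤ : ∀ {x y} z → x ≤ y → z + x ≤ z + y
  +-monoʳ-≤ {x} {y} z x≤y = begin
    z + x ≈⟨ +-comm z x ⟩
    x + z ≤⟨ +-monoˡ-≤ z x≤y ⟩
    y + z ≈⟨ +-comm y z ⟩
    z + y ∎

  +-mono-≤ : ∀ {x y u v} → x ≤ y → u ≤ v → x + u ≤ y + v
  +-mono-≤ {y = y} {u} x≤y u≤v = ≤-trans (+-monoˡ-≤ u x≤y) (+-monoʳ-≤ y u≤v)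

  0≤+ : ∀ {x y} → 0# ≤ x → 0# ≤ y → 0# ≤ x + y
  0≤+ {x} {y} 0≤x 0≤y = begin
    0#      ≈⟨ +-identityˡ 0# ⟨
    0# + 0# ≤⟨ +-mono-≤ 0≤x 0≤y ⟩
    x + y   ∎

  0≤* : ∀ {x y} → 0# ≤ x → 0# ≤ y → 0# ≤ x * y
  0≤* (inj₁ 0<x) (inj₁ 0<y) = inj₁ (*-pos 0<x 0<y)
  0≤* {x} {y} (inj₂ 0≈x) _  = inj₂ (sym (trans (*-congʳ (sym 0≈x)) (zeroˡ y)))
  0≤* {x} {y} _ (inj₂ 0≈y)  = inj₂ (sym (trans (*-congˡ (sym 0≈y)) (zeroʳ x)))

  ≤⇒0≤- : ∀ {x y} → x ≤ y → 0# ≤ y - x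
  ≤⇒0≤- {x} {y} x≤y = begin
    0#    ≈⟨ -‿inverseʳ x ⟨
    x - x ≤⟨ +-monoˡ-≤ (- x) x≤y ⟩
    y - x ∎

  *-monoˡ-≤ : ∀ {x y z} → 0# ≤ z → x ≤ y → z * x ≤ z * y
  *-monoˡ-≤ {x} {y} {z} 0≤z x≤y = ≤-by (z * (y - x)) (0≤* 0≤z (≤⇒0≤- x≤y))
    (solve 3 (λ x y z → z :* y := z :* x :+ z :* (y :- x)) refl x y z)

  *-monoʳ-≤ : ∀ {x y z} → 0# ≤ z → x ≤ y → x * z ≤ y * z
  *-monoʳ-≤ {x} {y} {z} 0≤z x≤y = begin
    x * z ≈⟨ *-comm x z ⟩
    z * x ≤⟨ *-monoˡ-≤ 0≤z x≤y ⟩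
    z * y ≈⟨ *-comm z y ⟩
    y * z ∎

  *-mono-≤ : ∀ {x y u v} → 0# ≤ y → 0# ≤ u → x ≤ y → u ≤ v → x * u ≤ y * v
  *-mono-≤ 0≤y 0≤u x≤y u≤v = ≤-trans (*-monoʳ-≤ 0≤u x≤y) (*-monoˡ-≤ 0≤y u≤v)

  <⇒≱ : ∀ {x y} → x < y → ¬ y ≤ x
  <⇒≱ x<y (inj₁ y<x) = <-asym x<y y<x
  <⇒≱ x<y (inj₂ y≈x) = <-irrefl (sym y≈x) x<y

  ≰⇒> : ∀ {x y} → ¬ x ≤ y → y < x
  ≰⇒> {x} {y} x≰y with ≤-total x y
  ... | inj₁ x≤y        = contradiction x≤y x≰y
  ... | inj₂ (inj₁ y<x) = y<x
  ... | inj₂ (inj₂ y≈x) = contradiction (≤-reflexive (sym y≈x)) x≰y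

  x<y⇒0<y-x : ∀ {x y} → x < y → 0# < y - x
  x<y⇒0<y-x {x} {y} x<y = begin-strict
    0#    ≈⟨ -‿inverseʳ x ⟨
    x - x <⟨ +-monoˡ-< (- x) x<y ⟩
    y - x ∎

  *-cancelˡ-≤ : ∀ {x y z} → 0# < z → z * x ≤ z * y → x ≤ y
  *-cancelˡ-≤ {x} {y} {z} 0<z zx≤zy with x ≤? y
  ... | yes x≤y = x≤y
  ... | no  x≰y = contradiction zx≤zy (<⇒≱ (begin-strict
    z * y               ≈⟨ +-identityˡ _ ⟨
    0# + z * y          <⟨ +-monoˡ-< _ (*-pos 0<z (x<y⇒0<y-x (≰⇒> x≰y))) ⟩
    z * (x - y) + z * y ≈⟨ solve 3 (λ x y z → z :* (x :- y) :+ z :* y := z :* x) refl x y z ⟩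
    z * x               ∎))

  0≤1 : 0# ≤ 1#
  0≤1 = <⇒≤ 0<1

  0≤fromℕ : ∀ n → 0# ≤ fromℕ n
  0≤fromℕ n = fromℕ-mono-≤ {0} {n} ℕ.z≤n

  fromℕ-+ : ∀ m n → fromℕ (m ℕ.+ n) ≈ fromℕ m + fromℕ n
  fromℕ-+ = Mult.×-homo-+ semiring 1#

  fromℕ-* : ∀ m n → fromℕ (m ℕ.* n) ≈ fromℕ m * fromℕ n
  fromℕ-* = Mult.×1-homo-* semiring

  fromℕ-^ : ∀ m k → fromℕ (m ℕ.^ k) ≈ fromℕ m ^ k
  fromℕ-^ m zero    = +-identityʳ 1#
  fromℕ-^ m (suc k) = trans (fromℕ-* m (m ℕ.^ k)) (*-congˡ (fromℕ-^ m k))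

  0≤x² : ∀ x → 0# ≤ x * x
  0≤x² x with ≤-total 0# x
  ... | inj₁ 0≤x = 0≤* 0≤x 0≤x
  ... | inj₂ x≤0 = begin
    0#        ≤⟨ 0≤* 0≤-x 0≤-x ⟩
    - x * - x ≈⟨ solve 1 (λ x → :- x :* :- x := x :* x) refl x ⟩
    x * x     ∎
    where
    0≤-x : 0# ≤ - x
    0≤-x = ≤-trans (≤⇒0≤- x≤0) (≤-reflexive (+-identityˡ _))

  square-mono-≤ : ∀ {x y} → 0# ≤ x → x ≤ y → x * x ≤ y * y
  square-mono-≤ 0≤x x≤y = *-mono-≤ (≤-trans 0≤x x≤y) 0≤x x≤y x≤y

  ⁻¹-pos : ∀ {x} → 0# < x → 0# < x ⁻¹
  ⁻¹-pos {x} 0<x with 0# <? x ⁻¹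
  ... | yes 0<x⁻¹ = 0<x⁻¹
  ... | no  0≮x⁻¹ = contradiction (begin-strict
    0#       <⟨ 0<1 ⟩
    1#       ≈⟨ *-inverseʳ (pos⇒≉0 0<x) ⟨
    x * x ⁻¹ ≤⟨ *-monoˡ-≤ (<⇒≤ 0<x) x⁻¹≤0 ⟩
    x * 0#   ≈⟨ zeroʳ x ⟩
    0#       ∎) (<-irrefl refl)
    where
    x⁻¹≤0 : x ⁻¹ ≤ 0#
    x⁻¹≤0 with ≤-total (x ⁻¹) 0#
    ... | inj₁ le         = le
    ... | inj₂ (inj₁ lt)  = contradiction lt 0≮x⁻¹
    ... | inj₂ (inj₂ eq)  = inj₂ (sym eq)

  ⁻¹-cancel : ∀ {x} y → 0# < x → x * (y * x ⁻¹) ≈ y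
  ⁻¹-cancel {x} y 0<x = begin-equality
    x * (y * x ⁻¹) ≈⟨ solve 3 (λ x y z → x :* (y :* z) := y :* (x :* z)) refl x y (x ⁻¹) ⟩
    y * (x * x ⁻¹) ≈⟨ *-congˡ (*-inverseʳ (pos⇒≉0 0<x)) ⟩
    y * 1#         ≈⟨ *-identityʳ y ⟩
    y              ∎

  ⁻¹-cong : ∀ {x y} → 0# < x → x ≈ y → x ⁻¹ ≈ y ⁻¹
  ⁻¹-cong {x} {y} 0<x x≈y = begin-equality
    x ⁻¹                ≈⟨ *-identityʳ _ ⟨
    x ⁻¹ * 1#           ≈⟨ *-congˡ (*-inverseʳ (λ y≈0 → pos⇒≉0 0<x (trans x≈y y≈0))) ⟨
    x ⁻¹ * (y * y ⁻¹)   ≈⟨ solve 3 (λ u y v → u :* (y :* v) := y :* u :* v) refl (x ⁻¹) y (y ⁻¹) ⟩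
    y * x ⁻¹ * y ⁻¹     ≈⟨ *-congʳ (*-congʳ x≈y) ⟨
    x * x ⁻¹ * y ⁻¹     ≈⟨ *-congʳ (*-inverseʳ (pos⇒≉0 0<x)) ⟩
    1# * y ⁻¹           ≈⟨ *-identityˡ _ ⟩
    y ⁻¹                ∎

  0≤^ : ∀ {x} k → 0# ≤ x → 0# ≤ x ^ k
  0≤^ zero    0≤x = 0≤1
  0≤^ (suc k) 0≤x = 0≤* 0≤x (0≤^ k 0≤x)

  0<^ : ∀ {x} k → 0# < x → 0# < x ^ k
  0<^ zero    0<x = 0<1
  0<^ (suc k) 0<x = *-pos 0<x (0<^ k 0<x)

  ^≤1 : ∀ {x} k → 0# ≤ x → x ≤ 1# → x ^ k ≤ 1#
  ^≤1 zero    0≤x x≤1 = ≤-refl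
  ^≤1 {x} (suc k) 0≤x x≤1 = begin
    x * x ^ k ≤⟨ *-mono-≤ 0≤1 (0≤^ k 0≤x) x≤1 (^≤1 k 0≤x x≤1) ⟩
    1# * 1#   ≈⟨ *-identityˡ 1# ⟩
    1#        ∎

  ^-cong : ∀ {x y} k → x ≈ y → x ^ k ≈ y ^ k
  ^-cong k = Exp.^-congˡ semiring k

  ^-*-assoc : ∀ x m n → (x ^ m) ^ n ≈ x ^ (m ℕ.* n)
  ^-*-assoc = Exp.^-assocʳ semiring

  ^-+ : ∀ x m n → x ^ (m ℕ.+ n) ≈ x ^ m * x ^ n
  ^-+ = Exp.^-homo-* semiring

  ^-distrib-* : ∀ x y k → (x * y) ^ k ≈ x ^ k * y ^ k
  ^-distrib-* = CExp.^-distrib-* commutativeSemiring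

  bernoulli : ∀ {y} k → 0# ≤ 1# + y → 1# + fromℕ k * y ≤ (1# + y) ^ k
  bernoulli {y} zero 0≤1+y = ≤-reflexive (trans (+-congˡ (zeroˡ y)) (+-identityʳ 1#))
  bernoulli {y} (suc k) 0≤1+y = begin
    1# + (1# + fromℕ k) * y
      ≤⟨ ≤-by (fromℕ k * (y * y)) (0≤* (0≤fromℕ k) (0≤x² y))
           (solve 2 (λ k y → (con (+ 1) :+ y) :* (con (+ 1) :+ k :* y)
                          := (con (+ 1) :+ (con (+ 1) :+ k) :* y) :+ k :* (y :* y))
                  refl (fromℕ k) y) ⟩
    (1# + y) * (1# + fromℕ k * y)
      ≤⟨ *-monoˡ-≤ 0≤1+y (bernoulli k 0≤1+y) ⟩
    (1# + y) * (1# + y) ^ k ∎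

  bernoulli⁻ : ∀ {x} k → x ≤ 1# → 1# - fromℕ k * x ≤ (1# - x) ^ k
  bernoulli⁻ {x} k x≤1 = begin
    1# - fromℕ k * x   ≈⟨ solve 2 (λ k x → con (+ 1) :- k :* x := con (+ 1) :+ k :* (:- x)) refl (fromℕ k) x ⟩
    1# + fromℕ k * - x ≤⟨ bernoulli k (≤⇒0≤- x≤1) ⟩
    (1# - x) ^ k       ∎

  open Max totalOrder public using (x≤x⊔y; x≤y⊔x; ⊔-lub)

  -- Completeness gives more than the negation of boundedness: applied to the
  -- naturals below x it returns one of them within distance 1 of their supremum.
  archimedean : ∀ x → 0# ≤ x → ∃ λ n → fromℕ n ≤ x × x < fromℕ (suc n)
  archimedean x 0≤x = n , n≤x , ≰⇒> suc-n≰x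
    where
    Below : Carrier → Set
    Below y = ∃ λ n → y ≈ fromℕ n × fromℕ n ≤ x

    below≤x : ∀ y → Below y → y ≤ x
    below≤x y (n , y≈n , n≤x) = ≤-trans (≤-reflexive y≈n) n≤x

    supremum = complete Below (0# , 0 , refl , 0≤x) (x , below≤x)
    s = proj₁ supremum

    s-1<s : s - 1# < s
    s-1<s = begin-strict
      s - 1#        ≈⟨ +-identityˡ _ ⟨
      0# + (s - 1#) <⟨ +-monoˡ-< _ 0<1 ⟩
      1# + (s - 1#) ≈⟨ solve 1 (λ s → con (+ 1) :+ (s :- con (+ 1)) := s) refl s ⟩
      s             ∎

    near = proj₂ (proj₂ supremum) (s - 1#) s-1<s
    n = proj₁ (proj₁ (proj₂ near))
    n≤x = proj₂ (proj₂ (proj₁ (proj₂ near)))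

    suc-n≰x : ¬ fromℕ (suc n) ≤ x
    suc-n≰x suc-n≤x = <-irrefl refl (begin-strict
      s                 ≈⟨ solve 1 (λ s → s := con (+ 1) :+ (s :- con (+ 1))) refl s ⟩
      1# + (s - 1#)     ≈⟨ +-comm _ _ ⟩
      (s - 1#) + 1#     <⟨ +-monoˡ-< 1# (proj₂ (proj₂ near)) ⟩
      proj₁ near + 1#   ≈⟨ +-congʳ (proj₁ (proj₂ (proj₁ (proj₂ near)))) ⟩
      fromℕ n + 1#      ≈⟨ +-comm _ _ ⟩
      fromℕ (suc n)     ≤⟨ proj₁ (proj₂ supremum) _ (suc n , refl , suc-n≤x) ⟩
      s                 ∎)

  n≤2^n : ∀ n → n ℕ.≤ 2 ℕ.^ n
  n≤2^n zero    = ℕ.z≤n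
  n≤2^n (suc n) = ℕ.+-mono-≤ (ℕ.>-nonZero⁻¹ (2 ℕ.^ n) {{ℕ.m^n≢0 2 n}})
    (ℕ.≤-trans (n≤2^n n) (ℕ.m≤m+n (2 ℕ.^ n) 0))

  fromℕ≤2^ : ∀ n → fromℕ n ≤ fromℕ 2 ^ n
  fromℕ≤2^ n = ≤-trans (fromℕ-mono-≤ (n≤2^n n)) (≤-reflexive (fromℕ-^ 2 n))

  -- The least k with x ≤ 2ᵏ exceeds log₂ x by at most one.
  ⌈log₂⌉ : ∀ x (1≤x : 1# ≤ x) → ∃ λ k → x ≤ fromℕ 2 ^ k × fromℕ k ≤ log₂ x 1≤x + 1#
  ⌈log₂⌉ x 1≤x = least (suc n) x≤2^n
    where
    n = proj₁ (archimedean x (≤-trans 0≤1 1≤x))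

    x≤2^n : x ≤ fromℕ 2 ^ suc n
    x≤2^n = ≤-trans (<⇒≤ (proj₂ (proj₂ (archimedean x (≤-trans 0≤1 1≤x))))) (fromℕ≤2^ (suc n))

    below⇒≤log : ∀ k → fromℕ 2 ^ k ≤ x → fromℕ k ≤ log₂ x 1≤x
    below⇒≤log k 2^k≤x = proj₁ (proj₂ (log₂-supremum x 1≤x)) (fromℕ k)
      (k , 1 , _ , k≈k/1 , ≤-trans 2^k≤x (≤-reflexive (sym (*-identityʳ x))))
      where
      k≈k/1 : fromℕ k ≈ fromℕ k * fromℕ 1 ⁻¹
      k≈k/1 = begin-equality
        fromℕ k                         ≈⟨ ⁻¹-cancel (fromℕ k) (0<fromℕ 1) ⟨
        fromℕ 1 * (fromℕ k * fromℕ 1 ⁻¹) ≈⟨ *-congʳ (+-identityʳ 1#) ⟩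
        1# * (fromℕ k * fromℕ 1 ⁻¹)      ≈⟨ *-identityˡ _ ⟩
        fromℕ k * fromℕ 1 ⁻¹             ∎

    least : ∀ k → x ≤ fromℕ 2 ^ k → ∃ λ k → x ≤ fromℕ 2 ^ k × fromℕ k ≤ log₂ x 1≤x + 1#
    least zero    x≤1 = 0 , x≤1 , 0≤+ (below⇒≤log 0 1≤x) 0≤1
    least (suc k) x≤2^[1+k] with x ≤? fromℕ 2 ^ k
    ... | yes x≤2^k = least k x≤2^k
    ... | no  x≰2^k = suc k , x≤2^[1+k] , (begin
      1# + fromℕ k      ≈⟨ +-comm _ _ ⟩
      fromℕ k + 1#      ≤⟨ +-monoˡ-≤ 1# (below⇒≤log k (<⇒≤ (≰⇒> x≰2^k))) ⟩
      log₂ x 1≤x + 1#   ∎)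

-- Finite sums and finitely supported probability

module FiniteProbability (ℝ : Reals) where

  open Testing ℝ
  open IntegerCoefficients ℝ
  open OrderedField ℝ
  open ≤-Reasoning

  open SemiringSum semiring public
    using (sum-cong-≋; ∑-distrib-+; *-distribˡ-sum; *-distribʳ-sum; sum-replicate)

  sum-mono : ∀ {n} {f g : Fin n → Carrier} → (∀ i → f i ≤ g i) → sum f ≤ sum g
  sum-mono {zero}  f≤g = ≤-refl
  sum-mono {suc n} f≤g = +-mono-≤ (f≤g zero) (sum-mono (f≤g ∘ suc))

  sum-nonneg : ∀ {n} {f : Fin n → Carrier} → (∀ i → 0# ≤ f i) → 0# ≤ sum f
  sum-nonneg {zero}  0≤f = ≤-refl
  sum-nonneg {suc n} 0≤f = 0≤+ (0≤f zero) (sum-nonneg (0≤f ∘ suc))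

  term≤sum : ∀ {n} {f : Fin n → Carrier} → (∀ i → 0# ≤ f i) → ∀ i → f i ≤ sum f
  term≤sum {suc n} {f} 0≤f zero    = ≤-by _ (sum-nonneg (0≤f ∘ suc)) refl
  term≤sum {suc n} {f} 0≤f (suc i) = ≤-trans (term≤sum (0≤f ∘ suc) i)
    (≤-by _ (0≤f zero) (+-comm _ _))

  private variable
    A B : Set

  -- Random A is the monad of finitely supported distributions on A, kept as
  -- weighted lists: the coins of an algorithm must come from a finite set, and
  -- lists make dependent choices (_>>=_) free of index arithmetic.
  average : List (Carrier × A) → (A → Carrier) → Carrier
  average []             f = 0#
  average ((w , a) ∷ os) f = w * f a + average os f

  record Random (A : Set) : Set where
    field
      outcomes       : List (Carrier × A)
      weights-nonneg : All (λ o → 0# ≤ proj₁ o) outcomes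
      weights-total  : average outcomes (λ _ → 1#) ≈ 1#

  open Random public

  𝔼 : Random A → (A → Carrier) → Carrier
  𝔼 X = average (outcomes X)

  module _ (X : Random A) where

    𝔼-cong : ∀ {f g} → (∀ a → f a ≈ g a) → 𝔼 X f ≈ 𝔼 X g
    𝔼-cong {f} {g} f≈g = go (outcomes X)
      where
      go : ∀ os → average os f ≈ average os g
      go []             = refl
      go ((w , a) ∷ os) = +-cong (*-congˡ (f≈g a)) (go os)

    𝔼-mono : ∀ {f g} → (∀ a → f a ≤ g a) → 𝔼 X f ≤ 𝔼 X g
    𝔼-mono {f} {g} f≤g = go (weights-nonneg X)
      where
      go : ∀ {os} → All (λ o → 0# ≤ proj₁ o) os → average os f ≤ average os g
      go []                      = ≤-refl
      go {(w , a) ∷ os} (0≤w ∷ ps) = +-mono-≤ (*-monoˡ-≤ 0≤w (f≤g a)) (go ps)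

    𝔼-+ : ∀ f g → 𝔼 X (λ a → f a + g a) ≈ 𝔼 X f + 𝔼 X g
    𝔼-+ f g = go (outcomes X)
      where
      go : ∀ os → average os (λ a → f a + g a) ≈ average os f + average os g
      go []             = sym (+-identityʳ 0#)
      go ((w , a) ∷ os) = trans (+-congˡ (go os))
        (solve 5 (λ w f g u v → w :* (f :+ g) :+ (u :+ v) := w :* f :+ u :+ (w :* g :+ v))
               refl w (f a) (g a) (average os f) (average os g))

    𝔼-* : ∀ c f → 𝔼 X (λ a → c * f a) ≈ c * 𝔼 X f
    𝔼-* c f = go (outcomes X)
      where
      go : ∀ os → average os (λ a → c * f a) ≈ c * average os f
      go []             = sym (zeroʳ c)
      go ((w , a) ∷ os) = trans (+-congˡ (go os))
        (solve 4 (λ w c f u → w :* (c :* f) :+ c :* u := c :* (w :* f :+ u))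
               refl w c (f a) (average os f))

    𝔼-const : ∀ c → 𝔼 X (λ _ → c) ≈ c
    𝔼-const c = begin-equality
      𝔼 X (λ _ → c)      ≈⟨ 𝔼-cong (λ _ → *-identityʳ c) ⟨
      𝔼 X (λ _ → c * 1#) ≈⟨ 𝔼-* c (λ _ → 1#) ⟩
      c * 𝔼 X (λ _ → 1#) ≈⟨ *-congˡ (weights-total X) ⟩
      c * 1#             ≈⟨ *-identityʳ c ⟩
      c                  ∎

    𝔼-*ʳ : ∀ c f → 𝔼 X (λ a → f a * c) ≈ 𝔼 X f * c
    𝔼-*ʳ c f = trans (𝔼-cong (λ a → *-comm (f a) c)) (trans (𝔼-* c f) (*-comm c _))

    𝔼-sum : ∀ {n} (f : Fin n → A → Carrier) →
            𝔼 X (λ a → ∑[ i < n ] f i a) ≈ ∑[ i < n ] 𝔼 X (f i)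
    𝔼-sum {zero}  f = 𝔼-const 0#
    𝔼-sum {suc n} f = trans (𝔼-+ (f zero) (λ a → ∑[ i < n ] f (suc i) a)) (+-congˡ (𝔼-sum (f ∘ suc)))

    𝔼-nonneg : ∀ {f} → (∀ a → 0# ≤ f a) → 0# ≤ 𝔼 X f
    𝔼-nonneg 0≤f = ≤-trans (≤-reflexive (sym (𝔼-const 0#))) (𝔼-mono 0≤f)

  private
    average-++ : ∀ (os ps : List (Carrier × A)) f → average (os List.++ ps) f ≈ average os f + average ps f
    average-++ []             ps f = sym (+-identityˡ _)
    average-++ ((w , a) ∷ os) ps f = trans (+-congˡ (average-++ os ps f)) (sym (+-assoc _ _ _))

    scale : Carrier → List (Carrier × A) → List (Carrier × A)
    scale w = List.map (map₁ (w *_))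

    average-scale : ∀ w (os : List (Carrier × A)) f → average (scale w os) f ≈ w * average os f
    average-scale w []             f = sym (zeroʳ w)
    average-scale w ((v , a) ∷ os) f = trans (+-congˡ (average-scale w os f))
      (solve 4 (λ w v f u → w :* v :* f :+ w :* u := w :* (v :* f :+ u)) refl w v (f a) (average os f))

    scale-nonneg : ∀ {w} {os : List (Carrier × A)} → 0# ≤ w →
                   All (λ o → 0# ≤ proj₁ o) os → All (λ o → 0# ≤ proj₁ o) (scale w os)
    scale-nonneg 0≤w []       = []
    scale-nonneg 0≤w (p ∷ ps) = 0≤* 0≤w p ∷ scale-nonneg 0≤w ps

    bindᴸ : List (Carrier × A) → (A → Random B) → List (Carrier × B)
    bindᴸ []             k = []
    bindᴸ ((w , a) ∷ os) k = scale w (outcomes (k a)) List.++ bindᴸ os k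

    average-bind : ∀ (os : List (Carrier × A)) (k : A → Random B) f →
                   average (bindᴸ os k) f ≈ average os (λ a → 𝔼 (k a) f)
    average-bind []             k f = refl
    average-bind ((w , a) ∷ os) k f = trans (average-++ (scale w (outcomes (k a))) (bindᴸ os k) f)
      (+-cong (average-scale w (outcomes (k a)) f) (average-bind os k f))

    bind-nonneg : ∀ {os : List (Carrier × A)} (k : A → Random B) →
                  All (λ o → 0# ≤ proj₁ o) os → All (λ o → 0# ≤ proj₁ o) (bindᴸ os k)
    bind-nonneg k []                         = []
    bind-nonneg {os = (w , a) ∷ _} k (p ∷ ps) =
      All.++⁺ (scale-nonneg p (weights-nonneg (k a))) (bind-nonneg k ps)

  pure : A → Random A
  pure a = record
    { outcomes       = (1# , a) ∷ []
    ; weights-nonneg = 0≤1 ∷ []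
    ; weights-total  = trans (+-identityʳ _) (*-identityʳ 1#)
    }

  𝔼-pure : ∀ (a : A) f → 𝔼 (pure a) f ≈ f a
  𝔼-pure a f = trans (+-identityʳ _) (*-identityˡ (f a))

  infixl 1 _>>=_
  _>>=_ : Random A → (A → Random B) → Random B
  X >>= k = record
    { outcomes       = bindᴸ (outcomes X) k
    ; weights-nonneg = bind-nonneg k (weights-nonneg X)
    ; weights-total  = trans (average-bind (outcomes X) k _)
        (trans (𝔼-cong X (λ a → weights-total (k a))) (weights-total X))
    }

  𝔼->>= : ∀ (X : Random A) (k : A → Random B) f → 𝔼 (X >>= k) f ≈ 𝔼 X (λ a → 𝔼 (k a) f)
  𝔼->>= X = average-bind (outcomes X)

  infixl 4 _<$>_
  _<$>_ : (A → B) → Random A → Random B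
  g <$> X = X >>= (λ a → pure (g a))

  𝔼-<$> : ∀ (g : A → B) X f → 𝔼 (g <$> X) f ≈ 𝔼 X (f ∘ g)
  𝔼-<$> g X f = trans (𝔼->>= X _ f) (𝔼-cong X (λ a → 𝔼-pure (g a) f))

  iid : Random A → ∀ s → Random (Vec A s)
  iid X zero    = pure []
  iid X (suc s) = X >>= λ a → a Vec.∷_ <$> iid X s

  𝔼-iid : ∀ (X : Random A) s f → 𝔼 (iid X (suc s)) f ≈ 𝔼 X (λ a → 𝔼 (iid X s) (λ as → f (a ∷ as)))
  𝔼-iid X s f = trans (𝔼->>= X _ f) (𝔼-cong X (λ a → 𝔼-<$> (a Vec.∷_) (iid X s) f))

  private
    average-tabulate : ∀ {n} (w : Fin n → Carrier) f →
                       average (List.tabulate (λ i → w i , i)) f ≈ ∑[ i < n ] (w i * f i)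
    average-tabulate {n} w f = go w (λ i → i)
      where
      go : ∀ {m} (w : Fin m → Carrier) (g : Fin m → Fin n) →
           average (List.tabulate (λ i → w i , g i)) f ≈ ∑[ i < m ] (w i * f (g i))
      go {zero}  w g = refl
      go {suc m} w g = +-congˡ (go (w ∘ suc) (g ∘ suc))

  fromWeights : ∀ {n} (w : Fin n → Carrier) → (∀ i → 0# ≤ w i) → sum w ≈ 1# → Random (Fin n)
  fromWeights w 0≤w ∑w≈1 = record
    { outcomes       = List.tabulate (λ i → w i , i)
    ; weights-nonneg = All.tabulate⁺ 0≤w
    ; weights-total  = trans (average-tabulate w _)
        (trans (sum-cong-≋ (λ i → *-identityʳ (w i))) ∑w≈1)
    }

  𝔼-fromWeights : ∀ {n} (w : Fin n → Carrier) 0≤w ∑w≈1 f →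
                  𝔼 (fromWeights w 0≤w ∑w≈1) f ≈ ∑[ i < n ] (w i * f i)
  𝔼-fromWeights w _ _ = average-tabulate w

  draw : ∀ {n} → Distribution n → Random (Fin n)
  draw μ = fromWeights (prob μ) (nonneg μ) (total μ)

  𝔼-draw : ∀ {n} (μ : Distribution n) f → 𝔼 (draw μ) f ≈ ∑[ i < n ] (prob μ i * f i)
  𝔼-draw μ = 𝔼-fromWeights (prob μ) (nonneg μ) (total μ)

  module _ (X : Random A) where

    private
      ∑-lookup : ∀ (os : List (Carrier × A)) f →
        ∑[ i < List.length os ] (proj₁ (List.lookup os i) * f (proj₂ (List.lookup os i))) ≈ average os f
      ∑-lookup []             f = refl
      ∑-lookup ((w , a) ∷ os) f = +-congˡ (∑-lookup os f)

      lookup-nonneg : ∀ {os : List (Carrier × A)} → All (λ o → 0# ≤ proj₁ o) os →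
                      ∀ i → 0# ≤ proj₁ (List.lookup os i)
      lookup-nonneg (p ∷ ps) zero    = p
      lookup-nonneg (p ∷ ps) (suc i) = lookup-nonneg ps i

    -- X as a distribution on the positions of its list of outcomes.
    outcomeCount : ℕ
    outcomeCount = List.length (outcomes X)

    outcome : Fin outcomeCount → A
    outcome i = proj₂ (List.lookup (outcomes X) i)

    law : Distribution outcomeCount
    law = record
      { prob   = weight
      ; nonneg = lookup-nonneg (weights-nonneg X)
      ; total  = trans (sum-cong-≋ {outcomeCount} {weight} (λ i → sym (*-identityʳ (weight i))))
          (trans (∑-lookup (outcomes X) (λ _ → 1#)) (weights-total X))
      }
      where
      weight : Fin outcomeCount → Carrier
      weight i = proj₁ (List.lookup (outcomes X) i)

    ∑-law : ∀ f → ∑[ i < outcomeCount ] (prob law i * f (outcome i)) ≈ 𝔼 X f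
    ∑-law = ∑-lookup (outcomes X)

-- Conditional samples and testers

module Testers (ℝ : Reals) where

  open Testing ℝ
  open IntegerCoefficients ℝ
  open OrderedField ℝ
  open FiniteProbability ℝ
  open ≤-Reasoning

  private variable
    n t : ℕ

  restrict : Subset n → (Fin n → Carrier) → Fin n → Carrier
  restrict A f i = if does (i ∈? A) then f i else 0#

  restrict-∈ : ∀ (A : Subset n) f {i} → i ∈ A → restrict A f i ≈ f i
  restrict-∈ A f {i} i∈A rewrite dec-true (i ∈? A) i∈A = refl

  restrict-∉ : ∀ (A : Subset n) f {i} → i ∉ A → restrict A f i ≈ 0#
  restrict-∉ A f {i} i∉A rewrite dec-false (i ∈? A) i∉A = refl

  restrict-nonneg : ∀ (A : Subset n) {f} → (∀ i → 0# ≤ f i) → ∀ i → 0# ≤ restrict A f i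
  restrict-nonneg A {f} 0≤f i with does (i ∈? A)
  ... | true  = 0≤f i
  ... | false = ≤-refl

  restrict-≤ : ∀ (A : Subset n) {f} → (∀ i → 0# ≤ f i) → ∀ i → restrict A f i ≤ f i
  restrict-≤ A {f} 0≤f i with does (i ∈? A)
  ... | true  = ≤-refl
  ... | false = 0≤f i

  restrict-cong : ∀ (A : Subset n) {f g} → (∀ i → f i ≈ g i) → ∀ i → restrict A f i ≈ restrict A g i
  restrict-cong A f≈g i with does (i ∈? A)
  ... | true  = f≈g i
  ... | false = refl

  ∑-restrict-1 : ∀ (A : Subset n) → sum (restrict A (λ _ → 1#)) ≈ fromℕ ∣ A ∣
  ∑-restrict-1 []            = refl
  ∑-restrict-1 (inside  ∷ A) = +-congˡ (∑-restrict-1 A)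
  ∑-restrict-1 (outside ∷ A) = trans (+-identityˡ _) (∑-restrict-1 A)

  Nonempty⇒NonZero : ∀ {A : Subset n} → Nonempty A → NonZero ∣ A ∣
  Nonempty⇒NonZero (_ , x∈A) = ℕ.>-nonZero (ℕ.≤-<-trans ℕ.z≤n (x∈p⇒∣p-x∣<∣p∣ x∈A))

  module _ (μ : Distribution n) (A : ConditioningSet n) where

    private
      S = proj₁ A
      m = mass μ S
      0≤prob = nonneg μ

    -- Both branches of conditional rescale nonnegative weights by their sum.
    conditional-0<mass : 0# < m → ∀ j → conditional μ A j ≈ restrict S (prob μ) j * m ⁻¹
    conditional-0<mass 0<m j rewrite dec-true (0# <? m) 0<m with does (j ∈? S)
    ... | true  = refl
    ... | false = sym (zeroˡ _)

    conditional-null : ¬ 0# < m → ∀ j → conditional μ A j ≈ restrict S (λ _ → 1#) j * fromℕ ∣ S ∣ ⁻¹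
    conditional-null 0≮m j rewrite dec-false (0# <? m) 0≮m with does (j ∈? S)
    ... | true  = sym (*-identityˡ _)
    ... | false = sym (zeroˡ _)

    private
      rescaled : (w : Fin n → Carrier) → (∀ i → 0# ≤ w i) → 0# < sum w →
                 (∀ j → conditional μ A j ≈ w j * sum w ⁻¹) →
                 (∀ j → 0# ≤ conditional μ A j) × sum (conditional μ A) ≈ 1#
      rescaled w 0≤w 0<∑w eq =
        (λ j → ≤-trans (0≤* (0≤w j) (<⇒≤ (⁻¹-pos 0<∑w))) (≤-reflexive (sym (eq j)))) ,
        (begin-equality
          sum (conditional μ A)                  ≈⟨ sum-cong-≋ {_} {conditional μ A} eq ⟩
          ∑[ j < n ] (w j * sum w ⁻¹)            ≈⟨ *-distribʳ-sum (sum w ⁻¹) w ⟨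
          sum w * sum w ⁻¹                       ≈⟨ *-inverseʳ (pos⇒≉0 0<∑w) ⟩
          1#                                     ∎)

      conditional-law : (∀ j → 0# ≤ conditional μ A j) × sum (conditional μ A) ≈ 1#
      conditional-law = cases (0# <? m)
        where
        0<∣S∣ : 0# < fromℕ ∣ S ∣
        0<∣S∣ = 0<fromℕ ∣ S ∣ {{Nonempty⇒NonZero (proj₂ A)}}

        0<∑ : 0# < sum (restrict S (λ _ → 1#))
        0<∑ = begin-strict
          0#                           <⟨ 0<∣S∣ ⟩
          fromℕ ∣ S ∣                  ≈⟨ ∑-restrict-1 S ⟨
          sum (restrict S (λ _ → 1#))  ∎

        cases : Dec (0# < m) → (∀ j → 0# ≤ conditional μ A j) × sum (conditional μ A) ≈ 1#
        cases (yes 0<m) = rescaled (restrict S (prob μ)) (restrict-nonneg S 0≤prob) 0<m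
                        (conditional-0<mass 0<m)
        cases (no 0≮m) = rescaled (restrict S (λ _ → 1#)) (restrict-nonneg S (λ _ → 0≤1)) 0<∑
                        (λ j → trans (conditional-null 0≮m j) (*-congˡ (⁻¹-cong 0<∣S∣ (sym (∑-restrict-1 S)))))

    conditional-nonneg : ∀ j → 0# ≤ conditional μ A j
    conditional-nonneg = proj₁ conditional-law

    conditional-total : sum (conditional μ A) ≈ 1#
    conditional-total = proj₂ conditional-law

    sample : Random (Fin n)
    sample = fromWeights (conditional μ A) conditional-nonneg conditional-total

    𝔼-sample : ∀ f → 𝔼 sample f ≈ ∑[ j < n ] (conditional μ A j * f j)
    𝔼-sample = 𝔼-fromWeights (conditional μ A) conditional-nonneg conditional-total

  samples : Distribution n → Vec (ConditioningSet n) t → Random (Vec (Fin n) t)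
  samples μ []       = pure []
  samples μ (A ∷ As) = sample μ A >>= λ j → j Vec.∷_ <$> samples μ As

  samples-replicate : ∀ (μ : Distribution n) r A → samples μ (replicate r A) ≡ iid (sample μ A) r
  samples-replicate μ zero    A = ≡.refl
  samples-replicate μ (suc r) A =
    ≡.cong (λ X → sample μ A >>= λ j → j Vec.∷_ <$> X) (samples-replicate μ r A)

  𝔼-samples-∷ : ∀ (μ : Distribution n) A (As : Vec (ConditioningSet n) t) f →
    𝔼 (samples μ (A ∷ As)) f ≈ 𝔼 (sample μ A) (λ j → 𝔼 (samples μ As) (λ js → f (j ∷ js)))
  𝔼-samples-∷ μ A As f = trans (𝔼->>= (sample μ A) _ f)
    (𝔼-cong (sample μ A) (λ j → 𝔼-<$> (j Vec.∷_) (samples μ As) f))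

  𝔼-samples-++ : ∀ {s} (μ : Distribution n) (As : Vec (ConditioningSet n) s) (Bs : Vec (ConditioningSet n) t) f →
    𝔼 (samples μ (As ++ Bs)) f ≈ 𝔼 (samples μ As) (λ is → 𝔼 (samples μ Bs) (λ js → f (is ++ js)))
  𝔼-samples-++ μ []       Bs f = sym (𝔼-pure [] (λ is → 𝔼 (samples μ Bs) (λ js → f (is ++ js))))
  𝔼-samples-++ μ (A ∷ As) Bs f = begin-equality
    𝔼 (samples μ (A ∷ As ++ Bs)) f
      ≈⟨ 𝔼-samples-∷ μ A (As ++ Bs) f ⟩
    𝔼 (sample μ A) (λ j → 𝔼 (samples μ (As ++ Bs)) (λ js → f (j ∷ js)))
      ≈⟨ 𝔼-cong (sample μ A) (λ j → 𝔼-samples-++ μ As Bs (λ js → f (j ∷ js))) ⟩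
    𝔼 (sample μ A) (λ j → 𝔼 (samples μ As) (λ is → 𝔼 (samples μ Bs) (λ js → f (j ∷ is ++ js))))
      ≈⟨ 𝔼-samples-∷ μ A As _ ⟨
    𝔼 (samples μ (A ∷ As)) (λ is → 𝔼 (samples μ Bs) (λ js → f (is ++ js))) ∎

  expectation≈𝔼 : ∀ (μ : Distribution n) (As : Vec (ConditioningSet n) t) f →
                  expectation μ As f ≈ 𝔼 (samples μ As) f
  expectation≈𝔼 μ []       f = sym (𝔼-pure [] f)
  expectation≈𝔼 {n} μ (A ∷ As) f = begin-equality
    ∑[ j < n ] (conditional μ A j * expectation μ As (λ js → f (j ∷ js)))
      ≈⟨ sum-cong-≋ {n} (λ j → *-congˡ {conditional μ A j} (expectation≈𝔼 μ As (λ js → f (j ∷ js)))) ⟩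
    ∑[ j < n ] (conditional μ A j * 𝔼 (samples μ As) (λ js → f (j ∷ js)))
      ≈⟨ 𝔼-sample μ A _ ⟨
    𝔼 (sample μ A) (λ j → 𝔼 (samples μ As) (λ js → f (j ∷ js)))
      ≈⟨ 𝔼-samples-∷ μ A As f ⟨
    𝔼 (samples μ (A ∷ As)) f ∎

  -- What remains of a non-adaptive algorithm once its coins are fixed; a Tester
  -- then draws a Test at random.
  record Test (n t : ℕ) : Set where
    field
      queries : Vec (ConditioningSet n) t
      decide  : Vec (Fin n) t → Verdict

  open Test

  Tester : ℕ → ℕ → Set
  Tester n t = Random (Test n t)

  Prᵀ : Distribution n → Verdict → Test n t → Carrier
  Prᵀ μ v T = 𝔼 (samples μ (queries T)) (λ js → indicator v (decide T js))

  Pr : Distribution n → Verdict → Tester n t → Carrier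
  Pr μ v X = 𝔼 X (Prᵀ μ v)

  indicator-nonneg : ∀ v w → 0# ≤ indicator v w
  indicator-nonneg accept accept = 0≤1
  indicator-nonneg accept reject = ≤-refl
  indicator-nonneg reject accept = ≤-refl
  indicator-nonneg reject reject = 0≤1

  Prᵀ-nonneg : ∀ (μ : Distribution n) v (T : Test n t) → 0# ≤ Prᵀ μ v T
  Prᵀ-nonneg μ v T = 𝔼-nonneg (samples μ (queries T)) (λ js → indicator-nonneg v (decide T js))

  Prᵀ-total : ∀ (μ : Distribution n) (T : Test n t) → Prᵀ μ accept T + Prᵀ μ reject T ≈ 1#
  Prᵀ-total μ T = begin-equality
    Prᵀ μ accept T + Prᵀ μ reject T ≈⟨ 𝔼-+ (samples μ (queries T)) _ _ ⟨
    𝔼 (samples μ (queries T)) (λ js → indicator accept (decide T js) + indicator reject (decide T js))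
      ≈⟨ 𝔼-cong (samples μ (queries T)) (λ js → one (decide T js)) ⟩
    𝔼 (samples μ (queries T)) (λ _ → 1#) ≈⟨ weights-total (samples μ (queries T)) ⟩
    1# ∎
    where
    one : ∀ w → indicator accept w + indicator reject w ≈ 1#
    one accept = +-identityʳ 1#
    one reject = +-identityˡ 1#

  Pr-nonneg : ∀ (μ : Distribution n) v (X : Tester n t) → 0# ≤ Pr μ v X
  Pr-nonneg μ v X = 𝔼-nonneg X (Prᵀ-nonneg μ v)

  Pr-total : ∀ (μ : Distribution n) (X : Tester n t) → Pr μ accept X + Pr μ reject X ≈ 1#
  Pr-total μ X = begin-equality
    Pr μ accept X + Pr μ reject X                     ≈⟨ 𝔼-+ X _ _ ⟨
    𝔼 X (λ T → Prᵀ μ accept T + Prᵀ μ reject T)       ≈⟨ 𝔼-cong X (Prᵀ-total μ) ⟩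
    𝔼 X (λ _ → 1#)                                    ≈⟨ weights-total X ⟩
    1#                                                ∎

  -- The combination of independent verdicts for which probabilities of v multiply.
  unanimous : Verdict → Verdict → Verdict → Verdict
  unanimous accept accept w = w
  unanimous accept reject w = reject
  unanimous reject reject w = w
  unanimous reject accept w = accept

  indicator-unanimous : ∀ v u w → indicator v (unanimous v u w) ≈ indicator v u * indicator v w
  indicator-unanimous accept accept w = sym (*-identityˡ _)
  indicator-unanimous accept reject w = sym (zeroˡ _)
  indicator-unanimous reject reject w = sym (*-identityˡ _)
  indicator-unanimous reject accept w = sym (zeroˡ _)

  both : ∀ {s} → Verdict → Test n s → Test n t → Test n (s ℕ.+ t)
  both {s = s} v T U = record
    { queries = queries T ++ queries U
    ; decide  = λ js → unanimous v (decide T (take s js)) (decide U (drop s js))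
    }

  private
    take-++ : ∀ {A : Set} {s} (xs : Vec A s) (ys : Vec A t) → take s (xs ++ ys) ≡ xs
    take-++ []       ys = ≡.refl
    take-++ (x ∷ xs) ys = ≡.cong (x ∷_) (take-++ xs ys)

    drop-++ : ∀ {A : Set} {s} (xs : Vec A s) (ys : Vec A t) → drop s (xs ++ ys) ≡ ys
    drop-++ []       ys = ≡.refl
    drop-++ (x ∷ xs) ys = drop-++ xs ys

  Prᵀ-both : ∀ {s} (μ : Distribution n) v (T : Test n s) (U : Test n t) →
             Prᵀ μ v (both v T U) ≈ Prᵀ μ v T * Prᵀ μ v U
  Prᵀ-both {s = s} μ v T U = begin-equality
    Prᵀ μ v (both v T U)
      ≈⟨ 𝔼-samples-++ μ (queries T) (queries U) _ ⟩
    𝔼 XT (λ is → 𝔼 XU (λ js → indicator v (decide (both v T U) (is ++ js))))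
      ≈⟨ 𝔼-cong XT (λ is → 𝔼-cong XU (factor is)) ⟩
    𝔼 XT (λ is → 𝔼 XU (λ js → indicator v (decide T is) * indicator v (decide U js)))
      ≈⟨ 𝔼-cong XT (λ is → 𝔼-* XU (indicator v (decide T is)) _) ⟩
    𝔼 XT (λ is → indicator v (decide T is) * Prᵀ μ v U)
      ≈⟨ 𝔼-*ʳ XT (Prᵀ μ v U) _ ⟩
    Prᵀ μ v T * Prᵀ μ v U ∎
    where
    XT = samples μ (queries T)
    XU = samples μ (queries U)
    factor : ∀ is js → indicator v (decide (both v T U) (is ++ js)) ≈
                       indicator v (decide T is) * indicator v (decide U js)
    factor is js rewrite take-++ is js | drop-++ is js = indicator-unanimous v _ _

  all : Verdict → ∀ N → Tester n t → Tester n (N ℕ.* t)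
  all v zero    X = pure (record { queries = [] ; decide = λ _ → v })
  all v (suc N) X = X >>= λ T → both v T <$> all v N X

  Pr-all : ∀ (μ : Distribution n) v N (X : Tester n t) → Pr μ v (all v N X) ≈ Pr μ v X ^ N
  Pr-all {n} μ v zero X = begin-equality
    Pr μ v (all v 0 X)               ≈⟨ 𝔼-pure (record { queries = [] ; decide = λ _ → v }) (Prᵀ μ v) ⟩
    𝔼 (samples μ []) (λ _ → indicator v v) ≈⟨ 𝔼-const (samples μ []) (indicator v v) ⟩
    indicator v v                    ≈⟨ certain v ⟩
    1#                               ∎
    where
    certain : ∀ v → indicator v v ≈ 1#
    certain accept = refl
    certain reject = refl
  Pr-all μ v (suc N) X = begin-equality
    Pr μ v (all v (suc N) X)                                ≈⟨ 𝔼->>= X _ (Prᵀ μ v) ⟩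
    𝔼 X (λ T → Pr μ v (both v T <$> all v N X))             ≈⟨ 𝔼-cong X (λ T → 𝔼-<$> (both v T) (all v N X) (Prᵀ μ v)) ⟩
    𝔼 X (λ T → 𝔼 (all v N X) (λ U → Prᵀ μ v (both v T U)))  ≈⟨ 𝔼-cong X (λ T → 𝔼-cong (all v N X) (Prᵀ-both μ v T)) ⟩
    𝔼 X (λ T → 𝔼 (all v N X) (λ U → Prᵀ μ v T * Prᵀ μ v U)) ≈⟨ 𝔼-cong X (λ T → 𝔼-* (all v N X) (Prᵀ μ v T) (Prᵀ μ v)) ⟩
    𝔼 X (λ T → Prᵀ μ v T * Pr μ v (all v N X))              ≈⟨ 𝔼-*ʳ X (Pr μ v (all v N X)) (Prᵀ μ v) ⟩
    Pr μ v X * Pr μ v (all v N X)                           ≈⟨ *-congˡ (Pr-all μ v N X) ⟩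
    Pr μ v X * Pr μ v X ^ N                                 ∎

  algorithm : Tester n t → NonAdaptiveAlgorithm n t
  algorithm X = record
    { coinOutcomes = outcomeCount X
    ; coins        = law X
    ; queries      = queries ∘ outcome X
    ; decide       = decide ∘ outcome X
    }

  Pr-algorithm : ∀ (X : Tester n t) (μ : Distribution n) v → Pr[ algorithm X , μ ⇒ v ] ≈ Pr μ v X
  Pr-algorithm X μ v = trans
    (sum-cong-≋ {outcomeCount X} (λ ω → *-congˡ {prob (law X) ω} (expectation≈𝔼 μ (queries (outcome X ω)) _)))
    (∑-law X (Prᵀ μ v))

-- Amplification of the success probability

module Amplification (ℝ : Reals) where

  open Testing ℝ
  open IntegerCoefficients ℝ
  open OrderedField ℝ
  open FiniteProbability ℝ
  open Testers ℝ
  open ≤-Reasoning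

  private variable
    n t : ℕ

  -- A block accepts iff its N runs all accept, and the verdict is reject iff the l
  -- blocks all reject.  N makes up for a small chance of rejecting, l then makes
  -- both errors exponentially small.
  amplify : ∀ l N → Tester n t → Tester n (l ℕ.* (N ℕ.* t))
  amplify l N X = all reject l (all accept N X)

  private
    accept≈1-reject : ∀ (μ : Distribution n) (X : Tester n t) → Pr μ accept X ≈ 1# - Pr μ reject X
    accept≈1-reject μ X = begin-equality
      Pr μ accept X                                   ≈⟨ solve 2 (λ a r → a := a :+ r :- r) refl _ (Pr μ reject X) ⟩
      Pr μ accept X + Pr μ reject X - Pr μ reject X   ≈⟨ +-congʳ (Pr-total μ X) ⟩
      1# - Pr μ reject X                              ∎

    reject≈1-accept : ∀ (μ : Distribution n) (X : Tester n t) → Pr μ reject X ≈ 1# - Pr μ accept X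
    reject≈1-accept μ X = begin-equality
      Pr μ reject X                                   ≈⟨ solve 2 (λ a r → r := a :+ r :- a) refl (Pr μ accept X) _ ⟩
      Pr μ accept X + Pr μ reject X - Pr μ accept X   ≈⟨ +-congʳ (Pr-total μ X) ⟩
      1# - Pr μ accept X                              ∎

    1-mono : ∀ {x y} → x ≤ y → 1# - y ≤ 1# - x
    1-mono {x} {y} x≤y = ≤-by (y - x) (≤⇒0≤- x≤y)
      (solve 2 (λ x y → con (+ 1) :- x := con (+ 1) :- y :+ (y :- x)) refl x y)

    Pr≤1 : ∀ (μ : Distribution n) (X : Tester n t) → Pr μ reject X ≤ 1#
    Pr≤1 μ X = ≤-by (Pr μ accept X) (Pr-nonneg μ accept X)
      (trans (sym (Pr-total μ X)) (+-comm _ _))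

    2^ : ℕ → Carrier
    2^ l = fromℕ 2 ^ l

    0<2 : 0# < fromℕ 2
    0<2 = 0<fromℕ 2

  -- By the union bound a block rejects with probability at most 1/2.
  amplify-accepts : ∀ (μ : Distribution n) (X : Tester n t) l N {δ} → 1# ≤ fromℕ 2 ^ l * δ →
    fromℕ 2 * (fromℕ N * Pr μ reject X) ≤ 1# → 1# - δ ≤ Pr μ accept (amplify l N X)
  amplify-accepts μ X l N {δ} 1≤2^lδ 2Nx≤1 = begin
    1# - δ                              ≤⟨ 1-mono z^l≤δ ⟩
    1# - z ^ l                          ≈⟨ +-congˡ (-‿cong (Pr-all μ reject l block)) ⟨
    1# - Pr μ reject (amplify l N X)    ≈⟨ accept≈1-reject μ (amplify l N X) ⟨
    Pr μ accept (amplify l N X)         ∎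
    where
    block = all accept N X
    x = Pr μ reject X
    z = Pr μ reject block

    z≤Nx : z ≤ fromℕ N * x
    z≤Nx = begin
      z                           ≈⟨ reject≈1-accept μ block ⟩
      1# - Pr μ accept block      ≈⟨ +-congˡ (-‿cong (Pr-all μ accept N X)) ⟩
      1# - Pr μ accept X ^ N      ≈⟨ +-congˡ (-‿cong (^-cong N (accept≈1-reject μ X))) ⟩
      1# - (1# - x) ^ N           ≤⟨ 1-mono (bernoulli⁻ N (Pr≤1 μ X)) ⟩
      1# - (1# - fromℕ N * x)     ≈⟨ solve 1 (λ u → con (+ 1) :- (con (+ 1) :- u) := u) refl _ ⟩
      fromℕ N * x                 ∎

    z^l≤δ : z ^ l ≤ δ
    z^l≤δ = *-cancelˡ-≤ (0<^ l 0<2) (begin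
      2^ l * z ^ l              ≈⟨ ^-distrib-* (fromℕ 2) z l ⟨
      (fromℕ 2 * z) ^ l         ≤⟨ ^≤1 l (0≤* (<⇒≤ 0<2) (Pr-nonneg μ reject block))
                                     (≤-trans (*-monoˡ-≤ (<⇒≤ 0<2) z≤Nx) 2Nx≤1) ⟩
      1#                        ≤⟨ 1≤2^lδ ⟩
      2^ l * δ                  ∎)

  -- R runs all accept with probability at most 1/2, so a block accepts with
  -- probability at most 4⁻ˡ, and l · 4⁻ˡ ≤ 2⁻ˡ ≤ δ.
  amplify-rejects : ∀ (μ : Distribution n) (X : Tester n t) l R {δ} → 1# ≤ fromℕ 2 ^ l * δ →
    1# ≤ fromℕ R * Pr μ reject X → 1# - δ ≤ Pr μ reject (amplify l (R ℕ.* (l ℕ.+ l)) X)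
  amplify-rejects μ X l R {δ} 1≤2^lδ 1≤Rx = begin
    1# - δ                           ≤⟨ 1-mono ly≤δ ⟩
    1# - fromℕ l * y                 ≤⟨ bernoulli⁻ l y≤1 ⟩
    (1# - y) ^ l                     ≈⟨ ^-cong l (reject≈1-accept μ block) ⟨
    Pr μ reject block ^ l            ≈⟨ Pr-all μ reject l block ⟨
    Pr μ reject (amplify l N X)      ∎
    where
    N = R ℕ.* (l ℕ.+ l)
    block = all accept N X
    x = Pr μ reject X
    a = Pr μ accept X
    y = Pr μ accept block

    y≤1 : y ≤ 1#
    y≤1 = ≤-by (Pr μ reject block) (Pr-nonneg μ reject block) (sym (Pr-total μ block))

    0≤x = Pr-nonneg μ reject X
    0≤a = Pr-nonneg μ accept X

    a[1+x]≤1 : a * (1# + x) ≤ 1#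
    a[1+x]≤1 = ≤-by (x * x) (0≤x² x) (sym (begin-equality
      a * (1# + x) + x * x         ≈⟨ +-congʳ (*-congʳ (accept≈1-reject μ X)) ⟩
      (1# - x) * (1# + x) + x * x  ≈⟨ solve 1 (λ x → (con (+ 1) :- x) :* (con (+ 1) :+ x) :+ x :* x := con (+ 1)) refl x ⟩
      1#                           ∎))

    2a^R≤1 : fromℕ 2 * a ^ R ≤ 1#
    2a^R≤1 = begin
      fromℕ 2 * a ^ R             ≈⟨ *-comm _ _ ⟩
      a ^ R * (1# + (1# + 0#))    ≤⟨ *-monoˡ-≤ (0≤^ R 0≤a) (+-monoʳ-≤ 1#
                                       (≤-trans (≤-reflexive (+-identityʳ 1#)) 1≤Rx)) ⟩
      a ^ R * (1# + fromℕ R * x)  ≤⟨ *-monoˡ-≤ (0≤^ R 0≤a) (bernoulli R (0≤+ 0≤1 0≤x)) ⟩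
      a ^ R * (1# + x) ^ R        ≈⟨ ^-distrib-* a (1# + x) R ⟨
      (a * (1# + x)) ^ R          ≤⟨ ^≤1 R (0≤* 0≤a (0≤+ 0≤1 0≤x)) a[1+x]≤1 ⟩
      1#                          ∎

    2^2l*y≤1 : 2^ l * (2^ l * y) ≤ 1#
    2^2l*y≤1 = begin
      2^ l * (2^ l * y)                        ≈⟨ *-assoc _ _ _ ⟨
      2^ l * 2^ l * y                          ≈⟨ *-cong (sym (^-+ (fromℕ 2) l l))
                                                    (trans (Pr-all μ accept N X) (sym (^-*-assoc a R (l ℕ.+ l)))) ⟩
      fromℕ 2 ^ (l ℕ.+ l) * (a ^ R) ^ (l ℕ.+ l) ≈⟨ ^-distrib-* (fromℕ 2) (a ^ R) (l ℕ.+ l) ⟨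
      (fromℕ 2 * a ^ R) ^ (l ℕ.+ l)            ≤⟨ ^≤1 (l ℕ.+ l) (0≤* (<⇒≤ 0<2) (0≤^ R 0≤a)) 2a^R≤1 ⟩
      1#                                       ∎

    ly≤δ : fromℕ l * y ≤ δ
    ly≤δ = *-cancelˡ-≤ (0<^ l 0<2) (begin
      2^ l * (fromℕ l * y) ≤⟨ *-monoˡ-≤ (0≤^ l (<⇒≤ 0<2)) (*-monoʳ-≤ (Pr-nonneg μ accept block) (fromℕ≤2^ l)) ⟩
      2^ l * (2^ l * y)    ≤⟨ 2^2l*y≤1 ⟩
      1#                   ≤⟨ 1≤2^lδ ⟩
      2^ l * δ             ∎)

-- Detecting a deviation of conditional probabilities

module DeviationTest (ℝ : Reals) where

  open Testing ℝ
  open IntegerCoefficients ℝ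
  open OrderedField ℝ
  open FiniteProbability ℝ
  open Testers ℝ
  open Amplification ℝ
  open ≤-Reasoning

  private variable
    n : ℕ
    A : Set

  sumOver : (A → Carrier) → ∀ {s} → Vec A s → Carrier
  sumOver g []       = 0#
  sumOver g (a ∷ as) = g a + sumOver g as

  module _ (X : Random A) (g : A → Carrier) where

    𝔼-sumOver : ∀ s → 𝔼 (iid X s) (sumOver g) ≈ fromℕ s * 𝔼 X g
    𝔼-sumOver zero    = trans (𝔼-pure [] (sumOver g)) (sym (zeroˡ _))
    𝔼-sumOver (suc s) = begin-equality
      𝔼 (iid X (suc s)) (sumOver g)                      ≈⟨ 𝔼-iid X s (sumOver g) ⟩
      𝔼 X (λ a → 𝔼 (iid X s) (λ as → g a + sumOver g as)) ≈⟨ 𝔼-cong X (λ a → trans (𝔼-+ (iid X s) (λ _ → g a) (sumOver g))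
                                                               (+-cong (𝔼-const (iid X s) (g a)) (𝔼-sumOver s))) ⟩
      𝔼 X (λ a → g a + fromℕ s * 𝔼 X g)                  ≈⟨ 𝔼-+ X g _ ⟩
      𝔼 X g + 𝔼 X (λ _ → fromℕ s * 𝔼 X g)                ≈⟨ +-congˡ (𝔼-const X _) ⟩
      𝔼 X g + fromℕ s * 𝔼 X g                            ≈⟨ solve 2 (λ e s → e :+ s :* e := (con (+ 1) :+ s) :* e) refl (𝔼 X g) (fromℕ s) ⟩
      fromℕ (suc s) * 𝔼 X g                              ∎

    -- Cross terms vanish, so variances add up.
    𝔼-sumOver² : 𝔼 X g ≈ 0# → ∀ s →
      𝔼 (iid X s) (λ as → sumOver g as * sumOver g as) ≈ fromℕ s * 𝔼 X (λ a → g a * g a)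
    𝔼-sumOver² centred zero    = trans (𝔼-pure [] (λ as → sumOver g as * sumOver g as))
      (trans (zeroˡ _) (sym (zeroˡ _)))
    𝔼-sumOver² centred (suc s) = begin-equality
      𝔼 (iid X (suc s)) (λ as → sumOver g as * sumOver g as)   ≈⟨ 𝔼-iid X s _ ⟩
      𝔼 X (λ a → 𝔼 (iid X s) (λ as → (g a + S as) * (g a + S as))) ≈⟨ 𝔼-cong X given ⟩
      𝔼 X (λ a → g a * g a + fromℕ s * V)                      ≈⟨ 𝔼-+ X _ _ ⟩
      V + 𝔼 X (λ _ → fromℕ s * V)                              ≈⟨ +-congˡ (𝔼-const X _) ⟩
      V + fromℕ s * V                                          ≈⟨ solve 2 (λ e s → e :+ s :* e := (con (+ 1) :+ s) :* e) refl V (fromℕ s) ⟩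
      fromℕ (suc s) * V                                        ∎
      where
      S = sumOver g {s}
      V = 𝔼 X (λ a → g a * g a)
      Y = iid X s

      given : ∀ a → 𝔼 Y (λ as → (g a + S as) * (g a + S as)) ≈ g a * g a + fromℕ s * V
      given a = begin-equality
        𝔼 Y (λ as → (g a + S as) * (g a + S as))
          ≈⟨ 𝔼-cong Y (λ as → solve 2 (λ g s → (g :+ s) :* (g :+ s) := g :* g :+ (g :+ g) :* s :+ s :* s) refl (g a) (S as)) ⟩
        𝔼 Y (λ as → g a * g a + (g a + g a) * S as + S as * S as)
          ≈⟨ 𝔼-+ Y _ _ ⟩
        𝔼 Y (λ as → g a * g a + (g a + g a) * S as) + 𝔼 Y (λ as → S as * S as)
          ≈⟨ +-cong (𝔼-+ Y _ _) (𝔼-sumOver² centred s) ⟩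
        𝔼 Y (λ _ → g a * g a) + 𝔼 Y (λ as → (g a + g a) * S as) + fromℕ s * V
          ≈⟨ +-congʳ (+-cong (𝔼-const Y _) (trans (𝔼-* Y (g a + g a) S) (trans (*-congˡ mean≈0) (zeroʳ _)))) ⟩
        g a * g a + 0# + fromℕ s * V
          ≈⟨ +-congʳ (+-identityʳ _) ⟩
        g a * g a + fromℕ s * V ∎
        where
        mean≈0 : 𝔼 Y S ≈ 0#
        mean≈0 = trans (𝔼-sumOver s) (trans (*-congˡ centred) (zeroʳ _))

  point : Fin n → Fin n → Carrier
  point h j = if does (h Fin.≟ j) then 1# else 0#

  ∑-point : ∀ (w : Fin n → Carrier) h → ∑[ j < n ] (w j * point h j) ≈ w h
  ∑-point {suc n} w zero = begin-equality
    w zero * 1# + ∑[ j < n ] (w (suc j) * 0#) ≈⟨ +-cong (*-identityʳ _) (sym (*-distribʳ-sum 0# (w ∘ suc))) ⟩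
    w zero + sum (w ∘ suc) * 0#               ≈⟨ +-congˡ (zeroʳ _) ⟩
    w zero + 0#                               ≈⟨ +-identityʳ _ ⟩
    w zero                                    ∎
  ∑-point {suc n} w (suc h) = begin-equality
    w zero * 0# + ∑[ j < n ] (w (suc j) * point h j) ≈⟨ +-cong (zeroʳ _) (∑-point (w ∘ suc) h) ⟩
    0# + w (suc h)                                   ≈⟨ +-identityˡ _ ⟩
    w (suc h)                                        ∎

  point² : ∀ (h j : Fin n) → point h j * point h j ≈ point h j
  point² h j with does (h Fin.≟ j)
  ... | true  = *-identityˡ 1#
  ... | false = zeroˡ 0#

  excess : (Fin n → Carrier) → ∀ {r} → Fin n → Vec (Fin n) r → Carrier
  excess p h = sumOver (λ j → point h j - p h)

  squaredExcess : (Fin n → Carrier) → ∀ {r} → Vec (Fin n) r → Carrier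
  squaredExcess {n} p js = ∑[ h < n ] (excess p h js * excess p h js)

  module _ (ν : Distribution n) (A : ConditioningSet n) where

    private
      q = conditional ν A
      X = sample ν A

    𝔼-point : ∀ h → 𝔼 X (point h) ≈ q h
    𝔼-point h = trans (𝔼-sample ν A (point h)) (∑-point q h)

    excess-variance : ∀ {p} h → p h ≈ q h → ∀ r →
      𝔼 (iid X r) (λ js → excess p h js * excess p h js) ≤ fromℕ r * q h
    excess-variance {p} h p≈q r = begin
      𝔼 (iid X r) (λ js → excess p h js * excess p h js)
        ≈⟨ 𝔼-sumOver² X (λ j → point h j - p h) centred r ⟩
      fromℕ r * 𝔼 X (λ j → (point h j - p h) * (point h j - p h))
        ≤⟨ *-monoˡ-≤ (0≤fromℕ r) variance ⟩
      fromℕ r * q h ∎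
      where
      centred : 𝔼 X (λ j → point h j - p h) ≈ 0#
      centred = begin-equality
        𝔼 X (λ j → point h j - p h)              ≈⟨ 𝔼-+ X (point h) (λ _ → - p h) ⟩
        𝔼 X (point h) + 𝔼 X (λ _ → - p h)        ≈⟨ +-cong (𝔼-point h) (𝔼-const X _) ⟩
        q h - p h                                ≈⟨ +-congˡ (-‿cong p≈q) ⟩
        q h - q h                                ≈⟨ -‿inverseʳ _ ⟩
        0#                                       ∎

      c = p h
      variance : 𝔼 X (λ j → (point h j - c) * (point h j - c)) ≤ q h
      variance = ≤-by (c * c) (0≤x² c) (sym (begin-equality
        𝔼 X (λ j → (point h j - c) * (point h j - c)) + c * c
          ≈⟨ +-congʳ (𝔼-cong X (λ j → trans
               (solve 2 (λ d c → (d :- c) :* (d :- c) := d :* d :+ (c :* c :+ (:- c :- c) :* d)) refl (point h j) c)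
               (+-congʳ (point² h j)))) ⟩
        𝔼 X (λ j → point h j + (c * c + (- c - c) * point h j)) + c * c
          ≈⟨ +-congʳ (𝔼-+ X _ _) ⟩
        𝔼 X (point h) + 𝔼 X (λ j → c * c + (- c - c) * point h j) + c * c
          ≈⟨ +-congʳ (+-cong (𝔼-point h) (𝔼-+ X _ _)) ⟩
        q h + (𝔼 X (λ _ → c * c) + 𝔼 X (λ j → (- c - c) * point h j)) + c * c
          ≈⟨ +-congʳ (+-congˡ (+-cong (𝔼-const X _) (trans (𝔼-* X (- c - c) (point h)) (*-congˡ (trans (𝔼-point h) (sym p≈q)))))) ⟩
        q h + (c * c + (- c - c) * c) + c * c
          ≈⟨ solve 2 (λ q c → q :+ (c :* c :+ (:- c :- c) :* c) :+ c :* c := q) refl (q h) c ⟩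
        q h ∎))

  deviationTest : Distribution n → Carrier → ∀ r → ConditioningSet n → Test n r
  deviationTest μ θ r A = record
    { queries = replicate r A
    ; decide  = λ js → if does (θ * θ ≤? squaredExcess (conditional μ A) js) then reject else accept
    }

  -- Markov's inequality for the statistic: the variances of the counts of all
  -- elements add up to at most r, since the probabilities add up to 1.
  deviationTest-sound : ∀ (μ ν : Distribution n) θ r A →
    (∀ h → conditional μ A h ≈ conditional ν A h) →
    θ * θ * Prᵀ ν reject (deviationTest μ θ r A) ≤ fromℕ r
  deviationTest-sound {n} μ ν θ r A p≈q rewrite samples-replicate ν r A = begin
    θ * θ * 𝔼 Y (λ js → indicator reject (decide js))
      ≈⟨ 𝔼-* Y (θ * θ) _ ⟨
    𝔼 Y (λ js → θ * θ * indicator reject (decide js))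
      ≤⟨ 𝔼-mono Y alarm ⟩
    𝔼 Y (squaredExcess p)
      ≈⟨ 𝔼-sum Y (λ h js → excess p h js * excess p h js) ⟩
    ∑[ h < n ] 𝔼 Y (λ js → excess p h js * excess p h js)
      ≤⟨ sum-mono (λ h → excess-variance ν A {p} h (p≈q h) r) ⟩
    ∑[ h < n ] (fromℕ r * conditional ν A h)
      ≈⟨ *-distribˡ-sum (fromℕ r) (conditional ν A) ⟨
    fromℕ r * sum (conditional ν A)
      ≈⟨ *-congˡ (conditional-total ν A) ⟩
    fromℕ r * 1#
      ≈⟨ *-identityʳ _ ⟩
    fromℕ r ∎
    where
    p = conditional μ A
    Y = iid (sample ν A) r
    open Test (deviationTest μ θ r A) using (decide)

    alarm : ∀ js → θ * θ * indicator reject (decide js) ≤ squaredExcess p js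
    alarm js with θ * θ ≤? squaredExcess p js
    ... | yes θ²≤χ² = ≤-trans (≤-reflexive (*-identityʳ _)) θ²≤χ²
    ... | no  _     = ≤-trans (≤-reflexive (zeroʳ _)) (sum-nonneg (λ h → 0≤x² (excess p h js)))

  -- If ν gives h an excess η, then a statistic below θ² forces the count of h to
  -- fall short of its ν-mean by at least θ, which Chebyshev's inequality bounds.
  deviationTest-complete : ∀ (μ ν : Distribution n) {θ η} r A h → 0# ≤ θ → θ + θ ≤ fromℕ r * η →
    conditional μ A h + η ≤ conditional ν A h →
    θ * θ * Prᵀ ν accept (deviationTest μ θ r A) ≤ fromℕ r
  deviationTest-complete {n} μ ν {θ} {η} r A h 0≤θ 2θ≤rη p+η≤q rewrite samples-replicate ν r A = begin
    θ * θ * 𝔼 Y (λ js → indicator accept (decide js))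
      ≈⟨ 𝔼-* Y (θ * θ) _ ⟨
    𝔼 Y (λ js → θ * θ * indicator accept (decide js))
      ≤⟨ 𝔼-mono Y miss ⟩
    𝔼 Y (λ js → excess q h js * excess q h js)
      ≤⟨ excess-variance ν A {q} h refl r ⟩
    fromℕ r * q h
      ≤⟨ *-monoˡ-≤ (0≤fromℕ r) (≤-trans (term≤sum (conditional-nonneg ν A) h) (≤-reflexive (conditional-total ν A))) ⟩
    fromℕ r * 1#
      ≈⟨ *-identityʳ _ ⟩
    fromℕ r ∎
    where
    p = conditional μ A
    q = conditional ν A
    Y = iid (sample ν A) r
    open Test (deviationTest μ θ r A) using (decide)

    shift : ∀ {s} (js : Vec (Fin n) s) → excess p h js ≈ excess q h js + fromℕ s * (q h - p h)
    shift []       = sym (trans (+-identityˡ _) (zeroˡ _))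
    shift {suc s} (j ∷ js) = trans (+-congˡ (shift js))
      (solve 5 (λ d p q e s → d :- p :+ (e :+ s :* (q :- p)) := d :- q :+ e :+ (con (+ 1) :+ s) :* (q :- p))
        refl (point h j) (p h) (q h) (excess q h js) (fromℕ s))

    2θ≤r[q-p] : θ + θ ≤ fromℕ r * (q h - p h)
    2θ≤r[q-p] = begin
      θ + θ                     ≤⟨ 2θ≤rη ⟩
      fromℕ r * η               ≈⟨ *-congˡ (solve 2 (λ p η → η := p :+ η :- p) refl (p h) η) ⟩
      fromℕ r * (p h + η - p h) ≤⟨ *-monoˡ-≤ (0≤fromℕ r) (+-monoˡ-≤ (- p h) p+η≤q) ⟩
      fromℕ r * (q h - p h)     ∎

    miss : ∀ js → θ * θ * indicator accept (decide js) ≤ excess q h js * excess q h js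
    miss js with θ * θ ≤? squaredExcess p js
    ... | yes _     = ≤-trans (≤-reflexive (zeroʳ _)) (0≤x² _)
    ... | no  θ²≰χ² = ≤-trans (≤-reflexive (*-identityʳ _)) (far (excess q h js ≤? - θ))
      where
      e = excess q h js
      far : Dec (e ≤ - θ) → θ * θ ≤ e * e
      far (yes e≤-θ) = begin
        θ * θ      ≤⟨ square-mono-≤ 0≤θ (≤-by (- θ - e) (≤⇒0≤- e≤-θ) (solve 2 (λ t e → :- e := t :+ (:- t :- e)) refl θ e)) ⟩
        - e * - e  ≈⟨ solve 1 (λ e → :- e :* :- e := e :* e) refl e ⟩
        e * e      ∎
      far (no e≰-θ) = contradiction (begin
        θ * θ                           ≤⟨ square-mono-≤ 0≤θ θ≤excess ⟩
        excess p h js * excess p h js   ≤⟨ term≤sum (λ h → 0≤x² (excess p h js)) h ⟩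
        squaredExcess p js                  ∎) θ²≰χ²
        where
        θ≤excess : θ ≤ excess p h js
        θ≤excess = begin
          θ                             ≈⟨ solve 1 (λ t → t := :- t :+ (t :+ t)) refl θ ⟩
          - θ + (θ + θ)                 ≤⟨ +-mono-≤ (<⇒≤ (≰⇒> e≰-θ)) 2θ≤r[q-p] ⟩
          e + fromℕ r * (q h - p h)     ≈⟨ shift js ⟨
          excess p h js                 ∎

-- Heavy elements in random sets

module RandomSets (ℝ : Reals) where

  open Testing ℝ
  open IntegerCoefficients ℝ
  open OrderedField ℝ
  open FiniteProbability ℝ
  open Testers ℝ
  open Amplification ℝ
  open DeviationTest ℝ
  open ≤-Reasoning

  private variable
    n m : ℕ
    A P Q : Set

  𝟙 : Dec P → Carrier
  𝟙 P? = if does P? then 1# else 0#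

  𝟙-true : (P? : Dec P) → P → 𝟙 P? ≈ 1#
  𝟙-true P? p rewrite dec-true P? p = refl

  𝟙-false : (P? : Dec P) → ¬ P → 𝟙 P? ≈ 0#
  𝟙-false P? ¬p rewrite dec-false P? ¬p = refl

  𝟙-nonneg : (P? : Dec P) → 0# ≤ 𝟙 P?
  𝟙-nonneg (yes _) = 0≤1
  𝟙-nonneg (no  _) = ≤-refl

  𝟙≤1 : (P? : Dec P) → 𝟙 P? ≤ 1#
  𝟙≤1 (yes _) = ≤-refl
  𝟙≤1 (no  _) = 0≤1

  𝟙-mono : (P? : Dec P) (Q? : Dec Q) → (P → Q) → 𝟙 P? ≤ 𝟙 Q?
  𝟙-mono (yes p) Q? P⇒Q = ≤-reflexive (sym (𝟙-true Q? (P⇒Q p)))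
  𝟙-mono (no  _) Q? P⇒Q = 𝟙-nonneg Q?

  point-refl : ∀ (h : Fin n) → point h h ≈ 1#
  point-refl h = 𝟙-true (h Fin.≟ h) ≡.refl

  point-≢ : ∀ {h j : Fin n} → h ≢ j → point h j ≈ 0#
  point-≢ {h = h} {j} h≢j = 𝟙-false (h Fin.≟ j) h≢j

  point-nonneg : ∀ (h j : Fin n) → 0# ≤ point h j
  point-nonneg h j = 𝟙-nonneg (h Fin.≟ j)

  ∑-const : ∀ c → ∑[ i < n ] c ≈ fromℕ n * c
  ∑-const {n} c = begin-equality
    ∑[ i < n ] c         ≈⟨ sum-replicate n ⟩
    n · c                ≈⟨ Mult.×-congʳ semiring n (*-identityˡ c) ⟨
    n · (1# * c)         ≈⟨ Mult.×-assoc-* semiring n 1# c ⟨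
    fromℕ n * c          ∎

  sumOver-removeAt : ∀ (g : A → Carrier) (xs : Vec A (suc m)) p →
                     sumOver g xs ≈ g (lookup xs p) + sumOver g (removeAt xs p)
  sumOver-removeAt g (x ∷ xs)     zero    = refl
  sumOver-removeAt g (x ∷ y ∷ xs) (suc p) = trans (+-congˡ (sumOver-removeAt g (y ∷ xs) p))
    (solve 3 (λ a b c → a :+ (b :+ c) := b :+ (a :+ c)) refl (g x) (g (lookup (y ∷ xs) p)) _)

  lookup-removeAt : ∀ (xs : Vec A (suc m)) p q → lookup (removeAt xs p) q ≡ lookup xs (punchIn p q)
  lookup-removeAt (x ∷ xs)     zero    q       = ≡.refl
  lookup-removeAt (x ∷ y ∷ xs) (suc p) zero    = ≡.refl
  lookup-removeAt (x ∷ y ∷ xs) (suc p) (suc q) = lookup-removeAt (y ∷ xs) p q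

  module _ (X : Random A) (u : A → Carrier) where

    -- The removed coordinate is independent of the others.
    𝔼-removeAt : ∀ {m} (k : Vec A m → Carrier) p →
      𝔼 (iid X (suc m)) (λ xs → u (lookup xs p) * k (removeAt xs p)) ≈ 𝔼 X u * 𝔼 (iid X m) k
    𝔼-removeAt {m} k zero = begin-equality
      𝔼 (iid X (suc m)) (λ xs → u (lookup xs zero) * k (removeAt xs zero))
        ≈⟨ 𝔼-iid X m (λ xs → u (lookup xs zero) * k (removeAt xs zero)) ⟩
      𝔼 X (λ a → 𝔼 (iid X m) (λ as → u a * k as))
        ≈⟨ 𝔼-cong X (λ a → 𝔼-* (iid X m) (u a) k) ⟩
      𝔼 X (λ a → u a * 𝔼 (iid X m) k)
        ≈⟨ 𝔼-*ʳ X (𝔼 (iid X m) k) u ⟩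
      𝔼 X u * 𝔼 (iid X m) k ∎
    𝔼-removeAt {suc m} k (suc p) = begin-equality
      𝔼 (iid X (suc (suc m))) (λ xs → u (lookup xs (suc p)) * k (removeAt xs (suc p)))
        ≈⟨ 𝔼-iid X (suc m) (λ xs → u (lookup xs (suc p)) * k (removeAt xs (suc p))) ⟩
      𝔼 X (λ a → 𝔼 (iid X (suc m)) (λ as → u (lookup as p) * k (removeAt (a ∷ as) (suc p))))
        ≈⟨ 𝔼-cong X (λ a → 𝔼-cong (iid X (suc m)) λ { (b ∷ bs) → refl }) ⟩
      𝔼 X (λ a → 𝔼 (iid X (suc m)) (λ as → u (lookup as p) * k (a ∷ removeAt as p)))
        ≈⟨ 𝔼-cong X (λ a → 𝔼-removeAt (λ as → k (a ∷ as)) p) ⟩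
      𝔼 X (λ a → 𝔼 X u * 𝔼 (iid X m) (λ as → k (a ∷ as)))
        ≈⟨ 𝔼-* X (𝔼 X u) _ ⟩
      𝔼 X u * 𝔼 X (λ a → 𝔼 (iid X m) (λ as → k (a ∷ as)))
        ≈⟨ *-congˡ (𝔼-iid X m k) ⟨
      𝔼 X u * 𝔼 (iid X (suc m)) k ∎

    𝔼-∑-removeAt : ∀ {m} (k : Vec A m → Carrier) →
      𝔼 (iid X (suc m)) (λ xs → ∑[ p < suc m ] (u (lookup xs p) * k (removeAt xs p)))
        ≈ fromℕ (suc m) * (𝔼 X u * 𝔼 (iid X m) k)
    𝔼-∑-removeAt {m} k = begin-equality
      𝔼 (iid X (suc m)) (λ xs → ∑[ p < suc m ] (u (lookup xs p) * k (removeAt xs p)))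
        ≈⟨ 𝔼-sum (iid X (suc m)) (λ p xs → u (lookup xs p) * k (removeAt xs p)) ⟩
      ∑[ p < suc m ] 𝔼 (iid X (suc m)) (λ xs → u (lookup xs p) * k (removeAt xs p))
        ≈⟨ sum-cong-≋ {suc m} (𝔼-removeAt k) ⟩
      ∑[ p < suc m ] (𝔼 X u * 𝔼 (iid X m) k)
        ≈⟨ ∑-const {suc m} _ ⟩
      fromℕ (suc m) * (𝔼 X u * 𝔼 (iid X m) k) ∎

  support : Vec (Fin n) m → Subset n
  support []       = ⊥
  support (x ∷ xs) = ⁅ x ⁆ ∪ support xs

  lookup∈support : ∀ (xs : Vec (Fin n) m) p → lookup xs p ∈ support xs
  lookup∈support (x ∷ xs) zero    = x∈p∪q⁺ (inj₁ (x∈⁅x⁆ x))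
  lookup∈support (x ∷ xs) (suc p) = x∈p∪q⁺ (inj₂ (lookup∈support xs p))

  setOf : Vec (Fin n) (suc m) → ConditioningSet n
  setOf xs = support xs , lookup xs zero , lookup∈support xs zero

  mass-support≤ : ∀ (ν : Distribution n) (xs : Vec (Fin n) m) → mass ν (support xs) ≤ sumOver (prob ν) xs
  mass-support≤ {n} ν [] = ≤-reflexive (begin-equality
    sum (restrict ⊥ (prob ν)) ≈⟨ sum-cong-≋ {n} (λ i → restrict-∉ ⊥ (prob ν) {i} ∉⊥) ⟩
    ∑[ i < n ] 0#             ≈⟨ trans (∑-const {n} 0#) (zeroʳ _) ⟩
    0#                        ∎)
  mass-support≤ {n} ν (x ∷ xs) = begin
    sum (restrict (⁅ x ⁆ ∪ support xs) (prob ν))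
      ≤⟨ sum-mono pointwise ⟩
    ∑[ i < n ] (prob ν i * point x i + restrict (support xs) (prob ν) i)
      ≈⟨ ∑-distrib-+ {n} (λ i → prob ν i * point x i) (restrict (support xs) (prob ν)) ⟩
    ∑[ i < n ] (prob ν i * point x i) + mass ν (support xs)
      ≤⟨ +-mono-≤ (≤-reflexive (∑-point (prob ν) x)) (mass-support≤ ν xs) ⟩
    prob ν x + sumOver (prob ν) xs ∎
    where
    pointwise : ∀ i → restrict (⁅ x ⁆ ∪ support xs) (prob ν) i ≤
                      prob ν i * point x i + restrict (support xs) (prob ν) i
    pointwise i = cases (i ∈? support xs) (x Fin.≟ i)
      where
      0≤point = 0≤* (nonneg ν i) (point-nonneg x i)

      cases : Dec (i ∈ support xs) → Dec (x ≡ i) → _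
      cases (yes i∈xs) _ = begin
        restrict (⁅ x ⁆ ∪ support xs) (prob ν) i            ≤⟨ restrict-≤ _ (nonneg ν) i ⟩
        prob ν i                                            ≈⟨ restrict-∈ (support xs) (prob ν) i∈xs ⟨
        restrict (support xs) (prob ν) i                    ≤⟨ ≤-by _ 0≤point (+-comm _ _) ⟩
        prob ν i * point x i + restrict (support xs) (prob ν) i ∎
      cases (no _) (yes ≡.refl) = begin
        restrict (⁅ x ⁆ ∪ support xs) (prob ν) x            ≤⟨ restrict-≤ _ (nonneg ν) x ⟩
        prob ν x                                            ≈⟨ trans (*-congˡ (point-refl x)) (*-identityʳ _) ⟨
        prob ν x * point x x                                ≤⟨ ≤-by _ (restrict-nonneg (support xs) (nonneg ν) x) refl ⟩
        prob ν x * point x x + restrict (support xs) (prob ν) x ∎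
      cases (no i∉xs) (no x≢i) = begin
        restrict (⁅ x ⁆ ∪ support xs) (prob ν) i
          ≈⟨ restrict-∉ (⁅ x ⁆ ∪ support xs) (prob ν)
               (λ i∈ → [ (λ i∈x → x≢i (≡.sym (x∈⁅y⁆⇒x≡y x i∈x))) , i∉xs ]′ (x∈p∪q⁻ ⁅ x ⁆ (support xs) i∈)) ⟩
        0#
          ≤⟨ 0≤+ 0≤point (restrict-nonneg (support xs) (nonneg ν) i) ⟩
        prob ν i * point x i + restrict (support xs) (prob ν) i ∎

  two-elements≤mass : ∀ (ν : Distribution n) {S : Subset n} {h l} → h ∈ S → l ∈ S → h ≢ l →
                      prob ν h + prob ν l ≤ mass ν S
  two-elements≤mass {n} ν {S} {h} {l} h∈S l∈S h≢l = begin
    prob ν h + prob ν l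
      ≈⟨ +-cong (∑-point (prob ν) h) (∑-point (prob ν) l) ⟨
    ∑[ i < n ] (prob ν i * point h i) + ∑[ i < n ] (prob ν i * point l i)
      ≈⟨ ∑-distrib-+ {n} (λ i → prob ν i * point h i) (λ i → prob ν i * point l i) ⟨
    ∑[ i < n ] (prob ν i * point h i + prob ν i * point l i)
      ≤⟨ sum-mono (λ i → cases i (h Fin.≟ i) (l Fin.≟ i)) ⟩
    mass ν S ∎
    where
    is : ∀ i → prob ν i * point i i ≈ prob ν i
    is i = trans (*-congˡ (point-refl i)) (*-identityʳ _)

    isn't : ∀ {i j} → j ≢ i → prob ν i * point j i ≈ 0#
    isn't {i} j≢i = trans (*-congˡ (point-≢ j≢i)) (zeroʳ _)

    cases : ∀ i → Dec (h ≡ i) → Dec (l ≡ i) →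
            prob ν i * point h i + prob ν i * point l i ≤ restrict S (prob ν) i
    cases i (yes ≡.refl) _ = ≤-reflexive (trans (+-cong (is h) (isn't (h≢l ∘ ≡.sym)))
      (trans (+-identityʳ _) (sym (restrict-∈ S (prob ν) h∈S))))
    cases i (no h≢i) (yes ≡.refl) = ≤-reflexive (trans (+-cong (isn't h≢i) (is l))
      (trans (+-identityˡ _) (sym (restrict-∈ S (prob ν) l∈S))))
    cases i (no h≢i) (no l≢i) = ≤-trans
      (≤-reflexive (trans (+-cong (isn't h≢i) (isn't l≢i)) (+-identityˡ 0#)))
      (restrict-nonneg S (nonneg ν) i)

  module _ (μ ν : Distribution n) {γ η : Carrier} (9η≈γ : fromℕ 9 * η ≈ γ) (0≤γ : 0# ≤ γ) where

    -- Here σ bounds the ν-mass of A without h.  Since A has at most three times the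
    -- μ-mass of A without h and at most three times the ν-mass of h, the gap
    -- survives in the conditional probabilities up to the factor 9.
    excess-at-heavy : ∀ (A : ConditioningSet n) {h l σ} →
      h ∈ proj₁ A → l ∈ proj₁ A → h ≢ l → 0# < prob μ h → 0# < prob ν h →
      prob μ h ≤ fromℕ 2 * prob μ l →
      mass ν (proj₁ A) ≤ prob ν h + σ → σ ≤ fromℕ 2 * prob ν h →
      prob μ h * σ + γ * (prob ν h * prob μ l) ≤ prob ν h * prob μ l → γ ≤ 1# →
      conditional μ A h + η ≤ conditional ν A h
    excess-at-heavy A {h} {l} {σ} h∈A l∈A h≢l 0<a 0<a′ a≤2l S′≤a′+σ σ≤2a′ gap γ≤1 = begin
      conditional μ A h + η ≈⟨ +-congʳ (conditional-0<mass μ A 0<S h) ⟩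
      restrict (proj₁ A) (prob μ) h * S ⁻¹ + η ≈⟨ +-congʳ (*-congʳ (restrict-∈ (proj₁ A) (prob μ) h∈A)) ⟩
      a * S ⁻¹ + η          ≤⟨ *-cancelˡ-≤ (*-pos 0<S 0<S′) scaled ⟩
      a′ * S′ ⁻¹            ≈⟨ *-congʳ (restrict-∈ (proj₁ A) (prob ν) h∈A) ⟨
      restrict (proj₁ A) (prob ν) h * S′ ⁻¹ ≈⟨ conditional-0<mass ν A 0<S′ h ⟨
      conditional ν A h     ∎
      where
      a  = prob μ h
      a′ = prob ν h
      ml = prob μ l
      S  = mass μ (proj₁ A)
      S′ = mass ν (proj₁ A)
      b  = S - a

      a+ml≤S : a + ml ≤ S
      a+ml≤S = two-elements≤mass μ h∈A l∈A h≢l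

      0<S : 0# < S
      0<S = begin-strict
        0#      <⟨ 0<a ⟩
        a       ≤⟨ ≤-by ml (nonneg μ l) refl ⟩
        a + ml  ≤⟨ a+ml≤S ⟩
        S       ∎

      0<S′ : 0# < S′
      0<S′ = begin-strict
        0#               <⟨ 0<a′ ⟩
        a′               ≤⟨ ≤-by (prob ν l) (nonneg ν l) refl ⟩
        a′ + prob ν l    ≤⟨ two-elements≤mass ν h∈A l∈A h≢l ⟩
        S′               ∎

      ml≤b : ml ≤ b
      ml≤b = ≤-by (S - (a + ml)) (≤⇒0≤- a+ml≤S)
        (solve 3 (λ s a m → s :- a := m :+ (s :- (a :+ m))) refl S a ml)

      0≤b : 0# ≤ b
      0≤b = ≤-trans (nonneg μ l) ml≤b

      S≤3b : S ≤ fromℕ 3 * b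
      S≤3b = ≤-by (fromℕ 2 * b - a) (≤⇒0≤- (≤-trans a≤2l (*-monoˡ-≤ (0≤fromℕ 2) ml≤b)))
        (solve 2 (λ s a → con (+ 3) :* (s :- a) := s :+ (con (+ 2) :* (s :- a) :- a)) refl S a)

      S′≤3a′ : S′ ≤ fromℕ 3 * a′
      S′≤3a′ = begin
        S′                 ≤⟨ S′≤a′+σ ⟩
        a′ + σ             ≤⟨ +-monoʳ-≤ a′ σ≤2a′ ⟩
        a′ + fromℕ 2 * a′  ≈⟨ solve 1 (λ a → a :+ con (+ 2) :* a := con (+ 3) :* a) refl a′ ⟩
        fromℕ 3 * a′       ∎

      0≤η : 0# ≤ η
      0≤η = *-cancelˡ-≤ (0<fromℕ 9) (≤-trans (≤-reflexive (zeroʳ _)) (≤-trans 0≤γ (≤-reflexive (sym 9η≈γ))))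

      gap-b : a * σ + γ * (a′ * b) ≤ a′ * b
      gap-b = begin
        a * σ + γ * (a′ * b)
          ≈⟨ solve 5 (λ x g a b m → x :+ g :* (a :* b) := x :+ g :* (a :* m) :+ g :* (a :* (b :- m))) refl (a * σ) γ a′ b ml ⟩
        a * σ + γ * (a′ * ml) + γ * (a′ * (b - ml))
          ≤⟨ +-mono-≤ gap (*-monoʳ-≤ (0≤* (<⇒≤ 0<a′) (≤⇒0≤- ml≤b)) γ≤1) ⟩
        a′ * ml + 1# * (a′ * (b - ml))
          ≈⟨ solve 3 (λ a b m → a :* m :+ con (+ 1) :* (a :* (b :- m)) := a :* b) refl a′ b ml ⟩
        a′ * b ∎

      scaled : S * S′ * (a * S ⁻¹ + η) ≤ S * S′ * (a′ * S′ ⁻¹)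
      scaled = begin
        S * S′ * (a * S ⁻¹ + η)
          ≈⟨ solve 4 (λ s t x e → s :* t :* (x :+ e) := t :* (s :* x) :+ e :* (s :* t)) refl S S′ (a * S ⁻¹) η ⟩
        S′ * (S * (a * S ⁻¹)) + η * (S * S′)
          ≈⟨ +-congʳ (*-congˡ (⁻¹-cancel a 0<S)) ⟩
        S′ * a + η * (S * S′)
          ≤⟨ +-mono-≤ (*-monoʳ-≤ (<⇒≤ 0<a) S′≤a′+σ)
               (*-monoˡ-≤ 0≤η (*-mono-≤ (0≤* (0≤fromℕ 3) 0≤b) (<⇒≤ 0<S′) S≤3b S′≤3a′)) ⟩
        (a′ + σ) * a + η * (fromℕ 3 * b * (fromℕ 3 * a′))
          ≈⟨ solve 5 (λ a t s e b → (t :+ s) :* a :+ e :* (con (+ 3) :* b :* (con (+ 3) :* t))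
                                := t :* a :+ (a :* s :+ con (+ 9) :* e :* (t :* b))) refl a a′ σ η b ⟩
        a′ * a + (a * σ + fromℕ 9 * η * (a′ * b))
          ≈⟨ +-congˡ (+-congˡ (*-congʳ 9η≈γ)) ⟩
        a′ * a + (a * σ + γ * (a′ * b))
          ≤⟨ +-monoʳ-≤ (a′ * a) gap-b ⟩
        a′ * a + a′ * b
          ≈⟨ solve 3 (λ a t s → t :* a :+ t :* (s :- a) := s :* t) refl a a′ S ⟩
        S * a′
          ≈⟨ *-congˡ (⁻¹-cancel a′ 0<S′) ⟨
        S * (S′ * (a′ * S′ ⁻¹))
          ≈⟨ *-assoc S S′ _ ⟨
        S * S′ * (a′ * S′ ⁻¹) ∎

  module _ {Heavy : Fin n → Set} (heavy? : ∀ i → Dec (Heavy i))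
           {Light : Vec (Fin n) m → Set} (light? : ∀ rest → Dec (Light rest))
           (light⇒¬heavy : ∀ rest q → Light rest → ¬ Heavy (lookup rest q)) where

    -- Linear in the positions, hence with computable mean.
    spikes : Vec (Fin n) (suc m) → Carrier
    spikes xs = ∑[ p < suc m ] (𝟙 (heavy? (lookup xs p)) * 𝟙 (light? (removeAt xs p)))

    -- Light company contains no heavy element, so there is at most one spike, and
    -- the mean of spikes is a lower bound for the probability of having one.
    spikes≤ : ∀ xs {c} → 0# ≤ c →
              (∀ p → Heavy (lookup xs p) → Light (removeAt xs p) → 1# ≤ c) → spikes xs ≤ c
    spikes≤ xs {c} 0≤c spike⇒1≤c =
      cases (Fin.any? (λ p → heavy? (lookup xs p) ×-dec light? (removeAt xs p)))
      where
      term : Fin (suc m) → Carrier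
      term p = 𝟙 (heavy? (lookup xs p)) * 𝟙 (light? (removeAt xs p))

      term≤1 : ∀ p → term p ≤ 1#
      term≤1 p = ≤-trans (*-mono-≤ 0≤1 (𝟙-nonneg (light? (removeAt xs p)))
        (𝟙≤1 (heavy? (lookup xs p))) (𝟙≤1 (light? (removeAt xs p)))) (≤-reflexive (*-identityʳ 1#))

      term≈0 : ∀ p → ¬ (Heavy (lookup xs p) × Light (removeAt xs p)) → term p ≈ 0#
      term≈0 p ¬spike with heavy? (lookup xs p) | light? (removeAt xs p)
      ... | no _  | _      = zeroˡ _
      ... | yes _ | no _   = zeroʳ _
      ... | yes H | yes L  = contradiction (H , L) ¬spike

      cases : Dec (∃ λ p → Heavy (lookup xs p) × Light (removeAt xs p)) → spikes xs ≤ c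
      cases (yes (p , H , L)) = begin
        spikes xs                           ≤⟨ sum-mono (λ p′ → only p′ (p Fin.≟ p′)) ⟩
        ∑[ p′ < suc m ] (1# * point p p′)   ≈⟨ ∑-point (λ _ → 1#) p ⟩
        1#                                  ≤⟨ spike⇒1≤c p H L ⟩
        c                                   ∎
        where
        only : ∀ p′ → Dec (p ≡ p′) → term p′ ≤ 1# * point p p′
        only p′ (yes ≡.refl) = ≤-trans (term≤1 p)
          (≤-reflexive (sym (trans (*-identityˡ _) (point-refl p))))
        only p′ (no p≢p′) = ≤-trans
          (≤-reflexive (term≈0 p′ (λ (H′ , _) → light⇒¬heavy (removeAt xs p) (punchOut p≢p′) L
            (≡.subst Heavy (≡.sym (removeAt-punchOut xs p≢p′)) H′))))
          (0≤* 0≤1 (point-nonneg p p′))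
      cases (no ¬spike) = begin
        spikes xs                  ≈⟨ sum-cong-≋ {suc m} (λ p → term≈0 p (λ s → ¬spike (p , s))) ⟩
        ∑[ p < suc m ] 0#          ≈⟨ trans (∑-const {suc m} 0#) (zeroʳ _) ⟩
        0#                         ≤⟨ 0≤c ⟩
        c                          ∎

-- Random sets of all dyadic sizes

module DyadicLevels (ℝ : Reals) where

  open Testing ℝ
  open IntegerCoefficients ℝ
  open OrderedField ℝ
  open FiniteProbability ℝ
  open Testers ℝ
  open Amplification ℝ
  open DeviationTest ℝ
  open RandomSets ℝ
  open ≤-Reasoning

  private variable
    n K : ℕ

  module _ (μ ν : Distribution n) {ε : Carrier} (far : ε ≤ variationDistance μ ν) where

    private
      -- For s = ± (μ - ν) the sum of |μ - ν| + s is twice that of a positive part,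
      -- and s itself sums to zero.
      half-distance : ∀ {g s : Fin n → Carrier} →
        (∀ i → ∣ prob μ i - prob ν i ∣ᴿ + s i ≤ fromℕ 2 * g i) → sum s ≈ 0# → ε ≤ sum g
      half-distance {g} {s} bound ∑s≈0 = *-cancelˡ-≤ (0<fromℕ 2) (begin
        fromℕ 2 * ε                              ≤⟨ *-monoˡ-≤ (0≤fromℕ 2) far ⟩
        fromℕ 2 * (fromℕ 2 ⁻¹ * D)               ≈⟨ *-congˡ (*-comm _ _) ⟩
        fromℕ 2 * (D * fromℕ 2 ⁻¹)               ≈⟨ ⁻¹-cancel D (0<fromℕ 2) ⟩
        D                                        ≈⟨ trans (+-congˡ ∑s≈0) (+-identityʳ _) ⟨
        D + sum s                                ≈⟨ ∑-distrib-+ {n} (λ i → ∣ prob μ i - prob ν i ∣ᴿ) s ⟨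
        ∑[ i < n ] (∣ prob μ i - prob ν i ∣ᴿ + s i) ≤⟨ sum-mono bound ⟩
        ∑[ i < n ] (fromℕ 2 * g i)               ≈⟨ *-distribˡ-sum (fromℕ 2) g ⟨
        fromℕ 2 * sum g                          ∎)
        where
        D = ∑[ i < n ] ∣ prob μ i - prob ν i ∣ᴿ

      ∑-difference : ∀ (σ τ : Distribution n) → ∑[ i < n ] (prob σ i - prob τ i) ≈ 0#
      ∑-difference σ τ = begin-equality
        ∑[ i < n ] (prob σ i - prob τ i)
          ≈⟨ sum-cong-≋ {n} (λ i → solve 2 (λ x y → x :- y := x :+ (:- con (+ 1)) :* y) refl (prob σ i) (prob τ i)) ⟩
        ∑[ i < n ] (prob σ i + - 1# * prob τ i)
          ≈⟨ ∑-distrib-+ {n} (prob σ) (λ i → - 1# * prob τ i) ⟩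
        sum (prob σ) + ∑[ i < n ] (- 1# * prob τ i)
          ≈⟨ +-cong (total σ) (sym (*-distribˡ-sum (- 1#) (prob τ))) ⟩
        1# + - 1# * sum (prob τ)
          ≈⟨ +-congˡ (trans (*-congˡ (total τ)) (*-identityʳ _)) ⟩
        1# - 1#
          ≈⟨ -‿inverseʳ 1# ⟩
        0# ∎

    distance≤∑excess : ∀ g → (∀ i → 0# ≤ g i) → (∀ i → prob ν i - prob μ i ≤ g i) → ε ≤ sum g
    distance≤∑excess g 0≤g ν-μ≤g = half-distance {g} {λ i → prob ν i - prob μ i} bound (∑-difference ν μ)
      where
      bound : ∀ i → ∣ prob μ i - prob ν i ∣ᴿ + (prob ν i - prob μ i) ≤ fromℕ 2 * g i
      bound i = begin
        ∣ d ∣ᴿ + e                ≤⟨ +-monoˡ-≤ e (⊔-lub d≤ -d≤) ⟩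
        fromℕ 2 * g i - e + e     ≈⟨ solve 2 (λ g e → con (+ 2) :* g :- e :+ e := con (+ 2) :* g) refl (g i) e ⟩
        fromℕ 2 * g i             ∎
        where
        d = prob μ i - prob ν i
        e = prob ν i - prob μ i
        d≤ : d ≤ fromℕ 2 * g i - e
        d≤ = ≤-by (fromℕ 2 * g i) (0≤* (0≤fromℕ 2) (0≤g i))
          (solve 3 (λ m v g → con (+ 2) :* g :- (v :- m) := m :- v :+ con (+ 2) :* g) refl (prob μ i) (prob ν i) (g i))
        -d≤ : - d ≤ fromℕ 2 * g i - e
        -d≤ = ≤-by (fromℕ 2 * (g i - e)) (0≤* (0≤fromℕ 2) (≤⇒0≤- (ν-μ≤g i)))
          (solve 3 (λ m v g → con (+ 2) :* g :- (v :- m) := :- (m :- v) :+ con (+ 2) :* (g :- (v :- m))) refl (prob μ i) (prob ν i) (g i))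

    distance≤∑deficit : ∀ g → (∀ i → 0# ≤ g i) → (∀ i → prob μ i - prob ν i ≤ g i) → ε ≤ sum g
    distance≤∑deficit g 0≤g μ-ν≤g = half-distance {g} {λ i → prob μ i - prob ν i} bound (∑-difference μ ν)
      where
      bound : ∀ i → ∣ prob μ i - prob ν i ∣ᴿ + (prob μ i - prob ν i) ≤ fromℕ 2 * g i
      bound i = begin
        ∣ d ∣ᴿ + d                ≤⟨ +-monoˡ-≤ d (⊔-lub d≤ -d≤) ⟩
        fromℕ 2 * g i - d + d     ≈⟨ solve 2 (λ g e → con (+ 2) :* g :- e :+ e := con (+ 2) :* g) refl (g i) d ⟩
        fromℕ 2 * g i             ∎
        where
        d = prob μ i - prob ν i
        d≤ : d ≤ fromℕ 2 * g i - d
        d≤ = ≤-by (fromℕ 2 * (g i - d)) (0≤* (0≤fromℕ 2) (≤⇒0≤- (μ-ν≤g i)))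
          (solve 2 (λ d g → con (+ 2) :* g :- d := d :+ con (+ 2) :* (g :- d)) refl d (g i))
        -d≤ : - d ≤ fromℕ 2 * g i - d
        -d≤ = ≤-by (fromℕ 2 * g i) (0≤* (0≤fromℕ 2) (0≤g i))
          (solve 2 (λ d g → con (+ 2) :* g :- d := :- d :+ con (+ 2) :* g) refl d (g i))

  2^_ : ℕ → Carrier
  2^ k = fromℕ (2 ℕ.^ k)

  0<2^ : ∀ k → 0# < 2^ k
  0<2^ k = 0<fromℕ (2 ℕ.^ k) {{ℕ.m^n≢0 2 k}}

  -- Level 0 uses pairs, level k + 1 sets formed by 2ᵏ + 1 draws: elements whose
  -- ν-mass is of order 2ᵏ times their μ-mass are best seen among about 2ᵏ others.
  companions : Fin (suc K) → ℕ
  companions zero    = 1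
  companions (suc k) = 2 ℕ.^ toℕ k

  randomSetAt : Distribution n → Fin (suc K) → Random (ConditioningSet n)
  randomSetAt μ level = setOf <$> iid (draw μ) (suc (companions level))

  randomSet : Distribution n → ℕ → Random (ConditioningSet n)
  randomSet μ K = draw (uniform (suc K)) >>= randomSetAt μ

  𝔼-randomSet : ∀ (μ : Distribution n) K c →
    fromℕ (suc K) * 𝔼 (randomSet μ K) c ≈ ∑[ level < suc K ] 𝔼 (randomSetAt μ level) c
  𝔼-randomSet μ K c = begin-equality
    fromℕ (suc K) * 𝔼 (randomSet μ K) c
      ≈⟨ *-congˡ (trans (𝔼->>= (draw (uniform (suc K))) (randomSetAt μ) c) (𝔼-draw (uniform (suc K)) _)) ⟩
    fromℕ (suc K) * (∑[ level < suc K ] (fromℕ (suc K) ⁻¹ * E level))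
      ≈⟨ *-congˡ (*-distribˡ-sum (fromℕ (suc K) ⁻¹) E) ⟨
    fromℕ (suc K) * (fromℕ (suc K) ⁻¹ * sum E)
      ≈⟨ *-congˡ (*-comm _ _) ⟩
    fromℕ (suc K) * (sum E * fromℕ (suc K) ⁻¹)
      ≈⟨ ⁻¹-cancel (sum E) (0<fromℕ (suc K)) ⟩
    sum E ∎
    where
    E : Fin (suc K) → Carrier
    E level = 𝔼 (randomSetAt μ level) c

  -- If j is the number of layers below v then v ≤ 2ʲ c, and these layers
  -- contribute (2ʲ - 1) c.
  layers : ∀ K {v c} → 0# ≤ c → v ≤ 2^ K * c →
           v ≤ c + ∑[ k < K ] (2^ toℕ k * c * 𝟙 (2^ toℕ k * c ≤? v))
  layers zero    {v} {c} 0≤c v≤c = begin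
    v             ≤⟨ v≤c ⟩
    2^ 0 * c      ≈⟨ *-congʳ (+-identityʳ 1#) ⟩
    1# * c        ≈⟨ *-identityˡ c ⟩
    c             ≈⟨ +-identityʳ c ⟨
    c + 0#        ∎
  layers (suc K) {v} {c} 0≤c v≤2^[1+K]c = cases (c ≤? v)
    where
    2c = fromℕ 2 * c
    doubled : ∀ k → 2^ suc k * c ≈ 2^ k * 2c
    doubled k = trans (*-congʳ (fromℕ-* 2 (2 ℕ.^ k)))
      (solve 3 (λ t s c → t :* s :* c := s :* (t :* c)) refl (fromℕ 2) (2^ k) c)

    once : 2^ 0 * c ≈ c
    once = trans (*-congʳ (+-identityʳ 1#)) (*-identityˡ c)

    tail tail′ : Carrier
    tail  = ∑[ k < K ] (2^ suc (toℕ k) * c * 𝟙 (2^ suc (toℕ k) * c ≤? v))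
    tail′ = ∑[ k < K ] (2^ toℕ k * 2c * 𝟙 (2^ toℕ k * 2c ≤? v))
    first = 2^ 0 * c * 𝟙 (2^ 0 * c ≤? v)

    0≤2c : 0# ≤ 2c
    0≤2c = 0≤* (0≤fromℕ 2) 0≤c

    tail′≤tail : tail′ ≤ tail
    tail′≤tail = sum-mono {K} (λ k → *-mono-≤ (0≤* (<⇒≤ (0<2^ (suc (toℕ k)))) 0≤c) (𝟙-nonneg (2^ toℕ k * 2c ≤? v))
      (≤-reflexive (sym (doubled (toℕ k))))
      (𝟙-mono (2^ toℕ k * 2c ≤? v) (2^ suc (toℕ k) * c ≤? v) (≤-trans (≤-reflexive (doubled (toℕ k))))))

    0≤tail : 0# ≤ tail
    0≤tail = sum-nonneg {K} (λ k → 0≤* (0≤* (<⇒≤ (0<2^ (suc (toℕ k)))) 0≤c) (𝟙-nonneg (2^ suc (toℕ k) * c ≤? v)))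

    cases : Dec (c ≤ v) → v ≤ c + (first + tail)
    cases (yes c≤v) = begin
      v                   ≤⟨ layers K 0≤2c (≤-trans v≤2^[1+K]c (≤-reflexive (doubled K))) ⟩
      2c + tail′          ≤⟨ +-monoʳ-≤ 2c tail′≤tail ⟩
      2c + tail           ≈⟨ solve 2 (λ c t → con (+ 2) :* c :+ t := c :+ (c :+ t)) refl c tail ⟩
      c + (c + tail)      ≈⟨ +-congˡ (+-congʳ (trans (*-cong once (𝟙-true (2^ 0 * c ≤? v) (≤-trans (≤-reflexive once) c≤v))) (*-identityʳ c))) ⟨
      c + (first + tail)  ∎
    cases (no c≰v) = begin
      v                   ≤⟨ <⇒≤ (≰⇒> c≰v) ⟩
      c                   ≤⟨ ≤-by (first + tail) (0≤+ (0≤* (0≤* (<⇒≤ (0<2^ 0)) 0≤c) (𝟙-nonneg (2^ 0 * c ≤? v))) 0≤tail) refl ⟩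
      c + (first + tail)  ∎

  module _ (μ ν : Distribution n) {γ M : Carrier}
           (0<γ : 0# < γ) (2γ≤1 : fromℕ 2 * γ ≤ 1#)
           (0<M : 0# < M) (≤M : ∀ i → prob μ i ≤ M) (M≤2 : ∀ i → M ≤ fromℕ 2 * prob μ i) where

    private
      0<prob : ∀ i → 0# < prob μ i
      0<prob i = ≰⇒> λ μi≤0 → <-irrefl refl (begin-strict
        0#                <⟨ 0<M ⟩
        M                 ≤⟨ M≤2 i ⟩
        fromℕ 2 * prob μ i ≤⟨ *-monoˡ-≤ (0≤fromℕ 2) μi≤0 ⟩
        fromℕ 2 * 0#      ≈⟨ zeroʳ _ ⟩
        0#                ∎)

      0≤γ = <⇒≤ 0<γ

      γ≤1 : γ ≤ 1#
      γ≤1 = ≤-trans (≤-by γ 0≤γ (solve 1 (λ g → con (+ 2) :* g := g :+ g) refl γ)) 2γ≤1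

    -- The factor 16 leaves room for companions of total ν-mass 2 · 2ᵏ M, twice a
    -- bound for the mean.
    Heavy : Fin (suc K) → Fin n → Set
    Heavy zero    i = prob μ i ≤ prob ν i
    Heavy (suc k) i = 2^ toℕ k * (fromℕ 16 * prob μ i) ≤ prob ν i

    heavy? : ∀ (level : Fin (suc K)) i → Dec (Heavy level i)
    heavy? zero    i = _ ≤? _
    heavy? (suc k) i = _ ≤? _

    Light : (level : Fin (suc K)) → Vec (Fin n) (companions level) → Set
    Light zero    rest = sumOver (prob ν) rest + γ * prob μ (Vec.head rest) ≤ prob μ (Vec.head rest)
    Light (suc k) rest = sumOver (prob ν) rest ≤ fromℕ 2 * (2^ toℕ k * M)

    light? : ∀ (level : Fin (suc K)) rest → Dec (Light level rest)
    light? zero    rest = _ ≤? _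
    light? (suc k) rest = _ ≤? _

    private
      0≤sumOver : ∀ {m} (xs : Vec (Fin n) m) → 0# ≤ sumOver (prob ν) xs
      0≤sumOver []       = ≤-refl
      0≤sumOver (x ∷ xs) = 0≤+ (nonneg ν x) (0≤sumOver xs)

      prob≤sumOver : ∀ {m} (xs : Vec (Fin n) m) q → prob ν (lookup xs q) ≤ sumOver (prob ν) xs
      prob≤sumOver (x ∷ xs) zero    = ≤-by _ (0≤sumOver xs) refl
      prob≤sumOver (x ∷ xs) (suc q) = ≤-trans (prob≤sumOver xs q) (≤-by _ (nonneg ν x) (+-comm _ _))

      8sM≤ : ∀ (k : Fin K) {i} → Heavy (suc k) i → fromℕ 8 * (2^ toℕ k * M) ≤ prob ν i
      8sM≤ k {i} H = begin
        fromℕ 8 * (s * M)                   ≤⟨ *-monoˡ-≤ (0≤fromℕ 8) (*-monoˡ-≤ (<⇒≤ (0<2^ (toℕ k))) (M≤2 i)) ⟩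
        fromℕ 8 * (s * (fromℕ 2 * prob μ i)) ≈⟨ solve 2 (λ s a → con (+ 8) :* (s :* (con (+ 2) :* a)) := s :* (con (+ 16) :* a)) refl s (prob μ i) ⟩
        s * (fromℕ 16 * prob μ i)           ≤⟨ H ⟩
        prob ν i                            ∎
        where s = 2^ toℕ k

      0<2^M : ∀ k → 0# < 2^ k * M
      0<2^M k = *-pos (0<2^ k) 0<M

    light⇒¬heavy : ∀ (level : Fin (suc K)) rest q → Light level rest → ¬ Heavy level (lookup rest q)
    light⇒¬heavy zero (l ∷ []) zero L H = <-irrefl refl (begin-strict
      prob ν l                        ≈⟨ +-identityˡ _ ⟨
      0# + prob ν l                   <⟨ +-monoˡ-< (prob ν l) (*-pos 0<γ (0<prob l)) ⟩
      γ * prob μ l + prob ν l         ≈⟨ solve 2 (λ x y → x :+ y := y :+ con (+ 0) :+ x) refl (γ * prob μ l) (prob ν l) ⟩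
      prob ν l + 0# + γ * prob μ l    ≤⟨ L ⟩
      prob μ l                        ≤⟨ H ⟩
      prob ν l                        ∎)
    light⇒¬heavy (suc k) rest q L H = <-irrefl refl (begin-strict
      fromℕ 2 * sM                    ≈⟨ +-identityˡ _ ⟨
      0# + fromℕ 2 * sM               <⟨ +-monoˡ-< _ (*-pos (0<fromℕ 6) (0<2^M (toℕ k))) ⟩
      fromℕ 6 * sM + fromℕ 2 * sM     ≈⟨ solve 1 (λ x → con (+ 6) :* x :+ con (+ 2) :* x := con (+ 8) :* x) refl sM ⟩
      fromℕ 8 * sM                    ≤⟨ 8sM≤ k H ⟩
      prob ν (lookup rest q)          ≤⟨ prob≤sumOver rest q ⟩
      sumOver (prob ν) rest           ≤⟨ L ⟩
      fromℕ 2 * sM                    ∎)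
      where sM = 2^ toℕ k * M

    private
      someCompanion : ∀ (level : Fin (suc K)) → Fin (companions level)
      someCompanion zero    = zero
      someCompanion (suc k) = fromℕ< (ℕ.>-nonZero⁻¹ (2 ℕ.^ toℕ k) {{ℕ.m^n≢0 2 (toℕ k)}})

      0<heavy : ∀ (level : Fin (suc K)) {i} → Heavy level i → 0# < prob ν i
      0<heavy zero {i} H = begin-strict
        0#        <⟨ 0<prob i ⟩
        prob μ i  ≤⟨ H ⟩
        prob ν i  ∎
      0<heavy (suc k) {i} H = begin-strict
        0#                       <⟨ *-pos (0<fromℕ 8) (0<2^M (toℕ k)) ⟩
        fromℕ 8 * (2^ toℕ k * M) ≤⟨ 8sM≤ k H ⟩
        prob ν i                 ∎

      companions-light : ∀ (level : Fin (suc K)) {h} rest → Heavy level h → Light level rest →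
        let σ  = sumOver (prob ν) rest
            l  = lookup rest (someCompanion level) in
        σ ≤ fromℕ 2 * prob ν h ×
        prob μ h * σ + γ * (prob ν h * prob μ l) ≤ prob ν h * prob μ l
      companions-light zero {h} rest@(l ∷ []) H L = σ≤2a′ , gap
        where
        σ  = sumOver (prob ν) rest
        a  = prob μ h
        a′ = prob ν h
        ml = prob μ l

        σ≤2a′ : σ ≤ fromℕ 2 * a′
        σ≤2a′ = begin
          σ            ≤⟨ ≤-by (γ * ml) (0≤* 0≤γ (nonneg μ l)) refl ⟩
          σ + γ * ml   ≤⟨ L ⟩
          ml           ≤⟨ ≤M l ⟩
          M            ≤⟨ M≤2 h ⟩
          fromℕ 2 * a  ≤⟨ *-monoˡ-≤ (0≤fromℕ 2) H ⟩
          fromℕ 2 * a′ ∎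

        gap : a * σ + γ * (a′ * ml) ≤ a′ * ml
        gap = begin
          a * σ + γ * (a′ * ml)   ≤⟨ +-monoˡ-≤ _ (*-monoʳ-≤ (0≤+ (nonneg ν l) ≤-refl) H) ⟩
          a′ * σ + γ * (a′ * ml)  ≈⟨ solve 4 (λ a s g m → a :* s :+ g :* (a :* m) := a :* (s :+ g :* m)) refl a′ σ γ ml ⟩
          a′ * (σ + γ * ml)       ≤⟨ *-monoˡ-≤ (nonneg ν h) L ⟩
          a′ * ml                 ∎
      companions-light (suc k) {h} rest H L = σ≤2a′ , gap
        where
        σ  = sumOver (prob ν) rest
        l  = lookup rest (someCompanion (suc k))
        a  = prob μ h
        a′ = prob ν h
        ml = prob μ l
        sM = 2^ toℕ k * M

        0≤a′ml : 0# ≤ a′ * ml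
        0≤a′ml = 0≤* (nonneg ν h) (nonneg μ l)

        4σ≤a′ : fromℕ 4 * σ ≤ a′
        4σ≤a′ = begin
          fromℕ 4 * σ              ≤⟨ *-monoˡ-≤ (0≤fromℕ 4) L ⟩
          fromℕ 4 * (fromℕ 2 * sM) ≈⟨ solve 1 (λ x → con (+ 4) :* (con (+ 2) :* x) := con (+ 8) :* x) refl sM ⟩
          fromℕ 8 * sM             ≤⟨ 8sM≤ k H ⟩
          a′                       ∎

        0≤σ : 0# ≤ σ
        0≤σ = ≤-trans (nonneg ν l) (prob≤sumOver rest (someCompanion (suc k)))

        σ≤2a′ : σ ≤ fromℕ 2 * a′
        σ≤2a′ = begin
          σ             ≤⟨ ≤-by (fromℕ 7 * σ) (0≤* (0≤fromℕ 7) 0≤σ) (solve 1 (λ x → con (+ 2) :* (con (+ 4) :* x) := x :+ con (+ 7) :* x) refl σ) ⟩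
          fromℕ 2 * (fromℕ 4 * σ) ≤⟨ *-monoˡ-≤ (0≤fromℕ 2) 4σ≤a′ ⟩
          fromℕ 2 * a′  ∎

        gap : a * σ + γ * (a′ * ml) ≤ a′ * ml
        gap = *-cancelˡ-≤ (0<fromℕ 2) (begin
          fromℕ 2 * (a * σ + γ * (a′ * ml))
            ≤⟨ *-monoˡ-≤ (0≤fromℕ 2) (+-monoˡ-≤ _ (*-monoʳ-≤ 0≤σ (≤-trans (≤M h) (M≤2 l)))) ⟩
          fromℕ 2 * (fromℕ 2 * ml * σ + γ * (a′ * ml))
            ≈⟨ solve 4 (λ m s g a → con (+ 2) :* (con (+ 2) :* m :* s :+ g :* (a :* m))
                               := con (+ 4) :* s :* m :+ con (+ 2) :* g :* (a :* m)) refl ml σ γ a′ ⟩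
          fromℕ 4 * σ * ml + fromℕ 2 * γ * (a′ * ml)
            ≤⟨ +-mono-≤ (*-monoʳ-≤ (nonneg μ l) 4σ≤a′) (*-monoʳ-≤ 0≤a′ml 2γ≤1) ⟩
          a′ * ml + 1# * (a′ * ml)
            ≈⟨ solve 1 (λ x → x :+ con (+ 1) :* x := con (+ 2) :* x) refl (a′ * ml) ⟩
          fromℕ 2 * (a′ * ml) ∎)

    -- Since μ(l) and μ(h) agree up to a factor 2, one companion l already gives A
    -- without h enough μ-mass.
    spike⇒excess : ∀ {η} → fromℕ 9 * η ≈ γ →
      ∀ (level : Fin (suc K)) (xs : Vec (Fin n) (suc (companions level))) p →
      Heavy level (lookup xs p) → Light level (removeAt xs p) →
      conditional μ (setOf xs) (lookup xs p) + η ≤ conditional ν (setOf xs) (lookup xs p)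
    spike⇒excess 9η≈γ level xs p H L =
      excess-at-heavy μ ν 9η≈γ 0≤γ (setOf xs) (lookup∈support xs p) l∈xs h≢l
        (0<prob _) (0<heavy level H) (≤-trans (≤M _) (M≤2 l))
        (≤-trans (mass-support≤ ν xs) (≤-reflexive (sumOver-removeAt (prob ν) xs p)))
        (proj₁ (companions-light level rest H L)) (proj₂ (companions-light level rest H L)) γ≤1
      where
      rest = removeAt xs p
      q = someCompanion level
      l = lookup rest q

      l∈xs : l ∈ support xs
      l∈xs = ≡.subst (_∈ support xs) (≡.sym (lookup-removeAt xs p q)) (lookup∈support xs _)

      h≢l : lookup xs p ≢ l
      h≢l h≡l = light⇒¬heavy level rest q L (≡.subst (Heavy level) h≡l H)

    PrHeavy : Fin (suc K) → Carrier
    PrHeavy level = 𝔼 (draw μ) (λ i → 𝟙 (heavy? level i))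

    PrLight : Fin (suc K) → Carrier
    PrLight level = 𝔼 (iid (draw μ) (companions level)) (λ rest → 𝟙 (light? level rest))

    -- Markov's inequality: one draw from μ has ν-mass at most M on average.
    ½≤PrLight : ∀ (k : Fin K) → 1# ≤ fromℕ 2 * PrLight (suc k)
    ½≤PrLight k = *-cancelˡ-≤ (0<2^M (toℕ k)) (begin
      sM * 1#                         ≈⟨ solve 1 (λ x → x :* con (+ 1) := con (+ 2) :* x :- x) refl sM ⟩
      fromℕ 2 * sM - sM               ≤⟨ +-monoˡ-≤ (- sM) (begin
          fromℕ 2 * sM                                            ≈⟨ 𝔼-const Y _ ⟨
          𝔼 Y (λ _ → fromℕ 2 * sM)                                ≤⟨ 𝔼-mono Y (λ rest → markov rest (light? (suc k) rest)) ⟩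
          𝔼 Y (λ rest → fromℕ 2 * sM * L rest + sumOver (prob ν) rest) ≈⟨ 𝔼-+ Y _ _ ⟩
          𝔼 Y (λ rest → fromℕ 2 * sM * L rest) + 𝔼 Y (sumOver (prob ν)) ≈⟨ +-cong (𝔼-* Y _ L) (𝔼-sumOver (draw μ) (prob ν) m) ⟩
          fromℕ 2 * sM * PrLight (suc k) + 2^ toℕ k * 𝔼 (draw μ) (prob ν) ≤⟨ +-monoʳ-≤ _ (*-monoˡ-≤ (<⇒≤ (0<2^ (toℕ k))) mean≤M) ⟩
          fromℕ 2 * sM * PrLight (suc k) + sM                     ∎) ⟩
      fromℕ 2 * sM * PrLight (suc k) + sM - sM ≈⟨ solve 2 (λ x p → con (+ 2) :* x :* p :+ x :- x := x :* (con (+ 2) :* p)) refl sM _ ⟩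
      sM * (fromℕ 2 * PrLight (suc k)) ∎)
      where
      m = 2 ℕ.^ toℕ k
      sM = 2^ toℕ k * M
      Y = iid (draw μ) m
      L : Vec (Fin n) m → Carrier
      L rest = 𝟙 (light? (suc k) rest)

      markov : ∀ rest (d : Dec (Light (suc k) rest)) → fromℕ 2 * sM ≤ fromℕ 2 * sM * 𝟙 d + sumOver (prob ν) rest
      markov rest (yes _) = ≤-by _ (0≤sumOver rest) (+-congʳ (*-identityʳ _))
      markov rest (no ¬L) = ≤-trans (<⇒≤ (≰⇒> ¬L))
        (≤-reflexive (sym (trans (+-congʳ (zeroʳ _)) (+-identityˡ _))))

      mean≤M : 𝔼 (draw μ) (prob ν) ≤ M
      mean≤M = begin
        𝔼 (draw μ) (prob ν)                 ≈⟨ 𝔼-draw μ (prob ν) ⟩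
        ∑[ i < n ] (prob μ i * prob ν i)    ≤⟨ sum-mono (λ i → *-monoʳ-≤ (nonneg ν i) (≤M i)) ⟩
        ∑[ i < n ] (M * prob ν i)           ≈⟨ *-distribˡ-sum M (prob ν) ⟨
        M * sum (prob ν)                    ≈⟨ trans (*-congˡ (total ν)) (*-identityʳ M) ⟩
        M                                   ∎

    module _ {ε : Carrier} (2γ≈ε : fromℕ 2 * γ ≈ ε) (far : ε ≤ variationDistance μ ν) where

      -- The light elements i are those with ν(i) ≤ (1 - γ) μ(i); the others
      -- contribute at most γ to the distance, which is at least 2 γ.
      γ≤PrLight : γ ≤ PrLight {K} zero
      γ≤PrLight {K} = begin
        γ           ≈⟨ solve 1 (λ g → g := con (+ 2) :* g :- g) refl γ ⟩
        fromℕ 2 * γ - γ ≤⟨ +-monoˡ-≤ (- γ) (begin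
          fromℕ 2 * γ                                  ≈⟨ 2γ≈ε ⟩
          ε                                            ≤⟨ distance≤∑deficit μ ν far g 0≤g deficit≤g ⟩
          sum g                                        ≈⟨ 𝔼-draw μ (λ i → light i + γ) ⟨
          𝔼 (draw μ) (λ i → light i + γ)               ≈⟨ 𝔼-+ (draw μ) light (λ _ → γ) ⟩
          𝔼 (draw μ) light + 𝔼 (draw μ) (λ _ → γ)      ≈⟨ +-cong (𝔼-cong (draw μ) (λ i → sym (𝔼-pure [] (λ is → 𝟙 (light? {K} zero (i ∷ is)))))) (𝔼-const (draw μ) γ) ⟩
          𝔼 (draw μ) (λ i → 𝔼 (iid (draw μ) 0) (λ is → 𝟙 (light? {K} zero (i ∷ is)))) + γ
                                                       ≈⟨ +-congʳ (𝔼-iid (draw μ) 0 (λ rest → 𝟙 (light? {K} zero rest))) ⟨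
          PrLight {K} zero + γ                         ∎) ⟩
        PrLight {K} zero + γ - γ ≈⟨ solve 2 (λ p g → p :+ g :- g := p) refl _ γ ⟩
        PrLight {K} zero ∎
        where
        light : Fin n → Carrier
        light i = 𝟙 (light? {K} zero (i ∷ []))

        g : Fin n → Carrier
        g i = prob μ i * (light i + γ)

        0≤g : ∀ i → 0# ≤ g i
        0≤g i = 0≤* (nonneg μ i) (0≤+ (𝟙-nonneg (light? {K} zero (i ∷ []))) 0≤γ)

        deficit≤g : ∀ i → prob μ i - prob ν i ≤ g i
        deficit≤g i = cases (light? {K} zero (i ∷ []))
          where
          a = prob μ i
          v = prob ν i
          cases : (d : Dec (Light {K} zero (i ∷ []))) → a - v ≤ a * (𝟙 d + γ)
          cases (yes _) = ≤-by (v + γ * a) (0≤+ (nonneg ν i) (0≤* 0≤γ (nonneg μ i)))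
            (solve 3 (λ a v g → a :* (con (+ 1) :+ g) := a :- v :+ (v :+ g :* a)) refl a v γ)
          cases (no ¬L) = ≤-by (v + 0# + γ * a - a) (≤⇒0≤- (<⇒≤ (≰⇒> ¬L)))
            (solve 3 (λ a v g → a :* (con (+ 0) :+ g) := a :- v :+ (v :+ con (+ 0) :+ g :* a :- a)) refl a v γ)

      weight : Fin (suc K) → Carrier
      weight zero    = 1#
      weight (suc k) = 2^ toℕ k

      spikesAt : (level : Fin (suc K)) → Vec (Fin n) (suc (companions level)) → Carrier
      spikesAt level = spikes (heavy? level) (light? level) (light⇒¬heavy level)

      -- At level k + 1 the number 2ᵏ + 1 of positions makes up for the rarity of
      -- heavy elements; at level 0 the factor ε pays for a light companion.
      ∑-heavy≤𝔼-spikes : ∀ (level : Fin (suc K)) →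
        ε * (weight level * PrHeavy level) ≤
        fromℕ 2 * 𝔼 (iid (draw μ) (suc (companions level))) (spikesAt level)
      ∑-heavy≤𝔼-spikes {K} zero = begin
        ε * (1# * H)                              ≈⟨ *-congʳ 2γ≈ε ⟨
        fromℕ 2 * γ * (1# * H)                    ≤⟨ *-monoʳ-≤ (0≤* 0≤1 0≤H) (*-monoˡ-≤ (0≤fromℕ 2) (γ≤PrLight {K})) ⟩
        fromℕ 2 * L * (1# * H)                    ≤⟨ ≤-by (fromℕ 2 * (H * L)) (0≤* (0≤fromℕ 2) (0≤* 0≤H 0≤L))
                                                       (solve 2 (λ h l → con (+ 2) :* (con (+ 2) :* (h :* l)) := con (+ 2) :* l :* (con (+ 1) :* h) :+ con (+ 2) :* (h :* l)) refl H L) ⟩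
        fromℕ 2 * (fromℕ 2 * (H * L))             ≈⟨ *-congˡ (𝔼-∑-removeAt (draw μ) (λ i → 𝟙 (heavy? {K} zero i)) (λ rest → 𝟙 (light? {K} zero rest))) ⟨
        fromℕ 2 * 𝔼 (iid (draw μ) 2) (spikesAt {K} zero) ∎
        where
        H = PrHeavy {K} zero
        L = PrLight {K} zero
        0≤H = 𝔼-nonneg (draw μ) (λ i → 𝟙-nonneg (heavy? {K} zero i))
        0≤L = 𝔼-nonneg (iid (draw μ) 1) (λ rest → 𝟙-nonneg (light? {K} zero rest))
      ∑-heavy≤𝔼-spikes {K} (suc k) = begin
        ε * (s * H)                               ≤⟨ *-monoʳ-≤ (0≤* 0≤s 0≤H) (≤-trans (≤-reflexive (sym 2γ≈ε)) 2γ≤1) ⟩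
        1# * (s * H)                              ≤⟨ *-monoʳ-≤ (0≤* 0≤s 0≤H) (½≤PrLight k) ⟩
        fromℕ 2 * L * (s * H)                     ≤⟨ ≤-by (fromℕ 2 * (H * L)) (0≤* (0≤fromℕ 2) (0≤* 0≤H 0≤L))
                                                       (solve 3 (λ h l s → con (+ 2) :* ((con (+ 1) :+ s) :* (h :* l)) := con (+ 2) :* l :* (s :* h) :+ con (+ 2) :* (h :* l)) refl H L s) ⟩
        fromℕ 2 * (fromℕ (suc (2 ℕ.^ toℕ k)) * (H * L)) ≈⟨ *-congˡ (𝔼-∑-removeAt (draw μ) (λ i → 𝟙 (heavy? (suc k) i)) (λ rest → 𝟙 (light? (suc k) rest))) ⟨
        fromℕ 2 * 𝔼 (iid (draw μ) (suc (2 ℕ.^ toℕ k))) (spikesAt (suc k)) ∎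
        where
        s = 2^ toℕ k
        H = PrHeavy (suc k)
        L = PrLight (suc k)
        0≤s = <⇒≤ (0<2^ (toℕ k))
        0≤H = 𝔼-nonneg (draw μ) (λ i → 𝟙-nonneg (heavy? (suc k) i))
        0≤L = 𝔼-nonneg (iid (draw μ) (2 ℕ.^ toℕ k)) (λ rest → 𝟙-nonneg (light? (suc k) rest))

      -- ν(i) ≤ 1 bounds the number of layers of ν(i) / μ(i) by K, so the dyadic
      -- levels account for the whole positive part of ν - μ.
      distance≤∑-heavy : ∀ K → (∀ i → 1# ≤ 2^ K * (fromℕ 16 * prob μ i)) →
        ε ≤ fromℕ 16 * (∑[ level < suc K ] (weight level * PrHeavy level))
      distance≤∑-heavy K large = begin
        ε
          ≤⟨ distance≤∑excess μ ν far g 0≤g excess≤g ⟩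
        ∑[ i < n ] (fromℕ 16 * (prob μ i * ∑levels i))
          ≈⟨ *-distribˡ-sum {n} (fromℕ 16) (λ i → prob μ i * ∑levels i) ⟨
        fromℕ 16 * (∑[ i < n ] (prob μ i * ∑levels i))
          ≈⟨ *-congˡ (𝔼-draw μ ∑levels) ⟨
        fromℕ 16 * 𝔼 (draw μ) ∑levels
          ≈⟨ *-congˡ (𝔼-sum (draw μ) layer) ⟩
        fromℕ 16 * (∑[ level < suc K ] 𝔼 (draw μ) (layer level))
          ≈⟨ *-congˡ (sum-cong-≋ {suc K} (λ level → 𝔼-* (draw μ) (weight level) (λ i → 𝟙 (heavy? level i)))) ⟩
        fromℕ 16 * (∑[ level < suc K ] (weight level * PrHeavy level)) ∎
        where
        layer : Fin (suc K) → Fin n → Carrier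
        layer level i = weight level * 𝟙 (heavy? level i)

        ∑levels : Fin n → Carrier
        ∑levels i = ∑[ level < suc K ] layer level i

        0≤weight : ∀ (level : Fin (suc K)) → 0# ≤ weight level
        0≤weight zero    = 0≤1
        0≤weight (suc k) = <⇒≤ (0<2^ (toℕ k))

        0≤layer : ∀ level i → 0# ≤ layer level i
        0≤layer level i = 0≤* (0≤weight level) (𝟙-nonneg (heavy? level i))

        0≤∑levels : ∀ i → 0# ≤ ∑levels i
        0≤∑levels i = sum-nonneg {suc K} (λ level → 0≤layer level i)

        g : Fin n → Carrier
        g i = fromℕ 16 * (prob μ i * ∑levels i)

        0≤g : ∀ i → 0# ≤ g i
        0≤g i = 0≤* (0≤fromℕ 16) (0≤* (nonneg μ i) (0≤∑levels i))

        excess≤g : ∀ i → prob ν i - prob μ i ≤ g i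
        excess≤g i = cases (prob μ i ≤? prob ν i)
          where
          a = prob μ i
          v = prob ν i
          c = fromℕ 16 * a

          ∑upper : Carrier
          ∑upper = ∑[ k < K ] layer (suc k) i

          v≤1 : v ≤ 1#
          v≤1 = ≤-trans (term≤sum (nonneg ν) i) (≤-reflexive (total ν))

          0≤c : 0# ≤ c
          0≤c = 0≤* (0≤fromℕ 16) (nonneg μ i)

          cases : Dec (a ≤ v) → v - a ≤ g i
          cases (no a≰v) = ≤-trans (≤-by (a - v) (≤⇒0≤- (<⇒≤ (≰⇒> a≰v)))
            (solve 2 (λ a v → con (+ 0) := v :- a :+ (a :- v)) refl a v)) (0≤g i)
          cases (yes a≤v) = begin
            v - a
              ≤⟨ ≤-by a (nonneg μ i) (solve 2 (λ a v → v := v :- a :+ a) refl a v) ⟩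
            v
              ≤⟨ layers K 0≤c (≤-trans v≤1 (large i)) ⟩
            c + ∑[ k < K ] (2^ toℕ k * c * 𝟙 (2^ toℕ k * c ≤? v))
              ≈⟨ +-congˡ (trans (sum-cong-≋ {K} (λ k →
                   solve 3 (λ s c h → s :* c :* h := c :* (s :* h)) refl (2^ toℕ k) c (𝟙 (2^ toℕ k * c ≤? v))))
                   (sym (*-distribˡ-sum {K} c (λ k → layer (suc k) i)))) ⟩
            c + c * ∑upper
              ≈⟨ solve 2 (λ c u → c :+ c :* u := c :* (con (+ 1) :+ u)) refl c ∑upper ⟩
            c * (1# + ∑upper)
              ≈⟨ *-congˡ (+-congʳ (trans (*-identityˡ _) (𝟙-true (heavy? {K} zero i) a≤v))) ⟨
            c * ∑levels i
              ≈⟨ *-assoc (fromℕ 16) a (∑levels i) ⟩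
            g i ∎

      -- For c = 1 on the sets that exhibit an excess, and 0 elsewhere, this bounds
      -- the probability of such a set from below by ε² / (32 (K + 1)).
      randomSet-detects : ∀ {η} → fromℕ 9 * η ≈ γ →
        ∀ K → (∀ i → 1# ≤ 2^ K * (fromℕ 16 * prob μ i)) →
        (c : ConditioningSet n → Carrier) → (∀ A → 0# ≤ c A) →
        (∀ A h → conditional μ A h + η ≤ conditional ν A h → 1# ≤ c A) → 0# ≤ ε →
        ε * ε ≤ fromℕ 32 * (fromℕ (suc K) * 𝔼 (randomSet μ K) c)
      randomSet-detects 9η≈γ K large c 0≤c excess⇒1≤c 0≤ε = begin
        ε * ε
          ≤⟨ *-monoˡ-≤ 0≤ε (distance≤∑-heavy K large) ⟩
        ε * (fromℕ 16 * (∑[ level < suc K ] (weight level * PrHeavy level)))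
          ≈⟨ solve 2 (λ e s → e :* (con (+ 16) :* s) := con (+ 16) :* (e :* s)) refl ε _ ⟩
        fromℕ 16 * (ε * (∑[ level < suc K ] (weight level * PrHeavy level)))
          ≈⟨ *-congˡ (*-distribˡ-sum {suc K} ε (λ level → weight level * PrHeavy level)) ⟩
        fromℕ 16 * (∑[ level < suc K ] (ε * (weight level * PrHeavy level)))
          ≤⟨ *-monoˡ-≤ (0≤fromℕ 16) (sum-mono {suc K} (λ level → ≤-trans (∑-heavy≤𝔼-spikes level)
               (*-monoˡ-≤ (0≤fromℕ 2) (𝔼-spikes≤𝔼-c level)))) ⟩
        fromℕ 16 * (∑[ level < suc K ] (fromℕ 2 * 𝔼 (randomSetAt μ level) c))
          ≈⟨ *-congˡ (*-distribˡ-sum {suc K} (fromℕ 2) (λ level → 𝔼 (randomSetAt μ level) c)) ⟨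
        fromℕ 16 * (fromℕ 2 * (∑[ level < suc K ] 𝔼 (randomSetAt μ level) c))
          ≈⟨ solve 1 (λ s → con (+ 16) :* (con (+ 2) :* s) := con (+ 32) :* s) refl _ ⟩
        fromℕ 32 * (∑[ level < suc K ] 𝔼 (randomSetAt μ level) c)
          ≈⟨ *-congˡ (𝔼-randomSet μ K c) ⟨
        fromℕ 32 * (fromℕ (suc K) * 𝔼 (randomSet μ K) c) ∎
        where
        𝔼-spikes≤𝔼-c : ∀ (level : Fin (suc K)) →
          𝔼 (iid (draw μ) (suc (companions level))) (spikesAt level) ≤ 𝔼 (randomSetAt μ level) c
        𝔼-spikes≤𝔼-c level = ≤-trans
          (𝔼-mono Y (λ xs → spikes≤ (heavy? level) (light? level) (light⇒¬heavy level) xs (0≤c (setOf xs))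
            (λ p H L → excess⇒1≤c (setOf xs) (lookup xs p) (spike⇒excess 9η≈γ level xs p H L))))
          (≤-reflexive (sym (𝔼-<$> setOf Y c)))
          where Y = iid (draw μ) (suc (companions level))

-- The tester and its parameters

module IdentityTester (ℝ : Reals) where

  open Testing ℝ
  open IntegerCoefficients ℝ
  open OrderedField ℝ
  open FiniteProbability ℝ
  open Testers ℝ
  open Amplification ℝ
  open DeviationTest ℝ
  open RandomSets ℝ
  open DyadicLevels ℝ
  open ≤-Reasoning

  private variable
    n : ℕ

  term≤maximum : ∀ (f : Fin n → Carrier) i → f i ≤ Vector.foldr _⊔_ 0# f
  term≤maximum f zero    = x≤x⊔y (f zero) _
  term≤maximum f (suc i) = ≤-trans (term≤maximum (f ∘ suc) i) (x≤y⊔x (f zero) _)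

  module _ (n : ℕ) .{{_ : NonZero n}} (μ : Distribution n) {ε : Carrier} (0<ε : 0# < ε) (ε<1 : ε < 1#)
           (close : ‖ μ - uniform n ‖∞ < ε * (fromℕ 8 * fromℕ n) ⁻¹) where

    private
      0<8n : 0# < fromℕ 8 * fromℕ n
      0<8n = *-pos (0<fromℕ 8) (0<fromℕ n)

      w = (fromℕ 8 * fromℕ n) ⁻¹

      8nw≈1 : fromℕ 8 * fromℕ n * w ≈ 1#
      8nw≈1 = *-inverseʳ (pos⇒≉0 0<8n)

      0<w : 0# < w
      0<w = ⁻¹-pos 0<8n

      1/n≈8w : fromℕ n ⁻¹ ≈ fromℕ 8 * w
      1/n≈8w = begin-equality
        fromℕ n ⁻¹                            ≈⟨ *-identityˡ _ ⟨
        1# * fromℕ n ⁻¹                       ≈⟨ *-congʳ 8nw≈1 ⟨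
        fromℕ 8 * fromℕ n * w * fromℕ n ⁻¹    ≈⟨ solve 4 (λ e n w v → e :* n :* w :* v := n :* (e :* w :* v)) refl (fromℕ 8) (fromℕ n) w (fromℕ n ⁻¹) ⟩
        fromℕ n * (fromℕ 8 * w * fromℕ n ⁻¹)  ≈⟨ ⁻¹-cancel (fromℕ 8 * w) (0<fromℕ n) ⟩
        fromℕ 8 * w                           ∎

      distance≤w : ∀ i → ∣ prob μ i - fromℕ n ⁻¹ ∣ᴿ ≤ w
      distance≤w i = begin
        ∣ prob μ i - fromℕ n ⁻¹ ∣ᴿ  ≤⟨ term≤maximum (λ i → ∣ prob μ i - fromℕ n ⁻¹ ∣ᴿ) i ⟩
        ‖ μ - uniform n ‖∞          <⟨ close ⟩
        ε * w                       ≤⟨ *-monoʳ-≤ (<⇒≤ 0<w) (<⇒≤ ε<1) ⟩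
        1# * w                      ≈⟨ *-identityˡ w ⟩
        w                           ∎

    -- All μ(i) lie between 7 w and 9 w, where w = 1 / (8 n).
    M : Carrier
    M = fromℕ 9 * w

    0<M : 0# < M
    0<M = *-pos (0<fromℕ 9) 0<w

    ≤M : ∀ i → prob μ i ≤ M
    ≤M i = begin
      prob μ i                               ≈⟨ solve 2 (λ m u → m := m :- u :+ u) refl (prob μ i) u ⟩
      prob μ i - u + u                       ≤⟨ +-mono-≤ (≤-trans (x≤x⊔y _ _) (distance≤w i)) (≤-reflexive 1/n≈8w) ⟩
      w + fromℕ 8 * w                        ≈⟨ solve 1 (λ w → w :+ con (+ 8) :* w := con (+ 9) :* w) refl w ⟩
      M                                      ∎
      where u = fromℕ n ⁻¹

    7w≤prob : ∀ i → fromℕ 7 * w ≤ prob μ i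
    7w≤prob i = begin
      fromℕ 7 * w                   ≈⟨ solve 1 (λ w → con (+ 7) :* w := con (+ 8) :* w :- w) refl w ⟩
      fromℕ 8 * w - w               ≈⟨ +-congʳ 1/n≈8w ⟨
      u - w                         ≤⟨ ≤-by (w - - (prob μ i - u)) (≤⇒0≤- (≤-trans (x≤y⊔x _ _) (distance≤w i)))
                                         (solve 3 (λ m u w → m := u :- w :+ (w :- (:- (m :- u)))) refl (prob μ i) u w) ⟩
      prob μ i                      ∎
      where u = fromℕ n ⁻¹

    M≤2prob : ∀ i → M ≤ fromℕ 2 * prob μ i
    M≤2prob i = begin
      M                          ≤⟨ ≤-by (fromℕ 5 * w) (0≤* (0≤fromℕ 5) (<⇒≤ 0<w))
                                      (solve 1 (λ w → con (+ 2) :* (con (+ 7) :* w) := con (+ 9) :* w :+ con (+ 5) :* w) refl w) ⟩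
      fromℕ 2 * (fromℕ 7 * w)    ≤⟨ *-monoˡ-≤ (0≤fromℕ 2) (7w≤prob i) ⟩
      fromℕ 2 * prob μ i         ∎

    0<prob : ∀ i → 0# < prob μ i
    0<prob i = begin-strict
      0#           <⟨ *-pos (0<fromℕ 7) 0<w ⟩
      fromℕ 7 * w  ≤⟨ 7w≤prob i ⟩
      prob μ i     ∎

    1≤16·2^K·prob : ∀ K → fromℕ n ≤ 2^ K → ∀ i → 1# ≤ 2^ K * (fromℕ 16 * prob μ i)
    1≤16·2^K·prob K n≤2^K i = begin
      1#                                  ≈⟨ 8nw≈1 ⟨
      fromℕ 8 * fromℕ n * w               ≤⟨ ≤-by (fromℕ 104 * (fromℕ n * w)) (0≤* (0≤fromℕ 104) (0≤* (0≤fromℕ n) (<⇒≤ 0<w)))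
                                              (solve 2 (λ n w → n :* (con (+ 16) :* (con (+ 7) :* w)) := con (+ 8) :* n :* w :+ con (+ 104) :* (n :* w)) refl (fromℕ n) w) ⟩
      fromℕ n * (fromℕ 16 * (fromℕ 7 * w)) ≤⟨ *-mono-≤ (<⇒≤ (0<2^ K)) (0≤* (0≤fromℕ 16) (0≤* (0≤fromℕ 7) (<⇒≤ 0<w)))
                                               n≤2^K (*-monoˡ-≤ (0≤fromℕ 16) (7w≤prob i)) ⟩
      2^ K * (fromℕ 16 * prob μ i)        ∎

  conditional-cong : ∀ {μ ν : Distribution n} → ν ≈ᵈ μ → (∀ i → 0# < prob μ i) →
                     ∀ A h → conditional μ A h ≈ conditional ν A h
  conditional-cong {n} {μ} {ν} ν≈μ 0<μ A@(S , a , a∈S) h = begin-equality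
    conditional μ A h                 ≈⟨ conditional-0<mass μ A 0<mass h ⟩
    restrict S (prob μ) h * mass μ S ⁻¹ ≈⟨ *-cong (sym (restrict-cong S ν≈μ h)) (⁻¹-cong 0<mass (sym mass≈)) ⟩
    restrict S (prob ν) h * mass ν S ⁻¹ ≈⟨ conditional-0<mass ν A 0<mass′ h ⟨
    conditional ν A h                 ∎
    where
    mass≈ : mass ν S ≈ mass μ S
    mass≈ = sum-cong-≋ {n} (restrict-cong S ν≈μ)

    0<mass : 0# < mass μ S
    0<mass = begin-strict
      0#                     <⟨ 0<μ a ⟩
      prob μ a               ≈⟨ restrict-∈ S (prob μ) a∈S ⟨
      restrict S (prob μ) a  ≤⟨ term≤sum (restrict-nonneg S (nonneg μ)) a ⟩
      mass μ S               ∎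

    0<mass′ : 0# < mass ν S
    0<mass′ = begin-strict
      0#        <⟨ 0<mass ⟩
      mass μ S  ≈⟨ mass≈ ⟨
      mass ν S  ∎

  -- R beats the detection probability ε² / (64 (K + 1)) of one run, N is the number
  -- of runs in a block, r the number of samples in a run, and t the total.  Only
  -- the factorisations of R and r matter, not their numerals.
  module SampleCount (K e l : ℕ) where

    abstract
      R : ℕ
      R = 64 ℕ.* suc K ℕ.* (suc e ℕ.* suc e)

      R≈ : fromℕ R ≈ fromℕ 64 * fromℕ (suc K) * (fromℕ (suc e) * fromℕ (suc e))
      R≈ = trans (fromℕ-* (64 ℕ.* suc K) (suc e ℕ.* suc e)) (*-cong (fromℕ-* 64 (suc K)) (fromℕ-* (suc e) (suc e)))

      1≤R : 1 ℕ.≤ R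
      1≤R = ℕ.*-mono-≤ {1} {64 ℕ.* suc K} {1} {suc e ℕ.* suc e}
        (ℕ.*-mono-≤ {1} {64} {1} {suc K} (ℕ.s≤s ℕ.z≤n) (ℕ.s≤s ℕ.z≤n)) (ℕ.s≤s ℕ.z≤n)

    N : ℕ
    N = R ℕ.* (suc l ℕ.+ suc l)

    N≈ : fromℕ N ≈ fromℕ R * (fromℕ (suc l) + fromℕ (suc l))
    N≈ = trans (fromℕ-* R (suc l ℕ.+ suc l)) (*-congˡ (fromℕ-+ (suc l) (suc l)))

    1≤N : 1 ℕ.≤ N
    1≤N = ℕ.*-mono-≤ {1} {R} {1} {suc l ℕ.+ suc l} 1≤R (ℕ.s≤s ℕ.z≤n)

    abstract
      r : ℕ
      r = 2 ℕ.* (36 ℕ.* 36 ℕ.* (N ℕ.* (suc e ℕ.* suc e)))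

      r≈ : fromℕ r ≈ fromℕ 2 * (fromℕ 36 * fromℕ 36 * (fromℕ N * (fromℕ (suc e) * fromℕ (suc e))))
      r≈ = trans (fromℕ-* 2 (36 ℕ.* 36 ℕ.* N*e²)) (*-congˡ (trans (fromℕ-* (36 ℕ.* 36) N*e²)
        (*-cong (fromℕ-* 36 36) (trans (fromℕ-* N (suc e ℕ.* suc e)) (*-congˡ (fromℕ-* (suc e) (suc e)))))))
        where
        N*e² : ℕ
        N*e² = N ℕ.* (suc e ℕ.* suc e)

      1≤r : 1 ℕ.≤ r
      1≤r = ℕ.*-mono-≤ {1} {2} {1} {36 ℕ.* 36 ℕ.* (N ℕ.* (suc e ℕ.* suc e))} (ℕ.s≤s ℕ.z≤n)
        (ℕ.*-mono-≤ {1} {36 ℕ.* 36} {1} {N ℕ.* (suc e ℕ.* suc e)} (ℕ.s≤s ℕ.z≤n)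
          (ℕ.*-mono-≤ {1} {N} {1} {suc e ℕ.* suc e} 1≤N (ℕ.s≤s ℕ.z≤n)))

    t : ℕ
    t = suc l ℕ.* (N ℕ.* r)

    t≈ : fromℕ t ≈ fromℕ (suc l) * (fromℕ N * fromℕ r)
    t≈ = trans (fromℕ-* (suc l) (N ℕ.* r)) (*-congˡ (fromℕ-* N r))

  open SimpleSolver (fromCommutativeRing commutativeRing) _≟_ using ()
    renaming (con to conᴾ; var to varᴾ; _:+_ to _+ᴾ_; _:*_ to _*ᴾ_)

  countᴾ : Polynomial 3
  countᴾ = Z *ᴾ (N *ᴾ r)
    where
    X Y Z R N r : Polynomial 3
    X = varᴾ 0F +ᴾ conᴾ (fromℕ 2)
    Y = varᴾ 1F +ᴾ conᴾ 1#
    Z = varᴾ 2F +ᴾ conᴾ (fromℕ 2)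
    R = conᴾ (fromℕ 64) *ᴾ X *ᴾ (Y *ᴾ Y)
    N = R *ᴾ (Z +ᴾ Z)
    r = conᴾ (fromℕ 2) *ᴾ (conᴾ (fromℕ 36) *ᴾ conᴾ (fromℕ 36) *ᴾ (N *ᴾ (Y *ᴾ Y)))

  t≤countᴾ : ∀ K e l {x y z} → fromℕ K ≤ x + 1# → fromℕ e ≤ y → fromℕ l ≤ z + 1# →
             fromℕ (SampleCount.t K e l) ≤ ⟦ countᴾ ⟧ (x ∷ y ∷ z ∷ [])
  t≤countᴾ K e l {x} {y} {z} K≤ e≤ l≤ = begin
    fromℕ t                              ≈⟨ t≈ ⟩
    fromℕ (suc l) * (fromℕ N * fromℕ r)  ≤⟨ proj₂ (Z ⊗ (N′ ⊗ r′)) ⟩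
    ⟦ countᴾ ⟧ (x ∷ y ∷ z ∷ [])          ∎
    where
    open SampleCount K e l

    infix 4 _≼_
    _≼_ : Carrier → Carrier → Set
    u ≼ v = 0# ≤ u × u ≤ v

    infixr 7 _⊗_
    _⊗_ : ∀ {a b u v} → a ≼ u → b ≼ v → a * b ≼ u * v
    (0≤a , a≤u) ⊗ (0≤b , b≤v) = 0≤* 0≤a 0≤b , *-mono-≤ (≤-trans 0≤a a≤u) 0≤b a≤u b≤v

    suc≼ : ∀ a {u} → fromℕ a ≤ u + 1# → fromℕ (suc a) ≼ u + fromℕ 2
    suc≼ a {u} a≤ = 0≤fromℕ (suc a) , ≤-trans (+-monoʳ-≤ 1# a≤)
      (≤-reflexive (solve 1 (λ u → con (+ 1) :+ (u :+ con (+ 1)) := u :+ con (+ 2)) refl u))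

    constant : ∀ c → fromℕ c ≼ fromℕ c
    constant c = 0≤fromℕ c , ≤-refl

    X : fromℕ (suc K) ≼ x + fromℕ 2
    X = suc≼ K K≤

    Y : fromℕ (suc e) ≼ y + 1#
    Y = 0≤fromℕ (suc e) , ≤-trans (+-monoʳ-≤ 1# e≤) (≤-reflexive (+-comm 1# y))

    Z : fromℕ (suc l) ≼ z + fromℕ 2
    Z = suc≼ l l≤

    N′ : fromℕ N ≼ fromℕ 64 * (x + fromℕ 2) * ((y + 1#) * (y + 1#)) * ((z + fromℕ 2) + (z + fromℕ 2))
    N′ = 0≤fromℕ N , ≤-trans (≤-reflexive (trans N≈ (*-congʳ R≈)))
      (proj₂ (((constant 64 ⊗ X) ⊗ (Y ⊗ Y)) ⊗ (0≤+ (proj₁ Z) (proj₁ Z) , +-mono-≤ (proj₂ Z) (proj₂ Z))))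

    r′ = 0≤fromℕ r , ≤-trans (≤-reflexive r≈)
      (proj₂ (constant 2 ⊗ ((constant 36 ⊗ constant 36) ⊗ (N′ ⊗ (Y ⊗ Y)))))

  module _ (n : ℕ) .{{_ : NonZero n}} (μ : Distribution n) {ε δ : Carrier} (0<ε : 0# < ε) (ε<1 : ε < 1#)
           (close : ‖ μ - uniform n ‖∞ < ε * (fromℕ 8 * fromℕ n) ⁻¹)
           (K e l : ℕ) (n≤2^K : fromℕ n ≤ 2^ K) (1≤eε : 1# ≤ fromℕ (suc e) * ε)
           (1≤2^lδ : 1# ≤ fromℕ 2 ^ suc l * δ) where

    open SampleCount K e l

    private
      -- η is the excess that a random set exhibits, and 2 θ = r η.
      γ η θ z : Carrier
      z = fromℕ 36
      γ = ε * fromℕ 2 ⁻¹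
      η = γ * fromℕ 9 ⁻¹
      θ = fromℕ r * (ε * z ⁻¹)

      0≤ε = <⇒≤ 0<ε

      2γ≈ε : fromℕ 2 * γ ≈ ε
      2γ≈ε = ⁻¹-cancel ε (0<fromℕ 2)

      9η≈γ : fromℕ 9 * η ≈ γ
      9η≈γ = ⁻¹-cancel γ (0<fromℕ 9)

      zθ≈rε : z * θ ≈ fromℕ r * ε
      zθ≈rε = trans (solve 3 (λ z r u → z :* (r :* u) := r :* (z :* u)) refl z (fromℕ r) (ε * z ⁻¹))
        (*-congˡ (⁻¹-cancel ε (0<fromℕ 36)))

      0<γ : 0# < γ
      0<γ = *-pos 0<ε (⁻¹-pos (0<fromℕ 2))

      0≤θ : 0# ≤ θ
      0≤θ = 0≤* (0≤fromℕ r) (0≤* 0≤ε (<⇒≤ (⁻¹-pos (0<fromℕ 36))))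

      2θ≤rη : θ + θ ≤ fromℕ r * η
      2θ≤rη = *-cancelˡ-≤ (0<fromℕ 18) (≤-reflexive (begin-equality
        fromℕ 18 * (θ + θ)                  ≈⟨ solve 1 (λ t → con (+ 18) :* (t :+ t) := con (+ 36) :* t) refl θ ⟩
        z * θ                               ≈⟨ zθ≈rε ⟩
        fromℕ r * ε                         ≈⟨ *-congˡ (trans (*-congˡ 9η≈γ) 2γ≈ε) ⟨
        fromℕ r * (fromℕ 2 * (fromℕ 9 * η)) ≈⟨ solve 2 (λ r h → r :* (con (+ 2) :* (con (+ 9) :* h)) := con (+ 18) :* (r :* h)) refl (fromℕ r) η ⟩
        fromℕ 18 * (fromℕ r * η)            ∎))

      0<z² : 0# < z * z
      0<z² = *-pos (0<fromℕ 36) (0<fromℕ 36)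

      0<r : 0# < fromℕ r
      0<r = 0<fromℕ r {{ℕ.>-nonZero 1≤r}}

      1≤[eε]² : 1# ≤ fromℕ (suc e) * fromℕ (suc e) * (ε * ε)
      1≤[eε]² = begin
        1#         ≈⟨ *-identityˡ 1# ⟨
        1# * 1#    ≤⟨ square-mono-≤ 0≤1 1≤eε ⟩
        fromℕ (suc e) * ε * (fromℕ (suc e) * ε) ≈⟨ solve 2 (λ e x → e :* x :* (e :* x) := e :* e :* (x :* x)) refl (fromℕ (suc e)) ε ⟩
        fromℕ (suc e) * fromℕ (suc e) * (ε * ε) ∎

      -- With 36 θ = r ε the bound on P is 36² / (r ε²), which is at most 1 / (2 N).
      rare : ∀ {P} → 0# ≤ P → θ * θ * P ≤ fromℕ r → fromℕ 2 * (fromℕ N * P) ≤ 1#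
      rare {P} 0≤P θ²P≤r = *-cancelˡ-≤ 0<z² (*-cancelˡ-≤ 0<r (begin
        r′ * (z * z * (two * (N′ * P)))
          ≈⟨ solve 5 (λ r z t n p → r :* (z :* z :* (t :* (n :* p))) := r :* (t :* (z :* z :* n)) :* p :* con (+ 1)) refl r′ z two N′ P ⟩
        r′ * (two * (z * z * N′)) * P * 1#
          ≤⟨ *-monoˡ-≤ (0≤* (0≤* (0≤fromℕ r) (0≤* (0≤fromℕ 2) (0≤* (<⇒≤ 0<z²) (0≤fromℕ N)))) 0≤P) 1≤[eε]² ⟩
        r′ * (two * (z * z * N′)) * P * (e′ * e′ * (ε * ε))
          ≈⟨ solve 7 (λ r z t n p e x → r :* (t :* (z :* z :* n)) :* p :* (e :* e :* (x :* x))
                     := r :* (t :* (z :* z :* (n :* (e :* e)))) :* (x :* x) :* p) refl r′ z two N′ P e′ ε ⟩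
        r′ * (two * (z * z * (N′ * (e′ * e′)))) * (ε * ε) * P
          ≈⟨ *-congʳ (*-congʳ (*-congˡ r≈)) ⟨
        r′ * r′ * (ε * ε) * P
          ≈⟨ solve 3 (λ r x p → r :* r :* (x :* x) :* p := (r :* x) :* (r :* x) :* p) refl r′ ε P ⟩
        (r′ * ε) * (r′ * ε) * P
          ≈⟨ *-congʳ (*-cong zθ≈rε zθ≈rε) ⟨
        (z * θ) * (z * θ) * P
          ≈⟨ solve 3 (λ z t p → z :* t :* (z :* t) :* p := z :* z :* (t :* t :* p)) refl z θ P ⟩
        z * z * (θ * θ * P)
          ≤⟨ *-monoˡ-≤ (<⇒≤ 0<z²) θ²P≤r ⟩
        z * z * r′
          ≈⟨ solve 2 (λ z r → z :* z :* r := r :* (z :* z :* con (+ 1))) refl z r′ ⟩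
        r′ * (z * z * 1#) ∎))
        where
        r′ = fromℕ r
        N′ = fromℕ N
        e′ = fromℕ (suc e)
        two = fromℕ 2

    basicTester : Tester n r
    basicTester = deviationTest μ θ r <$> randomSet μ K

    tester : Tester n t
    tester = amplify (suc l) N basicTester

    private
      Pr-basic : ∀ ν v → Pr ν v basicTester ≈ 𝔼 (randomSet μ K) (λ A → Prᵀ ν v (deviationTest μ θ r A))
      Pr-basic ν v = 𝔼-<$> (deviationTest μ θ r) (randomSet μ K) (Prᵀ ν v)

    tester-accepts : ∀ ν → ν ≈ᵈ μ → 1# - δ ≤ Pr ν accept tester
    tester-accepts ν ν≈μ = amplify-accepts ν basicTester (suc l) N 1≤2^lδ
      (rare (Pr-nonneg ν reject basicTester) (begin
        θ * θ * Pr ν reject basicTester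
          ≈⟨ *-congˡ (Pr-basic ν reject) ⟩
        θ * θ * 𝔼 (randomSet μ K) (λ A → Prᵀ ν reject (deviationTest μ θ r A))
          ≈⟨ 𝔼-* (randomSet μ K) (θ * θ) _ ⟨
        𝔼 (randomSet μ K) (λ A → θ * θ * Prᵀ ν reject (deviationTest μ θ r A))
          ≤⟨ 𝔼-mono (randomSet μ K) (λ A → deviationTest-sound μ ν θ r A
               (conditional-cong {_} {μ} {ν} ν≈μ (0<prob n μ 0<ε ε<1 close) A)) ⟩
        𝔼 (randomSet μ K) (λ _ → fromℕ r)
          ≈⟨ 𝔼-const (randomSet μ K) (fromℕ r) ⟩
        fromℕ r ∎))

    tester-rejects : ∀ ν → ε ≤ variationDistance μ ν → 1# - δ ≤ Pr ν reject tester
    tester-rejects ν far = amplify-rejects ν basicTester (suc l) R 1≤2^lδ (begin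
      1#
        ≤⟨ 1≤[eε]² ⟩
      e′ * e′ * (ε * ε)
        ≤⟨ *-monoˡ-≤ (0≤* (0≤fromℕ (suc e)) (0≤fromℕ (suc e)))
             (randomSet-detects μ ν 0<γ 2γ≤1 (0<M n μ 0<ε ε<1 close) (≤M n μ 0<ε ε<1 close) (M≤2prob n μ 0<ε ε<1 close)
               2γ≈ε far 9η≈γ K (1≤16·2^K·prob n μ 0<ε ε<1 close K n≤2^K) c 0≤c excess⇒1≤c 0≤ε) ⟩
      e′ * e′ * (fromℕ 32 * (fromℕ (suc K) * 𝔼 (randomSet μ K) c))
        ≈⟨ *-congˡ (*-congˡ (*-congˡ (trans (𝔼-* (randomSet μ K) (fromℕ 2) _) (*-congˡ (sym (Pr-basic ν reject)))))) ⟩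
      e′ * e′ * (fromℕ 32 * (fromℕ (suc K) * (fromℕ 2 * P)))
        ≈⟨ solve 3 (λ e k p → e :* e :* (con (+ 32) :* (k :* (con (+ 2) :* p))) := con (+ 64) :* k :* (e :* e) :* p) refl e′ (fromℕ (suc K)) P ⟩
      fromℕ 64 * fromℕ (suc K) * (e′ * e′) * P
        ≈⟨ *-congʳ R≈ ⟨
      fromℕ R * P ∎)
      where
      e′ = fromℕ (suc e)
      P = Pr ν reject basicTester

      2γ≤1 : fromℕ 2 * γ ≤ 1#
      2γ≤1 = ≤-trans (≤-reflexive 2γ≈ε) (<⇒≤ ε<1)

      rej acc c : ConditioningSet n → Carrier
      rej A = Prᵀ ν reject (deviationTest μ θ r A)
      acc A = Prᵀ ν accept (deviationTest μ θ r A)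
      c A = fromℕ 2 * rej A

      0≤c : ∀ A → 0# ≤ c A
      0≤c A = 0≤* (0≤fromℕ 2) (Prᵀ-nonneg ν reject (deviationTest μ θ r A))

      excess⇒1≤c : ∀ A h → conditional μ A h + η ≤ conditional ν A h → 1# ≤ c A
      excess⇒1≤c A h p+η≤q = begin
        1#
          ≤⟨ ≤-by (1# - fromℕ 2 * acc A) (≤⇒0≤- 2acc≤1)
               (solve 1 (λ a → con (+ 2) :* (con (+ 1) :- a) := con (+ 1) :+ (con (+ 1) :- con (+ 2) :* a)) refl (acc A)) ⟩
        fromℕ 2 * (1# - acc A)
          ≈⟨ *-congˡ (+-congʳ (Prᵀ-total ν (deviationTest μ θ r A))) ⟨
        fromℕ 2 * (acc A + rej A - acc A)
          ≈⟨ solve 2 (λ a b → con (+ 2) :* (a :+ b :- a) := con (+ 2) :* b) refl (acc A) (rej A) ⟩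
        c A ∎
        where
        0≤acc = Prᵀ-nonneg ν accept (deviationTest μ θ r A)

        2acc≤1 : fromℕ 2 * acc A ≤ 1#
        2acc≤1 = begin
          fromℕ 2 * acc A              ≈⟨ *-congˡ (*-identityˡ _) ⟨
          fromℕ 2 * (1# * acc A)       ≤⟨ *-monoˡ-≤ (0≤fromℕ 2) (*-monoʳ-≤ 0≤acc (1≤fromℕ N {{ℕ.>-nonZero 1≤N}})) ⟩
          fromℕ 2 * (fromℕ N * acc A)  ≤⟨ rare 0≤acc (deviationTest-complete μ ν r A h 0≤θ 2θ≤rη p+η≤q) ⟩
          1#                           ∎

  IsIdentityTest : (ε δ : Carrier) → Distribution n → ∀ {t} → NonAdaptiveAlgorithm n t → Set
  IsIdentityTest {n} ε δ μ alg = (μ′ : Distribution n) →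
    (μ′ ≈ᵈ μ → 1# - δ ≤ Pr[ alg , μ′ ⇒ accept ]) ×
    (ε ≤ variationDistance μ μ′ → 1# - δ ≤ Pr[ alg , μ′ ⇒ reject ])

  module _ (n : ℕ) .{{_ : NonZero n}} (μ : Distribution n) {ε δ : Carrier} (0<ε : 0# < ε) (ε<1 : ε < 1#)
           (close : ‖ μ - uniform n ‖∞ < ε * (fromℕ 8 * fromℕ n) ⁻¹) where

    private
      tester-is-test : ∀ K e l n≤2^K 1≤eε 1≤2^lδ →
        IsIdentityTest ε δ μ (algorithm (tester n μ {ε} {δ} 0<ε ε<1 close K e l n≤2^K 1≤eε 1≤2^lδ))
      tester-is-test K e l n≤2^K 1≤eε 1≤2^lδ μ′ =
        (λ μ′≈μ → ≤-trans (tester-accepts n μ 0<ε ε<1 close K e l n≤2^K 1≤eε 1≤2^lδ μ′ μ′≈μ)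
          (≤-reflexive (sym (Pr-algorithm X μ′ accept)))) ,
        (λ far → ≤-trans (tester-rejects n μ 0<ε ε<1 close K e l n≤2^K 1≤eε 1≤2^lδ μ′ far)
          (≤-reflexive (sym (Pr-algorithm X μ′ reject))))
        where X = tester n μ {ε} {δ} 0<ε ε<1 close K e l n≤2^K 1≤eε 1≤2^lδ

    identityTest : (0<δ : 0# < δ) → ∀ {logn logδ⁻¹} →
      (∃ λ K → fromℕ n ≤ fromℕ 2 ^ K × fromℕ K ≤ logn + 1#) →
      (∃ λ e → fromℕ e ≤ ε ⁻¹ × ε ⁻¹ < fromℕ (suc e)) →
      (∃ λ l → δ ⁻¹ ≤ fromℕ 2 ^ l × fromℕ l ≤ logδ⁻¹ + 1#) →
      ∃ λ t → fromℕ t ≤ ⟦ countᴾ ⟧ (logn ∷ ε ⁻¹ ∷ logδ⁻¹ ∷ []) ×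
      Σ (NonAdaptiveAlgorithm n t) (IsIdentityTest ε δ μ)
    identityTest 0<δ (K , n≤2^K , K≤) (e , e≤ , 1/ε<1+e) (l , 1/δ≤2^l , l≤) =
      SampleCount.t K e l , t≤countᴾ K e l K≤ e≤ l≤ ,
      algorithm (tester n μ 0<ε ε<1 close K e l n≤2^K′ 1≤eε 1≤2^lδ) ,
      tester-is-test K e l n≤2^K′ 1≤eε 1≤2^lδ
      where
      1≤eε : 1# ≤ fromℕ (suc e) * ε
      1≤eε = begin
        1#                 ≈⟨ *-inverseʳ (pos⇒≉0 0<ε) ⟨
        ε * ε ⁻¹           ≤⟨ *-monoˡ-≤ (<⇒≤ 0<ε) (<⇒≤ 1/ε<1+e) ⟩
        ε * fromℕ (suc e)  ≈⟨ *-comm _ _ ⟩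
        fromℕ (suc e) * ε  ∎

      1≤2^lδ : 1# ≤ fromℕ 2 ^ suc l * δ
      1≤2^lδ = begin
        1#                    ≈⟨ *-inverseʳ (pos⇒≉0 0<δ) ⟨
        δ * δ ⁻¹              ≈⟨ *-comm _ _ ⟩
        δ ⁻¹ * δ              ≤⟨ *-monoʳ-≤ (<⇒≤ 0<δ) 1/δ≤2^l ⟩
        fromℕ 2 ^ l * δ       ≤⟨ ≤-by (fromℕ 2 ^ l * δ) (0≤* (0≤^ l (0≤fromℕ 2)) (<⇒≤ 0<δ))
                                   (solve 2 (λ x d → con (+ 2) :* x :* d := x :* d :+ x :* d) refl (fromℕ 2 ^ l) δ) ⟩
        fromℕ 2 ^ suc l * δ   ∎

      n≤2^K′ : fromℕ n ≤ 2^ K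
      n≤2^K′ = ≤-trans n≤2^K (≤-reflexive (sym (fromℕ-^ 2 K)))

-- Non-adaptive identity testing near uniform

theorem4p1p2 : (ℝ : Reals) → let open Testing ℝ in
    ∃ λ (p : Polynomial 3) →
    (ε δ : Carrier) → 0# < ε → ε < 1# → (0<δ : 0# < δ) (δ<1 : δ < 1#) →
    (n : ℕ) .{{_ : NonZero n}} (μ : Distribution n) →
    ‖ μ - uniform n ‖∞ < ε * (fromℕ 8 * fromℕ n) ⁻¹ →
    ∃ λ t →
    fromℕ t ≤ ⟦ p ⟧ (log₂ (fromℕ n) (1≤fromℕ n) ∷ ε ⁻¹ ∷ log₂ (δ ⁻¹) (1≤⁻¹ 0<δ δ<1) ∷ []) ×
    Σ (NonAdaptiveAlgorithm n t) λ alg →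
    (μ′ : Distribution n) →
    (μ′ ≈ᵈ μ → 1# - δ ≤ Pr[ alg , μ′ ⇒ accept ]) ×
    (ε ≤ variationDistance μ μ′ → 1# - δ ≤ Pr[ alg , μ′ ⇒ reject ])
theorem4p1p2 ℝ = countᴾ , λ ε δ 0<ε ε<1 0<δ δ<1 n μ close →
  identityTest n μ 0<ε ε<1 close 0<δ
    (⌈log₂⌉ (fromℕ n) (1≤fromℕ n))
    (archimedean (ε ⁻¹) (<⇒≤ (⁻¹-pos 0<ε)))
    (⌈log₂⌉ (δ ⁻¹) (1≤⁻¹ 0<δ δ<1))
  where
  open Reals ℝ
  open OrderedField ℝ
  open IdentityTester ℝ
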